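{- Let $W$ be an irreducible complex reflection group, and let $T$ be the set of all reflections in $W$. Then the Cayley graph $\Gamma(W,T)$ is distance integral; that is, every eigenvalue of its distance matrix is an integer.
   Context: Let $V$ be a finite-dimensional complex vector space of dimension $n$. A reflection on $V$ is a linear transformation of $V$ of finite order whose eigenspace for eigenvalue $1$ has dimension $n-1$. A complex reflection group $W$ on $V$ is a finite subgroup of $\mathrm{GL}(V)$ generated by reflections (and $V$ carries a $W$-invariant hermitian form). It is irreducible if it acts irreducibly on the orthogonal complement of its fixed point space (the fixed point space may be zero). The set $T$ of all reflections in $W$ generates $W$ and is closed under inversion and conjugation. The (left) Cayley graph $\Gamma(W,T)$ is the undirected graph with vertex set $W$ and an edge joining $g$ and $tg$ for each $g\in W$, $t\in T$. Its distance matrix $D$ has rows and columns indexed by $W$, with $(g,h)$-entry the minimal length of a path from $g$ to $h$ in $\Gamma(W,T)$. A graph is distance integral if all eigenvalues of its distance matrix are integers. -}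

module Defs where

open import Algebra.Bundles using (Group; Ring; CommutativeRing)
import Algebra.Definitions.RawMonoid as RawMonoidDefinitions
open import Algebra.Module.Bundles using (LeftModule)
import Algebra.Module.Morphism.Construct.Composition as Composition
import Algebra.Module.Morphism.Construct.Identity as Identity
open import Algebra.Module.Morphism.Structures using (module LeftModuleMorphisms)
open import Data.Fin.Base using (Fin)
open import Data.Integer.Base as ℤ using (ℤ)
open import Data.Nat.Base as ℕ using (ℕ; zero; suc; _⊔_)
import Data.Nat.Properties as ℕₚ
open import Data.Product.Base using (∃; _×_; _,_; proj₁; proj₂)
open import Data.Rational.Base as ℚ using (ℚ; 0ℚ; 1ℚ; ½; ∣_∣)
import Data.Rational.Properties as ℚₚ
open import Data.Rational.Solver using (module +-*-Solver)
open import Data.Sum.Base using (_⊎_)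
open import Function.Base using (_on_)
open import Level using (Level; 0ℓ) renaming (suc to lsuc; _⊔_ to _⊔ˡ_)
open import Relation.Binary.Construct.Closure.Symmetric using (SymClosure)
open import Relation.Binary.Core using (Rel)
open import Relation.Binary.PropositionalEquality using (_≡_; refl; sym; trans; cong; cong₂; subst)
open import Relation.Unary using (Pred; _⊆_; U)

------------------------------------------------------------------------
-- Real numbers: Cauchy sequences of rationals (each carrying its modulus
-- of convergence), up to having difference tending to zero.  Without eta, and
-- with the operations below defined by copatterns, x +ᴿ y and the like do not
-- unfold, which lets unification solve for their arguments.

record ℝ : Set where
  no-eta-equality
  field
    seq    : ℕ → ℚ
    cauchy : ∀ ε → 0ℚ ℚ.< ε →
             ∃ λ N → ∀ m n → N ℕ.≤ m → N ℕ.≤ n → ∣ seq m ℚ.- seq n ∣ ℚ.≤ ε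

open ℝ public

infix 4 _≃_ _<_ _#ᴿ_

record _≃_ (x y : ℝ) : Set where
  constructor mk≃
  field
    close : ∀ ε → 0ℚ ℚ.< ε →
            ∃ λ N → ∀ n → N ℕ.≤ n → ∣ seq x n ℚ.- seq y n ∣ ℚ.≤ ε

open _≃_ public

_<_ : ℝ → ℝ → Set
x < y = ∃ λ ε → 0ℚ ℚ.< ε × ∃ λ N → ∀ n → N ℕ.≤ n → ε ℚ.≤ seq y n ℚ.- seq x n

-- Apartness, the positive form of inequality.

_#ᴿ_ : ℝ → ℝ → Set
x #ᴿ y = x < y ⊎ y < x

-- Vanishing of a family of rationals along a height function.  It covers
-- both the Cauchy condition (pairs of indices, with the minimum as height)
-- and the equality of reals (single indices).

module Vanishing {I : Set} (height : I → ℕ) where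

  Vanishes : (I → ℚ) → Set
  Vanishes f = ∀ ε → 0ℚ ℚ.< ε → ∃ λ N → ∀ i → N ℕ.≤ height i → ∣ f i ∣ ℚ.≤ ε

  Bounded : (I → ℚ) → Set
  Bounded f = ∃ λ K → 0ℚ ℚ.< K × ∃ λ N → ∀ i → N ℕ.≤ height i → ∣ f i ∣ ℚ.≤ K

  vanishes-zero : ∀ {f} → (∀ i → f i ≡ 0ℚ) → Vanishes f
  vanishes-zero eq ε ε>0 =
    0 , λ i _ → subst (ℚ._≤ ε) (sym (cong ∣_∣ (eq i))) (ℚₚ.<⇒≤ ε>0)

  vanishes-cong : ∀ {f g} → (∀ i → f i ≡ g i) → Vanishes f → Vanishes g
  vanishes-cong eq vf ε ε>0 with vf ε ε>0
  ... | N , h = N , λ i N≤i → subst (λ q → ∣ q ∣ ℚ.≤ ε) (eq i) (h i N≤i)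

  vanishes-neg : ∀ {f} → Vanishes f → Vanishes (λ i → ℚ.- f i)
  vanishes-neg {f} vf ε ε>0 with vf ε ε>0
  ... | N , h = N , λ i N≤i → subst (ℚ._≤ ε) (sym (ℚₚ.∣-p∣≡∣p∣ (f i))) (h i N≤i)

  vanishes-+ : ∀ {f g} → Vanishes f → Vanishes g → Vanishes (λ i → f i ℚ.+ g i)
  vanishes-+ {f} {g} vf vg ε ε>0 with vf (½ ℚ.* ε) ½ε>0 | vg (½ ℚ.* ε) ½ε>0
    where
    ½ε>0 : 0ℚ ℚ.< ½ ℚ.* ε
    ½ε>0 = subst (ℚ._< ½ ℚ.* ε) (ℚₚ.*-zeroʳ ½) (ℚₚ.*-monoʳ-<-pos ½ ε>0)
  ... | N , h | M , k = N ⊔ M , λ i le →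
    ℚₚ.≤-trans (ℚₚ.∣p+q∣≤∣p∣+∣q∣ (f i) (g i))
      (subst (∣ f i ∣ ℚ.+ ∣ g i ∣ ℚ.≤_) halves
        (ℚₚ.+-mono-≤ (h i (ℕₚ.≤-trans (ℕₚ.m≤m⊔n N M) le))
                     (k i (ℕₚ.≤-trans (ℕₚ.m≤n⊔m N M) le))))
    where
    halves : ½ ℚ.* ε ℚ.+ ½ ℚ.* ε ≡ ε
    halves = trans (sym (ℚₚ.*-distribʳ-+ ε ½ ½)) (ℚₚ.*-identityˡ ε)

  vanishes-* : ∀ {f g} → Bounded f → Vanishes g → Vanishes (λ i → f i ℚ.* g i)
  vanishes-* {f} {g} (K , K>0 , N , h) vg ε ε>0 with vg δ δ>0
    where
    instance
      K-positive : ℚ.Positive K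
      K-positive = ℚ.positive K>0
      K-nonZero : ℚ.NonZero K
      K-nonZero = ℚₚ.pos⇒nonZero K
      K⁻¹-positive : ℚ.Positive (ℚ.1/ K)
      K⁻¹-positive = ℚₚ.1/pos⇒pos K
    δ = ℚ.1/ K ℚ.* ε
    δ>0 : 0ℚ ℚ.< δ
    δ>0 = subst (ℚ._< δ) (ℚₚ.*-zeroʳ (ℚ.1/ K)) (ℚₚ.*-monoʳ-<-pos (ℚ.1/ K) ε>0)
  ... | M , k = N ⊔ M , λ i le → begin
    ∣ f i ℚ.* g i ∣          ≡⟨ ℚₚ.∣p*q∣≡∣p∣*∣q∣ (f i) (g i) ⟩
    ∣ f i ∣ ℚ.* ∣ g i ∣      ≤⟨ ℚₚ.*-monoʳ-≤-nonNeg ∣ g i ∣ {{ℚₚ.∣-∣-nonNeg (g i)}}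
                                  (h i (ℕₚ.≤-trans (ℕₚ.m≤m⊔n N M) le)) ⟩
    K ℚ.* ∣ g i ∣            ≤⟨ ℚₚ.*-monoˡ-≤-nonNeg K {{ℚₚ.pos⇒nonNeg K}}
                                  (k i (ℕₚ.≤-trans (ℕₚ.m≤n⊔m N M) le)) ⟩
    K ℚ.* (ℚ.1/ K ℚ.* ε)     ≡⟨ ℚₚ.*-assoc K (ℚ.1/ K) ε ⟨
    K ℚ.* ℚ.1/ K ℚ.* ε       ≡⟨ cong (ℚ._* ε) (ℚₚ.*-inverseʳ K) ⟩
    1ℚ ℚ.* ε                 ≡⟨ ℚₚ.*-identityˡ ε ⟩
    ε                        ∎
    where
    open ℚₚ.≤-Reasoning
    instance
      K-positive : ℚ.Positive K
      K-positive = ℚ.positive K>0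
      K-nonZero : ℚ.NonZero K
      K-nonZero = ℚₚ.pos⇒nonZero K

open module V₁ = Vanishing {ℕ} (λ n → n)
  using (Bounded)

minIndex : ℕ × ℕ → ℕ
minIndex (m , n) = m ℕ.⊓ n

module V₂ = Vanishing minIndex

open +-*-Solver using (solve; con; _:=_; _:+_; _:*_; _:-_; :-_)

cauchy₂ : (x : ℝ) → V₂.Vanishes (λ p → seq x (proj₁ p) ℚ.- seq x (proj₂ p))
cauchy₂ x ε ε>0 with cauchy x ε ε>0
... | N , h = N , λ { (m , n) le → h m n (ℕₚ.≤-trans le (ℕₚ.m⊓n≤m m n))
                                         (ℕₚ.≤-trans le (ℕₚ.m⊓n≤n m n)) }

curried : (s : ℕ → ℚ) → V₂.Vanishes (λ p → s (proj₁ p) ℚ.- s (proj₂ p)) →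
            ∀ ε → 0ℚ ℚ.< ε →
            ∃ λ N → ∀ m n → N ℕ.≤ m → N ℕ.≤ n → ∣ s m ℚ.- s n ∣ ℚ.≤ ε
curried s v ε ε>0 = proj₁ (v ε ε>0) , λ m n N≤m N≤n →
  proj₂ (v ε ε>0) (m , n) (ℕₚ.⊓-glb N≤m N≤n)

bounded : (x : ℝ) → Bounded (seq x)
bounded x with cauchy x 1ℚ (ℚₚ.positive⁻¹ 1ℚ)
... | N , h = ∣ seq x N ∣ ℚ.+ 1ℚ
            , ℚₚ.+-mono-≤-< (ℚₚ.0≤∣p∣ (seq x N)) (ℚₚ.positive⁻¹ 1ℚ)
            , N , λ n N≤n → ℚₚ.≤-trans
                (subst (λ q → ∣ q ∣ ℚ.≤ ∣ seq x N ∣ ℚ.+ ∣ seq x n ℚ.- seq x N ∣)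
                  (solve 2 (λ a b → a :+ (b :- a) := b) refl (seq x N) (seq x n))
                  (ℚₚ.∣p+q∣≤∣p∣+∣q∣ (seq x N) (seq x n ℚ.- seq x N)))
                (ℚₚ.+-monoʳ-≤ ∣ seq x N ∣ (h n N N≤n ℕₚ.≤-refl))

bounded₂ : (π : ℕ × ℕ → ℕ) → (∀ p → minIndex p ℕ.≤ π p) →
           (x : ℝ) → V₂.Bounded (λ p → seq x (π p))
bounded₂ π minIndex≤π x = weaken (bounded x)
  where
  weaken : Bounded (seq x) → V₂.Bounded (λ p → seq x (π p))
  weaken (K , K>0 , N , h) = K , K>0 , N , λ p le → h (π p) (ℕₚ.≤-trans le (minIndex≤π p))

infix  8 -ᴿ_
infixl 7 _*ᴿ_
infixl 6 _+ᴿ_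

fromℚ : ℚ → ℝ
seq (fromℚ q) _ = q
cauchy (fromℚ q) = curried (λ _ → q) (V₂.vanishes-zero λ _ → ℚₚ.+-inverseʳ q)

_+ᴿ_ : ℝ → ℝ → ℝ
seq (x +ᴿ y) n = seq x n ℚ.+ seq y n
cauchy (x +ᴿ y) = curried (λ n → seq x n ℚ.+ seq y n)
  (V₂.vanishes-cong
    (λ (m , n) → solve 4 (λ a b c d → (a :- b) :+ (c :- d) := (a :+ c) :- (b :+ d)) refl
      (seq x m) (seq x n) (seq y m) (seq y n))
    (V₂.vanishes-+ (cauchy₂ x) (cauchy₂ y)))

-ᴿ_ : ℝ → ℝ
seq (-ᴿ x) n = ℚ.- seq x n
cauchy (-ᴿ x) = curried (λ n → ℚ.- seq x n)
  (V₂.vanishes-cong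
    (λ (m , n) → solve 2 (λ a b → :- (a :- b) := (:- a) :- (:- b)) refl (seq x m) (seq x n))
    (V₂.vanishes-neg (cauchy₂ x)))

_*ᴿ_ : ℝ → ℝ → ℝ
seq (x *ᴿ y) n = seq x n ℚ.* seq y n
cauchy (x *ᴿ y) = curried (λ n → seq x n ℚ.* seq y n)
  (V₂.vanishes-cong
    (λ (m , n) → solve 4 (λ a b c d → a :* (c :- d) :+ d :* (a :- b) := a :* c :- b :* d) refl
      (seq x m) (seq x n) (seq y m) (seq y n))
    (V₂.vanishes-+
      (V₂.vanishes-* (bounded₂ proj₁ (λ (m , n) → ℕₚ.m⊓n≤m m n) x) (cauchy₂ y))
      (V₂.vanishes-* (bounded₂ proj₂ (λ (m , n) → ℕₚ.m⊓n≤n m n) y) (cauchy₂ x))))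

≗⇒≃ : ∀ {x y} → (∀ n → seq x n ≡ seq y n) → x ≃ y
≗⇒≃ {x} {y} eq = mk≃ (V₁.vanishes-zero λ n →
  trans (cong (ℚ._- seq y n) (eq n)) (ℚₚ.+-inverseʳ (seq y n)))

≃-refl : ∀ {x} → x ≃ x
≃-refl = ≗⇒≃ λ _ → refl

≃-sym : ∀ {x y} → x ≃ y → y ≃ x
≃-sym {x} {y} p = mk≃ (V₁.vanishes-cong
  (λ n → solve 2 (λ a b → :- (a :- b) := b :- a) refl (seq x n) (seq y n))
  (V₁.vanishes-neg (close p)))

≃-trans : ∀ {x y z} → x ≃ y → y ≃ z → x ≃ z
≃-trans {x} {y} {z} p q = mk≃ (V₁.vanishes-cong
  (λ n → solve 3 (λ a b c → (a :- b) :+ (b :- c) := a :- c) refl (seq x n) (seq y n) (seq z n))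
  (V₁.vanishes-+ (close p) (close q)))

+ᴿ-cong : ∀ {x y u v} → x ≃ y → u ≃ v → x +ᴿ u ≃ y +ᴿ v
+ᴿ-cong {x} {y} {u} {v} p q = mk≃ (V₁.vanishes-cong
  (λ n → solve 4 (λ a b c d → (a :- b) :+ (c :- d) := (a :+ c) :- (b :+ d)) refl
    (seq x n) (seq y n) (seq u n) (seq v n))
  (V₁.vanishes-+ (close p) (close q)))

-ᴿ-cong : ∀ {x y} → x ≃ y → -ᴿ x ≃ -ᴿ y
-ᴿ-cong {x} {y} p = mk≃ (V₁.vanishes-cong
  (λ n → solve 2 (λ a b → :- (a :- b) := (:- a) :- (:- b)) refl (seq x n) (seq y n))
  (V₁.vanishes-neg (close p)))

*ᴿ-cong : ∀ {x y u v} → x ≃ y → u ≃ v → x *ᴿ u ≃ y *ᴿ v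
*ᴿ-cong {x} {y} {u} {v} p q = mk≃ (V₁.vanishes-cong
  (λ n → solve 4 (λ a b c d → a :* (c :- d) :+ d :* (a :- b) := a :* c :- b :* d) refl
    (seq x n) (seq y n) (seq u n) (seq v n))
  (V₁.vanishes-+ (V₁.vanishes-* (bounded x) (close q)) (V₁.vanishes-* (bounded v) (close p))))

0ᴿ 1ᴿ : ℝ
0ᴿ = fromℚ 0ℚ
1ᴿ = fromℚ 1ℚ

------------------------------------------------------------------------
-- Complex numbers

record ℂ : Set where
  no-eta-equality
  field
    re im : ℝ

open ℂ public

infix 4 _≈ᶜ_ _#ᶜ_

record _≈ᶜ_ (x y : ℂ) : Set where
  constructor _,ᶜ_
  field
    re≃ : re x ≃ re y
    im≃ : im x ≃ im y

open _≈ᶜ_ public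

_#ᶜ_ : ℂ → ℂ → Set
x #ᶜ y = re x #ᴿ re y ⊎ im x #ᴿ im y

infix  8 -ᶜ_
infixl 7 _*ᶜ_
infixl 6 _+ᶜ_

_+ᶜ_ _*ᶜ_ : ℂ → ℂ → ℂ
re (x +ᶜ y) = re x +ᴿ re y
im (x +ᶜ y) = im x +ᴿ im y
re (x *ᶜ y) = re x *ᴿ re y +ᴿ -ᴿ (im x *ᴿ im y)
im (x *ᶜ y) = re x *ᴿ im y +ᴿ im x *ᴿ re y

-ᶜ_ conj : ℂ → ℂ
re (-ᶜ x) = -ᴿ re x
im (-ᶜ x) = -ᴿ im x
re (conj x) = re x
im (conj x) = -ᴿ im x

fromℤ : ℤ → ℂ
re (fromℤ k) = fromℚ (k ℚ./ 1)
im (fromℤ k) = 0ᴿ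

0ᶜ 1ᶜ : ℂ
re 0ᶜ = 0ᴿ
im 0ᶜ = 0ᴿ
re 1ᶜ = 1ᴿ
im 1ᶜ = 0ᴿ

private
  *ᶜ-assoc : ∀ x y z → (x *ᶜ y) *ᶜ z ≈ᶜ x *ᶜ (y *ᶜ z)
  *ᶜ-assoc x y z =
    ≗⇒≃ (λ n → solve 6 (λ a b c d e f →
        (a :* c :+ :- (b :* d)) :* e :+ :- ((a :* d :+ b :* c) :* f)
        := a :* (c :* e :+ :- (d :* f)) :+ :- (b :* (c :* f :+ d :* e))) refl
        (seq (re x) n) (seq (im x) n) (seq (re y) n) (seq (im y) n) (seq (re z) n) (seq (im z) n))
    ,ᶜ
    ≗⇒≃ (λ n → solve 6 (λ a b c d e f →
        (a :* c :+ :- (b :* d)) :* f :+ (a :* d :+ b :* c) :* e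
        := a :* (c :* f :+ d :* e) :+ b :* (c :* e :+ :- (d :* f))) refl
        (seq (re x) n) (seq (im x) n) (seq (re y) n) (seq (im y) n) (seq (re z) n) (seq (im z) n))

  *ᶜ-comm : ∀ x y → x *ᶜ y ≈ᶜ y *ᶜ x
  *ᶜ-comm x y =
    ≗⇒≃ (λ n → solve 4 (λ a b c d →
        a :* c :+ :- (b :* d) := c :* a :+ :- (d :* b)) refl
        (seq (re x) n) (seq (im x) n) (seq (re y) n) (seq (im y) n))
    ,ᶜ
    ≗⇒≃ (λ n → solve 4 (λ a b c d →
        a :* d :+ b :* c := c :* b :+ d :* a) refl
        (seq (re x) n) (seq (im x) n) (seq (re y) n) (seq (im y) n))

  *ᶜ-identityˡ : ∀ x → 1ᶜ *ᶜ x ≈ᶜ x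
  *ᶜ-identityˡ x =
    ≗⇒≃ (λ n → solve 2 (λ a b →
        con 1ℚ :* a :+ :- (con 0ℚ :* b) := a) refl (seq (re x) n) (seq (im x) n))
    ,ᶜ
    ≗⇒≃ (λ n → solve 2 (λ a b →
        con 1ℚ :* b :+ con 0ℚ :* a := b) refl (seq (re x) n) (seq (im x) n))

  *ᶜ-distribˡ : ∀ x y z → x *ᶜ (y +ᶜ z) ≈ᶜ x *ᶜ y +ᶜ x *ᶜ z
  *ᶜ-distribˡ x y z =
    ≗⇒≃ (λ n → solve 6 (λ a b c d e f →
        a :* (c :+ e) :+ :- (b :* (d :+ f))
        := (a :* c :+ :- (b :* d)) :+ (a :* e :+ :- (b :* f))) refl
        (seq (re x) n) (seq (im x) n) (seq (re y) n) (seq (im y) n) (seq (re z) n) (seq (im z) n))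
    ,ᶜ
    ≗⇒≃ (λ n → solve 6 (λ a b c d e f →
        a :* (d :+ f) :+ b :* (c :+ e)
        := (a :* d :+ b :* c) :+ (a :* f :+ b :* e)) refl
        (seq (re x) n) (seq (im x) n) (seq (re y) n) (seq (im y) n) (seq (re z) n) (seq (im z) n))

  *ᶜ-cong : ∀ {x y u v} → x ≈ᶜ y → u ≈ᶜ v → x *ᶜ u ≈ᶜ y *ᶜ v
  *ᶜ-cong (p ,ᶜ q) (r ,ᶜ s) =
    +ᴿ-cong (*ᴿ-cong p r) (-ᴿ-cong (*ᴿ-cong q s))
    ,ᶜ +ᴿ-cong (*ᴿ-cong p s) (*ᴿ-cong q r)

  ≈ᶜ-trans : ∀ {x y z} → x ≈ᶜ y → y ≈ᶜ z → x ≈ᶜ z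
  ≈ᶜ-trans (p ,ᶜ q) (r ,ᶜ s) = ≃-trans p r ,ᶜ ≃-trans q s

ℂ-commutativeRing : CommutativeRing 0ℓ 0ℓ
ℂ-commutativeRing = record
  { Carrier = ℂ
  ; _≈_     = _≈ᶜ_
  ; _+_     = _+ᶜ_
  ; _*_     = _*ᶜ_
  ; -_      = -ᶜ_
  ; 0#      = 0ᶜ
  ; 1#      = 1ᶜ
  ; isCommutativeRing = record
    { isRing = record
      { +-isAbelianGroup = record
        { isGroup = record
          { isMonoid = record
            { isSemigroup = record
              { isMagma = record
                { isEquivalence = record
                  { refl  = ≃-refl ,ᶜ ≃-refl
                  ; sym   = λ (p ,ᶜ q) → ≃-sym p ,ᶜ ≃-sym q
                  ; trans = ≈ᶜ-trans
                  }
                ; ∙-cong = λ (p ,ᶜ q) (r ,ᶜ s) → +ᴿ-cong p r ,ᶜ +ᴿ-cong q s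
                }
              ; assoc = λ x y z →
                  ≗⇒≃ (λ n → ℚₚ.+-assoc (seq (re x) n) (seq (re y) n) (seq (re z) n))
                  ,ᶜ ≗⇒≃ (λ n → ℚₚ.+-assoc (seq (im x) n) (seq (im y) n) (seq (im z) n))
              }
            ; identity =
                (λ x → ≗⇒≃ (λ n → ℚₚ.+-identityˡ (seq (re x) n))
                              ,ᶜ ≗⇒≃ (λ n → ℚₚ.+-identityˡ (seq (im x) n)))
              , (λ x → ≗⇒≃ (λ n → ℚₚ.+-identityʳ (seq (re x) n))
                              ,ᶜ ≗⇒≃ (λ n → ℚₚ.+-identityʳ (seq (im x) n)))
            }
          ; inverse =
              (λ x → ≗⇒≃ (λ n → ℚₚ.+-inverseˡ (seq (re x) n))
                            ,ᶜ ≗⇒≃ (λ n → ℚₚ.+-inverseˡ (seq (im x) n)))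
            , (λ x → ≗⇒≃ (λ n → ℚₚ.+-inverseʳ (seq (re x) n))
                            ,ᶜ ≗⇒≃ (λ n → ℚₚ.+-inverseʳ (seq (im x) n)))
          ; ⁻¹-cong = λ (p ,ᶜ q) → -ᴿ-cong p ,ᶜ -ᴿ-cong q
          }
        ; comm = λ x y →
            ≗⇒≃ (λ n → ℚₚ.+-comm (seq (re x) n) (seq (re y) n))
            ,ᶜ ≗⇒≃ (λ n → ℚₚ.+-comm (seq (im x) n) (seq (im y) n))
        }
      ; *-cong     = *ᶜ-cong
      ; *-assoc    = *ᶜ-assoc
      ; *-identity = *ᶜ-identityˡ , λ x → ≈ᶜ-trans (*ᶜ-comm x 1ᶜ) (*ᶜ-identityˡ x)
      ; distrib    = *ᶜ-distribˡ , λ x y z →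
          ≈ᶜ-trans (*ᶜ-comm (y +ᶜ z) x)
            (≈ᶜ-trans (*ᶜ-distribˡ x y z)
              (+ᶜ-cong (*ᶜ-comm x y) (*ᶜ-comm x z)))
      }
    ; *-comm = *ᶜ-comm
    }
  }
  where
  +ᶜ-cong : ∀ {x y u v} → x ≈ᶜ y → u ≈ᶜ v → x +ᶜ u ≈ᶜ y +ᶜ v
  +ᶜ-cong (p ,ᶜ q) (r ,ᶜ s) = +ᴿ-cong p r ,ᶜ +ᴿ-cong q s

ℂ-ring : Ring 0ℓ 0ℓ
ℂ-ring = CommutativeRing.ring ℂ-commutativeRing

private
  module ℂΣ = RawMonoidDefinitions (CommutativeRing.+-rawMonoid ℂ-commutativeRing)

------------------------------------------------------------------------
-- Distance integral graphs on a finite vertex set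

data Walk {a r} {A : Set a} (R : Rel A r) : ℕ → Rel A (a ⊔ˡ r) where
  []  : ∀ {x} → Walk R 0 x x
  _∷_ : ∀ {k x y z} → R x y → Walk R k y z → Walk R (suc k) x z

IsDistanceMatrix : ∀ {r m} → Rel (Fin m) r → (Fin m → Fin m → ℕ) → Set r
IsDistanceMatrix Adj D =
  ∀ i j → Walk Adj (D i j) i j × (∀ k → Walk Adj k i j → D i j ℕ.≤ k)

IsEigenvalue : ∀ {m} → (Fin m → Fin m → ℂ) → ℂ → Set
IsEigenvalue {m} M μ = ∃ λ (v : Fin m → ℂ) →
  (∃ λ i → v i #ᶜ 0ᶜ) × (∀ i → ℂΣ.sum (λ j → M i j *ᶜ v j) ≈ᶜ μ *ᶜ v i)

-- At most one D satisfies IsDistanceMatrix, so quantifying over D refers to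
-- the distance matrix of the (connected) graph.

DistanceIntegral : ∀ {r m} → Rel (Fin m) r → Set r
DistanceIntegral Adj = ∀ D → IsDistanceMatrix Adj D →
  ∀ μ → IsEigenvalue (λ i j → fromℤ (ℤ.+ D i j)) μ → ∃ λ k → μ ≈ᶜ fromℤ k

------------------------------------------------------------------------
-- Subgroups and Cayley graphs

module _ {c ℓ : Level} (G : Group c ℓ) where
  open Group G

  record IsSubgroup {h : Level} (H : Pred Carrier h) : Set (c ⊔ˡ ℓ ⊔ˡ h) where
    field
      resp      : ∀ {x y} → x ≈ y → H x → H y
      ε-closed  : H ε
      ∙-closed  : ∀ {x y} → H x → H y → H (x ∙ y)
      ⁻¹-closed : ∀ {x} → H x → H (x ⁻¹)

  data Generated {s : Level} (S : Pred Carrier s) : Pred Carrier (c ⊔ˡ ℓ ⊔ˡ s) where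
    gen  : ∀ {x} → S x → Generated S x
    eq   : ∀ {x y} → x ≈ y → Generated S x → Generated S y
    unit : Generated S ε
    mult : ∀ {x y} → Generated S x → Generated S y → Generated S (x ∙ y)
    inv  : ∀ {x} → Generated S x → Generated S (x ⁻¹)

  record Finite {h : Level} (H : Pred Carrier h) : Set (c ⊔ˡ ℓ ⊔ˡ h) where
    field
      order    : ℕ
      elem     : Fin order → Carrier
      elem∈    : ∀ i → H (elem i)
      distinct : ∀ {i j} → elem i ≈ elem j → i ≡ j
      complete : ∀ {x} → H x → ∃ λ i → elem i ≈ x

  -- The vertices are the elements of H, named by their position in the
  -- enumeration.

  CayleyGraph : ∀ {h t} {H : Pred Carrier h} (fin : Finite H) → Pred Carrier t →
                Rel (Fin (Finite.order fin)) (c ⊔ˡ ℓ ⊔ˡ t)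
  CayleyGraph fin T = SymClosure (λ g h → ∃ λ t → T t × h ≈ t ∙ g) on Finite.elem fin

------------------------------------------------------------------------
-- Complex vector spaces

module _ {a ℓ : Level} (V : LeftModule ℂ-ring a ℓ) where
  open LeftModule V
  open LeftModuleMorphisms rawLeftModule rawLeftModule

  linComb : ∀ {k} → (Fin k → ℂ) → (Fin k → Carrierᴹ) → Carrierᴹ
  linComb c b = RawMonoidDefinitions.sum +ᴹ-rawMonoid (λ i → c i *ₗ b i)

  record IsSubspace {p : Level} (P : Pred Carrierᴹ p) : Set (a ⊔ˡ ℓ ⊔ˡ p) where
    field
      resp      : ∀ {x y} → x ≈ᴹ y → P x → P y
      0-closed  : P 0ᴹ
      +-closed  : ∀ {x y} → P x → P y → P (x +ᴹ y)
      *ₗ-closed : ∀ c {x} → P x → P (c *ₗ x)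

  record HasDimension {p : Level} (P : Pred Carrierᴹ p) (k : ℕ) : Set (a ⊔ˡ ℓ ⊔ˡ p) where
    field
      basis       : Fin k → Carrierᴹ
      basis∈      : ∀ i → P (basis i)
      independent : ∀ c → linComb c basis ≈ᴹ 0ᴹ → ∀ i → c i ≈ᶜ 0ᶜ
      coord       : ∀ {v} → P v → Fin k → ℂ
      expansion   : ∀ {v} (p : P v) → v ≈ᴹ linComb (coord p) basis

  -- Some coordinate is apart from zero (a condition which does not depend
  -- on the basis).

  NonZero : ∀ {n} → HasDimension U n → Pred Carrierᴹ 0ℓ
  NonZero dimV v = ∃ λ i → HasDimension.coord dimV {v} _ i #ᶜ 0ᶜ

  record Automorphism : Set (a ⊔ˡ ℓ) where
    field
      ⟦_⟧           : Carrierᴹ → Carrierᴹ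
      isIsomorphism : IsLeftModuleIsomorphism ⟦_⟧
    open IsLeftModuleIsomorphism isIsomorphism public

  open Automorphism using (⟦_⟧)

  private
    inverse : Automorphism → Automorphism
    inverse g = record
      { ⟦_⟧ = g⁻¹
      ; isIsomorphism = record
        { isLeftModuleMonomorphism = record
          { isLeftModuleHomomorphism = record
            { +ᴹ-isGroupHomomorphism = record
              { isMonoidHomomorphism = record
                { isMagmaHomomorphism = record
                  { isRelHomomorphism = record
                    { cong = λ {x} {y} x≈y → g.injective
                        (≈ᴹ-trans (gg⁻¹ x) (≈ᴹ-trans x≈y (≈ᴹ-sym (gg⁻¹ y)))) }
                  ; homo = λ x y → g.injective (≈ᴹ-trans (gg⁻¹ (x +ᴹ y)) (≈ᴹ-sym
                      (≈ᴹ-trans (g.+ᴹ-homo (g⁻¹ x) (g⁻¹ y)) (+ᴹ-cong (gg⁻¹ x) (gg⁻¹ y)))))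
                  }
                ; ε-homo = g.injective (≈ᴹ-trans (gg⁻¹ 0ᴹ) (≈ᴹ-sym g.0ᴹ-homo))
                }
              ; ⁻¹-homo = λ x → g.injective (≈ᴹ-trans (gg⁻¹ (-ᴹ x)) (≈ᴹ-sym
                  (≈ᴹ-trans (g.-ᴹ-homo (g⁻¹ x)) (-ᴹ‿cong (gg⁻¹ x)))))
              }
            ; *ₗ-homo = λ c x → g.injective (≈ᴹ-trans (gg⁻¹ (c *ₗ x)) (≈ᴹ-sym
                (≈ᴹ-trans (g.*ₗ-homo c (g⁻¹ x)) (*ₗ-cong (Ring.refl ℂ-ring) (gg⁻¹ x)))))
            }
          ; injective = λ {x} {y} eq →
              ≈ᴹ-trans (≈ᴹ-sym (gg⁻¹ x)) (≈ᴹ-trans (g.⟦⟧-cong eq) (gg⁻¹ y))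
          }
        ; surjective = λ y → ⟦ g ⟧ y , λ {z} z≈gy → g.injective (≈ᴹ-trans (gg⁻¹ z) z≈gy)
        }
      }
      where
      module g = Automorphism g
      g⁻¹ : Carrierᴹ → Carrierᴹ
      g⁻¹ y = proj₁ (g.surjective y)
      gg⁻¹ : ∀ y → ⟦ g ⟧ (g⁻¹ y) ≈ᴹ y
      gg⁻¹ y = proj₂ (g.surjective y) ≈ᴹ-refl

  GL : Group (a ⊔ˡ ℓ) (a ⊔ˡ ℓ)
  GL = record
    { Carrier = Automorphism
    ; _≈_     = λ g h → ∀ v → ⟦ g ⟧ v ≈ᴹ ⟦ h ⟧ v
    ; _∙_     = λ g h → record
      { ⟦_⟧ = λ v → ⟦ g ⟧ (⟦ h ⟧ v)
      ; isIsomorphism = Composition.isLeftModuleIsomorphism ≈ᴹ-trans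
          (Automorphism.isIsomorphism h) (Automorphism.isIsomorphism g)
      }
    ; ε       = record
      { ⟦_⟧ = λ v → v
      ; isIsomorphism = Identity.isLeftModuleIsomorphism rawLeftModule ≈ᴹ-refl
      }
    ; _⁻¹     = inverse
    ; isGroup = record
      { isMonoid = record
        { isSemigroup = record
          { isMagma = record
            { isEquivalence = record
              { refl  = λ _ → ≈ᴹ-refl
              ; sym   = λ p v → ≈ᴹ-sym (p v)
              ; trans = λ p q v → ≈ᴹ-trans (p v) (q v)
              }
            ; ∙-cong = λ {g} {g′} {h} {h′} p q v →
                ≈ᴹ-trans (Automorphism.⟦⟧-cong g (q v)) (p (⟦ h′ ⟧ v))
            }
          ; assoc = λ _ _ _ _ → ≈ᴹ-refl
          }
        ; identity = (λ _ _ → ≈ᴹ-refl) , (λ _ _ → ≈ᴹ-refl)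
        }
      ; inverse =
          (λ g v → Automorphism.injective g
            (proj₂ (Automorphism.surjective g (⟦ g ⟧ v)) ≈ᴹ-refl))
        , (λ g v → proj₂ (Automorphism.surjective g v) ≈ᴹ-refl)
      ; ⁻¹-cong = λ {g} {h} p v → Automorphism.injective g
          (≈ᴹ-trans (proj₂ (Automorphism.surjective g v) ≈ᴹ-refl)
            (≈ᴹ-sym (≈ᴹ-trans (p (⟦ inverse h ⟧ v))
              (proj₂ (Automorphism.surjective h v) ≈ᴹ-refl))))
      }
    }

  module GL = Group GL

  Eigenspace : Automorphism → ℂ → Pred Carrierᴹ ℓ
  Eigenspace g μ v = ⟦ g ⟧ v ≈ᴹ μ *ₗ v

  -- k ×ᴳ g is the k-th power of g (the library writes powers in a monoid
  -- additively).

  FiniteOrder : Pred Automorphism (a ⊔ˡ ℓ)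
  FiniteOrder g = ∃ λ k → GL._≈_ (suc k ×ᴳ g) GL.ε
    where open RawMonoidDefinitions GL.rawMonoid using () renaming (_×_ to _×ᴳ_)

  -- n is the dimension of V.  Writing n as suc m, rather than using
  -- truncated subtraction, excludes n = 0.

  IsReflection : ℕ → Pred Automorphism (a ⊔ˡ ℓ)
  IsReflection n g = FiniteOrder g × ∃ λ m → n ≡ suc m × HasDimension (Eigenspace g 1ᶜ) m

  record HermitianForm {n : ℕ} (dimV : HasDimension U n) : Set (a ⊔ˡ ℓ) where
    field
      ⟨_,_⟩       : Carrierᴹ → Carrierᴹ → ℂ
      form-cong   : ∀ {x x′ y y′} → x ≈ᴹ x′ → y ≈ᴹ y′ → ⟨ x , y ⟩ ≈ᶜ ⟨ x′ , y′ ⟩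
      +-linear    : ∀ x x′ y → ⟨ x +ᴹ x′ , y ⟩ ≈ᶜ ⟨ x , y ⟩ +ᶜ ⟨ x′ , y ⟩
      *ₗ-linear   : ∀ c x y → ⟨ c *ₗ x , y ⟩ ≈ᶜ c *ᶜ ⟨ x , y ⟩
      hermitian   : ∀ x y → ⟨ y , x ⟩ ≈ᶜ conj ⟨ x , y ⟩
      posDefinite : ∀ x → NonZero dimV x → 0ᴿ < re ⟨ x , x ⟩

  record ComplexReflectionGroup {n : ℕ} (dimV : HasDimension U n) (w : Level)
    : Set (a ⊔ˡ ℓ ⊔ˡ lsuc w) where
    field
      W          : Pred Automorphism w
      isSubgroup : IsSubgroup GL W
      finite     : Finite GL W

    Reflection : Pred Automorphism (a ⊔ˡ ℓ ⊔ˡ w)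
    Reflection g = W g × IsReflection n g

    field
      generated  : ∀ {g} → W g → Generated GL Reflection g
      form       : HermitianForm dimV
    open HermitianForm form public
    field
      invariant  : ∀ {g} → W g → ∀ x y → ⟨ ⟦ g ⟧ x , ⟦ g ⟧ y ⟩ ≈ᶜ ⟨ x , y ⟩

    FixedSpace : Pred Carrierᴹ (a ⊔ˡ ℓ ⊔ˡ w)
    FixedSpace v = ∀ {g} → W g → ⟦ g ⟧ v ≈ᴹ v

    Complement : Pred Carrierᴹ (a ⊔ˡ ℓ ⊔ˡ w)
    Complement u = ∀ {v} → FixedSpace v → ⟨ u , v ⟩ ≈ᶜ 0ᶜ

    Stable : ∀ {p} → Pred Carrierᴹ p → Set (a ⊔ˡ ℓ ⊔ˡ w ⊔ˡ p)
    Stable P = ∀ {g} → W g → ∀ {v} → P v → P (⟦ g ⟧ v)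

    -- As usual, an irreducible representation is nonzero.  "Every stable
    -- subspace is zero or everything" is expressed as "every stable subspace
    -- with a nonzero vector is everything", since the disjunction is not
    -- decidable for an arbitrary predicate.

    record Irreducible : Set (lsuc (a ⊔ˡ ℓ) ⊔ˡ w) where
      field
        nontrivial : ∃ λ v → Complement v × NonZero dimV v
        simple     : (P : Pred Carrierᴹ (a ⊔ˡ ℓ)) → IsSubspace P → Stable P →
                     P ⊆ Complement → (∃ λ v → P v × NonZero dimV v) →
                     Complement ⊆ P

{-# OPTIONS --safe #-}

-- Let G be a finite group of exponent e, generated by a set T which is closed
-- under conjugation, inversion and powers prime to e, as the reflections are.
--
-- Rotating words shows that a class function a in ℤ[G] and a prime p not
-- dividing e satisfy a^(pʲ⁺¹)(x^p) ≡ a^(pʲ)(x) modulo pʲ⁺¹.  As every class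
-- function is a pʲ-th power modulo p, it follows that the operation taking a
-- to x ↦ a(x^p) is multiplicative.  It fixes the indicator of the unit ball,
-- hence its powers, whose supports are the balls; so the length function ℓ,
-- and then every convolution power of ℓ, has the same value at x and at x^u
-- for all u prime to e.
--
-- Let χ be the character of G on the eigenspace of the distance matrix for μ,
-- and d its dimension.  Averaging over a cyclic group is a projection, so the
-- sums Σ_{i<m} χ(xⁱ) with x^m = 1 are integers, and therefore so are the sums
-- of χ(xⁱ) over the i < e prime to e.  If there are φ such i, the invariance of
-- the powers of ℓ makes φ d μᵏ = φ Σ_x ℓᵏ(x) χ(x) an integer for every k, which
-- forces μ to be an integer.
--
-- Equality in ℂ being undecidable, the linear algebra is carried out under
-- double negation; this suffices, because whether μ is an integer can be read
-- off a rational approximation of μ up to a doubly negated equation.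

module Submission where

open import Algebra.Bundles using (Group; CommutativeRing)
open import Data.Fin.Base as Fin using (Fin; zero; suc; toℕ; fromℕ<)
import Data.Fin.Properties as Finₚ
open import Data.Nat.Base as ℕ using (ℕ; zero; suc)
import Data.Nat.Properties as ℕₚ
open import Data.Product.Base using (∃; _×_; _,_; proj₁; proj₂)
open import Data.Sum.Base using (_⊎_; inj₁; inj₂)
open import Function.Base using (_∘_)
open import Level using (Level; 0ℓ)
open import Relation.Nullary

-- The invariance of ℓ under x ↦ x^u is usually read off from Galois automorphisms permuting
-- character values. Here it comes from counting words inside the centre of ℤ[G], so that no roots
-- of unity have to be constructed. Closure under conjugation is what places ℓ in this centre, and
-- the distance matrix is convolution by ℓ. Put F(a)(x) = a(x^p). Then F(a^p) ≡ a modulo p, and F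
-- has finite order because p is invertible modulo e. Iterating over a multiple of that order gives
-- a ≡ a^Q modulo p for arbitrarily high powers Q of p. On such powers F is multiplicative modulo a
-- high power of p, since (ab)^Q = a^Q b^Q, and the error terms divisible by p are absorbed by
-- induction. Powers prime to e preserve reflections because g and g^u are powers of each other and
-- so fix the same vectors. The final step is about bounded denominators: if c μᵏ is an integer for
-- all k and a fixed c ≠ 0, then with cμ = r each cᵏ divides rᵏ⁺¹, whence c divides r. The exponent
-- is e = 2 · n! for n = |G|; the factor 2 gives e > 1, so that 0 is not prime to e.

-- Divisibility and powers of natural numbers

module Arithmetic where
  open import Data.Nat.Base
  open import Data.Nat.Properties
  open import Data.Nat.Divisibility
  open import Data.Nat.DivMod
  open import Data.Nat.Coprimality as Coprimality using (Coprime; coprime-divisor)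
  open import Data.Nat.Primality using (Prime; prime⇒nonZero; prime⇒irreducible)
  open import Data.Nat.Solver using (module +-*-Solver)
  open import Relation.Binary.PropositionalEquality

  prime∧∤⇒coprime : ∀ {p n} → Prime p → ¬ p ∣ n → Coprime p n
  prime∧∤⇒coprime pp p∤n (d∣p , d∣n) with prime⇒irreducible pp d∣p
  ... | inj₁ d≡1  = d≡1
  ... | inj₂ refl = contradiction d∣n p∤n

  coprime-^ : ∀ {m n} k → Coprime m n → Coprime (m ^ k) n
  coprime-^ zero    c = Coprimality.1-coprimeTo _
  coprime-^ (suc k) c {d} (d∣mmᵏ , d∣n) = coprime-^ k c
    (coprime-divisor (λ (i∣d , i∣m) → c (i∣m , ∣-trans i∣d d∣n)) d∣mmᵏ , d∣n)

  coprime∧∣⇒≡1 : ∀ {m n} → Coprime m n → n ∣ m → n ≡ 1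
  coprime∧∣⇒≡1 c n∣m = c (n∣m , ∣-refl)

  -- The cofactor of g is either prime to p, hence 1, or contains a factor p that can be cancelled.
  divisor-prime^ : ∀ {p g} → Prime p → ∀ j → g ∣ p ^ suc j → g ≡ p ^ suc j ⊎ g ∣ p ^ j
  divisor-prime^ {p} {g} pp j (divides h eq) with p ∣? h
  ... | no p∤h = inj₁ (sym (trans eq (trans (cong (_* g) h≡1) (*-identityˡ g))))
    where
    h≡1 : h ≡ 1
    h≡1 = coprime∧∣⇒≡1 (coprime-^ (suc j) (prime∧∤⇒coprime pp p∤h))
            (divides g (trans eq (*-comm h g)))
  ... | yes (divides h′ refl) = inj₂ (divides h′ (*-cancelˡ-≡ (p ^ j) (h′ * g) p
          {{prime⇒nonZero pp}} (trans eq (solve 3 (λ a b c → a :* b :* c := b :* (a :* c)) refl h′ p g))))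
    where open +-*-Solver

  private
    %-≡⇒∣-∸ : ∀ m n d .{{_ : NonZero d}} → m % d ≡ n % d → d ∣ n ∸ m
    %-≡⇒∣-∸ m n d eq = divides (n / d ∸ m / d) (begin
      n ∸ m  ≡⟨ cong₂ _∸_ (m≡m%n+[m/n]*n n d) (m≡m%n+[m/n]*n m d) ⟩
      (n % d + n / d * d) ∸ (m % d + m / d * d) ≡⟨ cong (λ r → (n % d + n / d * d) ∸ (r + m / d * d)) eq ⟩
      (n % d + n / d * d) ∸ (n % d + m / d * d) ≡⟨ [m+n]∸[m+o]≡n∸o (n % d) _ _ ⟩
      n / d * d ∸ m / d * d  ≡⟨ *-distribʳ-∸ d (n / d) (m / d) ⟨
      (n / d ∸ m / d) * d                      ∎)
      where open ≡-Reasoning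

  -- Two of the e + 1 powers u⁰, ..., uᵉ agree modulo e, and the smaller one cancels because it is
  -- prime to e. Writing the exponent as `suc φ` makes u^φ an inverse of u modulo e.
  coprime⇒power≡1 : ∀ {u e} .{{_ : NonZero u}} .{{_ : NonZero e}} → Coprime u e →
                    ∃ λ φ → ∃ λ k → u ^ suc φ ≡ 1 + k * e
  coprime⇒power≡1 {u} {e} c
    with Finₚ.pigeonhole (n<1+n e) (λ i → (u ^ toℕ i) mod e)
  ... | i , k , i<k , eq = conclude (m≤n⇒∃[o]m+o≡n i<k)
    where
    open ≡-Reasoning
    eq% : (u ^ toℕ i) % e ≡ (u ^ toℕ k) % e
    eq% = trans (sym (Finₚ.toℕ-fromℕ< _)) (trans (cong toℕ eq) (Finₚ.toℕ-fromℕ< _))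
    conclude : ∃ (λ φ → suc (toℕ i) + φ ≡ toℕ k) → ∃ λ φ → ∃ λ k → u ^ suc φ ≡ 1 + k * e
    conclude (φ , i+φ≡k) = φ , quotient e∣ , (begin
        u ^ suc φ            ≡⟨ m+[n∸m]≡n (m^n>0 u (suc φ)) ⟨
        1 + (u ^ suc φ ∸ 1)  ≡⟨ cong (1 +_) (m∣n⇒n≡quotient*m e∣) ⟩
        1 + quotient e∣ * e  ∎)
      where
      e∣ : e ∣ u ^ suc φ ∸ 1
      e∣ = coprime-divisor {e} {u ^ toℕ i} (Coprimality.sym (coprime-^ (toℕ i) c))
        (subst (e ∣_) (begin
          u ^ toℕ k ∸ u ^ toℕ i  ≡⟨ cong (λ z → u ^ z ∸ u ^ toℕ i) (trans (sym i+φ≡k) (sym (+-suc (toℕ i) φ))) ⟩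
          u ^ (toℕ i + suc φ) ∸ u ^ toℕ i  ≡⟨ cong₂ _∸_ (^-distribˡ-+-* u (toℕ i) (suc φ)) (sym (*-identityʳ (u ^ toℕ i))) ⟩
          u ^ toℕ i * u ^ suc φ ∸ u ^ toℕ i * 1 ≡⟨ *-distribˡ-∸ (u ^ toℕ i) (u ^ suc φ) 1 ⟨
          u ^ toℕ i * (u ^ suc φ ∸ 1)          ∎)
          (%-≡⇒∣-∸ (u ^ toℕ i) (u ^ toℕ k) e eq%))

  ^-distribʳ-* : ∀ k m n → (m * n) ^ k ≡ m ^ k * n ^ k
  ^-distribʳ-* zero    m n = refl
  ^-distribʳ-* (suc k) m n = begin
    m * n * (m * n) ^ k  ≡⟨ cong (m * n *_) (^-distribʳ-* k m n) ⟩
    m * n * (m ^ k * n ^ k)  ≡⟨ solve 4 (λ a b c d → a :* b :* (c :* d) := a :* c :* (b :* d)) refl m n (m ^ k) (n ^ k) ⟩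
    m * m ^ k * (n * n ^ k)    ∎
    where
    open ≡-Reasoning
    open +-*-Solver

  n<m^n : ∀ {m} → 2 ≤ m → ∀ n → n < m ^ n
  n<m^n     2≤m zero    = s≤s z≤n
  n<m^n {m} 2≤m (suc n) = begin-strict
    suc n              ≤⟨ n<m^n 2≤m n ⟩
    m ^ n  <⟨ m<m*n (m ^ n) m {{m^n≢0 m n {{>-nonZero (≤-trans (s≤s z≤n) 2≤m)}}}} 2≤m ⟩
    m ^ n * m          ≡⟨ *-comm (m ^ n) m ⟩
    m ^ suc n          ∎
    where open ≤-Reasoning

open Arithmetic

-- Finite sums and finite groups

module FiniteGroups where
  open import Algebra.Structures using (IsGroup)
  import Algebra.Properties.Group as GroupProperties
  import Algebra.Properties.Monoid.Mult as Mult
  import Algebra.Properties.Semiring.Sum as SemiringSum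
  open import Data.Fin.Base using (_↑ˡ_; _↑ʳ_)
  import Data.Fin.Permutation as Perm
  open import Data.Nat.Divisibility using (∣-trans; m≤n⇒m!∣n!; m∣m*n; divides; _∣_)
  open import Data.Nat.Coprimality using (Coprime)
  open import Relation.Binary.PropositionalEquality

  module Sums {c ℓ : Level} (R : CommutativeRing c ℓ) where
    open CommutativeRing R using (Carrier; _≈_; _+_; 0#; 1#; semiring; +-cong; +-congˡ; +-assoc; +-identityˡ; +-identityʳ)
      renaming (sym to ≈-sym; trans to ≈-trans)
    open SemiringSum semiring public

    indicator : ∀ {p} {P : Set p} → Dec P → Carrier
    indicator (yes _) = 1#
    indicator (no _)  = 0#

    indicator-yes : ∀ {p} {P : Set p} (d : Dec P) → P → indicator d ≡ 1#
    indicator-yes (yes _) _ = refl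
    indicator-yes (no ¬p) p = contradiction p ¬p

    indicator-no : ∀ {p} {P : Set p} (d : Dec P) → ¬ P → indicator d ≡ 0#
    indicator-no (yes p) ¬p = contradiction p ¬p
    indicator-no (no _)  _  = refl

    indicator-⇔ : ∀ {p q} {P : Set p} {Q : Set q} (d : Dec P) (d′ : Dec Q) →
                  (P → Q) → (Q → P) → indicator d ≡ indicator d′
    indicator-⇔ (yes p) d′ f g = sym (indicator-yes d′ (f p))
    indicator-⇔ (no ¬p) d′ f g = sym (indicator-no d′ (¬p ∘ g))

    sum-zero : ∀ {n} {f : Fin n → Carrier} → (∀ i → f i ≈ 0#) → sum f ≈ 0#
    sum-zero {n} eq = ≈-trans (sum-cong-≋ eq) (sum-replicate-zero n)

    sum-single : ∀ {n} (k : Fin n) (f : Fin n → Carrier) → (∀ i → i ≢ k → f i ≈ 0#) → sum f ≈ f k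
    sum-single zero f eq =
      ≈-trans (+-congˡ (sum-zero λ i → eq (suc i) λ ())) (+-identityʳ (f zero))
    sum-single (suc k) f eq =
      ≈-trans (+-cong (eq zero λ ()) (sum-single k (f ∘ suc) λ i i≢k → eq (suc i) (i≢k ∘ Finₚ.suc-injective)))
        (+-identityˡ (f (suc k)))

    sum-++ : ∀ m {n} (f : Fin (m ℕ.+ n) → Carrier) → sum f ≈ sum (λ i → f (i ↑ˡ n)) + sum (λ i → f (m ↑ʳ i))
    sum-++ zero    f = ≈-sym (+-identityˡ (sum f))
    sum-++ (suc m) f = ≈-trans (+-congˡ (sum-++ m (f ∘ suc))) (≈-sym (+-assoc (f zero) _ _))

    sum-bijection : ∀ {n} (f : Fin n → Carrier) (σ τ : Fin n → Fin n) →
                    (∀ i → σ (τ i) ≡ i) → (∀ i → τ (σ i) ≡ i) → sum f ≈ sum (f ∘ σ)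
    sum-bijection f σ τ στ τσ = sum-permute f (Perm.permutation σ τ στ τσ)

  -- With carrier `Fin n` and propositional equality, group elements can be compared decidably and
  -- serve directly as indices of sums and matrices.
  record FinGroup (n : ℕ) : Set where
    infixl 7 _∙_
    infix  8 _⁻¹
    field
      _∙_     : Fin n → Fin n → Fin n
      ε       : Fin n
      _⁻¹     : Fin n → Fin n
      isGroup : IsGroup _≡_ _∙_ ε _⁻¹

    group : Group 0ℓ 0ℓ
    group = record { isGroup = isGroup }

    open Group group public using (assoc; identityˡ; identityʳ; inverseˡ; inverseʳ)
    open GroupProperties group public
      using (⁻¹-involutive; ⁻¹-anti-homo-∙; ε⁻¹≈ε; inverseʳ-unique)
    private module M = Mult (Group.monoid group)

    infixr 9 _^_
    _^_ : Fin n → ℕ → Fin n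
    x ^ k = k M.× x

    ^-+ : ∀ x j k → x ^ (j ℕ.+ k) ≡ x ^ j ∙ x ^ k
    ^-+ = M.×-homo-+

    ^-* : ∀ x j k → (x ^ j) ^ k ≡ x ^ (k ℕ.* j)
    ^-* x j k = M.×-assocˡ x k j

    ^-1 : ∀ x → x ^ 1 ≡ x
    ^-1 = identityʳ

    ^-suc : ∀ x k → x ^ suc k ≡ x ^ k ∙ x
    ^-suc x k = trans (cong (x ^_) (sym (ℕₚ.+-comm k 1))) (trans (^-+ x k 1) (cong (x ^ k ∙_) (^-1 x)))

    ^-ε : ∀ k → ε ^ k ≡ ε
    ^-ε zero    = refl
    ^-ε (suc k) = trans (identityˡ _) (^-ε k)

    cancel-⁻¹∙ : ∀ x y → x ⁻¹ ∙ (x ∙ y) ≡ y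
    cancel-⁻¹∙ x y = trans (sym (assoc (x ⁻¹) x y)) (trans (cong (_∙ y) (inverseˡ x)) (identityˡ y))

    cancel-∙⁻¹ : ∀ x y → x ∙ (x ⁻¹ ∙ y) ≡ y
    cancel-∙⁻¹ x y = trans (sym (assoc x (x ⁻¹) y)) (trans (cong (_∙ y) (inverseʳ x)) (identityˡ y))

    cancelʳ-∙⁻¹ : ∀ x y → (y ∙ x) ∙ x ⁻¹ ≡ y
    cancelʳ-∙⁻¹ x y = trans (assoc y x (x ⁻¹)) (trans (cong (y ∙_) (inverseʳ x)) (identityʳ y))

    cancelʳ-⁻¹∙ : ∀ x y → (y ∙ x ⁻¹) ∙ x ≡ y
    cancelʳ-⁻¹∙ x y = trans (assoc y (x ⁻¹) x) (trans (cong (y ∙_) (inverseˡ x)) (identityʳ y))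

    conjugate : Fin n → Fin n → Fin n
    conjugate g x = g ∙ x ∙ g ⁻¹

    conjugate-∙ : ∀ g x y → conjugate g x ∙ conjugate g y ≡ conjugate g (x ∙ y)
    conjugate-∙ g x y = begin
      (g ∙ x ∙ g ⁻¹) ∙ (g ∙ y ∙ g ⁻¹)  ≡⟨ assoc (g ∙ x ∙ g ⁻¹) (g ∙ y) (g ⁻¹) ⟨
      (g ∙ x ∙ g ⁻¹) ∙ (g ∙ y) ∙ g ⁻¹  ≡⟨ cong (_∙ g ⁻¹) (assoc (g ∙ x) (g ⁻¹) (g ∙ y)) ⟩
      g ∙ x ∙ (g ⁻¹ ∙ (g ∙ y)) ∙ g ⁻¹  ≡⟨ cong (λ z → g ∙ x ∙ z ∙ g ⁻¹) (cancel-⁻¹∙ g y) ⟩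
      g ∙ x ∙ y ∙ g ⁻¹  ≡⟨ cong (_∙ g ⁻¹) (assoc g x y) ⟩
      g ∙ (x ∙ y) ∙ g ⁻¹               ∎
      where open ≡-Reasoning

    conjugate-ε : ∀ g → conjugate g ε ≡ ε
    conjugate-ε g = trans (cong (_∙ g ⁻¹) (identityʳ g)) (inverseʳ g)

    conjugate-^ : ∀ g x k → conjugate g x ^ k ≡ conjugate g (x ^ k)
    conjugate-^ g x zero    = sym (conjugate-ε g)
    conjugate-^ g x (suc k) = trans (cong (conjugate g x ∙_) (conjugate-^ g x k)) (conjugate-∙ g x (x ^ k))

    conjugate-⁻¹ : ∀ g x → conjugate (g ⁻¹) (conjugate g x) ≡ x
    conjugate-⁻¹ g x = begin
      g ⁻¹ ∙ (g ∙ x ∙ g ⁻¹) ∙ (g ⁻¹) ⁻¹  ≡⟨ cong (λ z → g ⁻¹ ∙ z ∙ (g ⁻¹) ⁻¹) (assoc g x (g ⁻¹)) ⟩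
      g ⁻¹ ∙ (g ∙ (x ∙ g ⁻¹)) ∙ (g ⁻¹) ⁻¹  ≡⟨ cong (_∙ (g ⁻¹) ⁻¹) (cancel-⁻¹∙ g (x ∙ g ⁻¹)) ⟩
      x ∙ g ⁻¹ ∙ (g ⁻¹) ⁻¹               ≡⟨ cancelʳ-∙⁻¹ (g ⁻¹) x ⟩
      x                                  ∎
      where open ≡-Reasoning

    HasExponent : ℕ → Set
    HasExponent e = ∀ x → x ^ e ≡ ε

    ^-mod : ∀ {e} → HasExponent e → ∀ x k → x ^ (1 ℕ.+ k ℕ.* e) ≡ x
    ^-mod {e} exp x k = begin
      x ∙ x ^ (k ℕ.* e)  ≡⟨ cong (x ∙_) (^-* x e k) ⟨
      x ∙ (x ^ e) ^ k    ≡⟨ cong (λ z → x ∙ z ^ k) (exp x) ⟩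
      x ∙ ε ^ k          ≡⟨ cong (x ∙_) (^-ε k) ⟩
      x ∙ ε              ≡⟨ identityʳ x ⟩
      x                  ∎
      where open ≡-Reasoning

    -- This makes x ↦ x^u a bijection of the group, with inverse x ↦ x^(u^φ).
    power-recurs : ∀ {e u} .{{_ : ℕ.NonZero u}} .{{_ : ℕ.NonZero e}} → HasExponent e → Coprime u e →
                   ∃ λ φ → ∀ x → x ^ (u ℕ.^ suc φ) ≡ x
    power-recurs exp c with coprime⇒power≡1 c
    ... | φ , k , eq = φ , λ x → trans (cong (x ^_) eq) (^-mod exp x k)

    -- By pigeonhole some positive power x^m with m ≤ n is trivial, and m divides n!. The factor 2
    -- makes the exponent exceed 1 even for the trivial group.
    factorial-exponent : HasExponent (2 ℕ.* (n ℕ.!))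
    factorial-exponent x with Finₚ.pigeonhole (ℕₚ.n<1+n n) (λ i → x ^ toℕ i)
    ... | i , k , i<k , eq = conclude (ℕₚ.m≤n⇒∃[o]m+o≡n i<k)
      where
      open ≡-Reasoning
      conclude : ∃ (λ d → suc (toℕ i) ℕ.+ d ≡ toℕ k) → x ^ (2 ℕ.* (n ℕ.!)) ≡ ε
      conclude (d , i+d≡k) = multiple (∣-trans (∣-trans (m∣m*n (d ℕ.!)) (m≤n⇒m!∣n! d<n)) (divides 2 refl))
        where
        d<n : d ℕ.< n
        d<n = ℕₚ.≤-trans (ℕₚ.m≤n+m (suc d) (toℕ i))
                (subst (ℕ._≤ n) (trans (sym i+d≡k) (sym (ℕₚ.+-suc (toℕ i) d))) (ℕₚ.≤-pred (Finₚ.toℕ<n k)))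
        xᵈ≡ε : x ^ suc d ≡ ε
        xᵈ≡ε = begin
          x ^ suc d  ≡⟨ cancel-⁻¹∙ (x ^ toℕ i) (x ^ suc d) ⟨
          (x ^ toℕ i) ⁻¹ ∙ (x ^ toℕ i ∙ x ^ suc d) ≡⟨ cong ((x ^ toℕ i) ⁻¹ ∙_) (^-+ x (toℕ i) (suc d)) ⟨
          (x ^ toℕ i) ⁻¹ ∙ x ^ (toℕ i ℕ.+ suc d) ≡⟨ cong (λ m → (x ^ toℕ i) ⁻¹ ∙ x ^ m) (trans (ℕₚ.+-suc (toℕ i) d) i+d≡k) ⟩
          (x ^ toℕ i) ⁻¹ ∙ x ^ toℕ k  ≡⟨ cong ((x ^ toℕ i) ⁻¹ ∙_) eq ⟨
          (x ^ toℕ i) ⁻¹ ∙ x ^ toℕ i  ≡⟨ inverseˡ (x ^ toℕ i) ⟩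
          ε                                      ∎
        multiple : ∀ {m} → suc d ∣ m → x ^ m ≡ ε
        multiple (divides k refl) = trans (sym (^-* x (suc d) k)) (trans (cong (_^ k) xᵈ≡ε) (^-ε k))

open FiniteGroups

-- Words up to rotation

module Necklaces where
  open import Data.Integer.Base as ℤ using (ℤ; +_)
  import Data.Integer.Properties as ℤₚ
  open import Data.Integer.Divisibility.Signed as ℤᵈ using () renaming (_∣_ to _∣ℤ_)
  open import Data.List.Base using (List; []; _∷_; _++_; length)
  import Data.List.Properties as Listₚ
  open import Data.Nat.Base using (NonZero)
  open import Data.Nat.Divisibility using (_∣_; divides; ∣⇒≤)
  open import Data.Nat.DivMod using (_%_; _/_; m%n<n; m≡m%n+[m/n]*n; m<n⇒m%n≡m; [m+kn]%n≡m%n)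
  open import Data.Nat.GCD using (gcd; gcd-GCD; gcd[m,n]∣m; gcd[m,n]∣n; module Bézout)
  open import Data.Nat.Primality using (Prime; prime⇒nonZero)
  open import Function.Base using (it)
  open import Relation.Binary.Definitions using (tri<; tri≈; tri>)
  open import Relation.Binary.PropositionalEquality
  open Sums ℤₚ.+-*-commutativeRing

  sum-const : ∀ n x → sum {n} (λ _ → x) ≡ + n ℤ.* x
  sum-const zero    x = sym (ℤₚ.*-zeroˡ x)
  sum-const (suc n) x = trans (cong (λ y → x ℤ.+ y) (sum-const n x)) (sym (ℤₚ.suc-* (+ n) x))

  argmin : ∀ n .{{_ : NonZero n}} (f : Fin n → ℕ) → ∃ λ i → ∀ j → f i ℕ.≤ f j
  argmin 1             f = zero , λ { zero → ℕₚ.≤-refl }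
  argmin (suc (suc n)) f with argmin (suc n) (f ∘ suc)
  ... | i , min with f zero ℕₚ.≤? f (suc i)
  ...   | yes f₀≤fᵢ = zero , λ { zero → ℕₚ.≤-refl ; (suc j) → ℕₚ.≤-trans f₀≤fᵢ (min j) }
  ...   | no  f₀≰fᵢ = suc i , λ { zero → ℕₚ.<⇒≤ (ℕₚ.≰⇒> f₀≰fᵢ) ; (suc j) → min j }

  module Words (m : ℕ) where

    Word : Set
    Word = List (Fin m)

    _≟ʷ_ : (u v : Word) → Dec (u ≡ v)
    _≟ʷ_ = Listₚ.≡-dec Finₚ._≟_

    sumWords : ℕ → (Word → ℤ) → ℤ
    sumWords zero    f = f []
    sumWords (suc k) f = sum λ l → sumWords k λ w → f (l ∷ w)

    sumWords-cong : ∀ k {f g : Word → ℤ} → (∀ w → length w ≡ k → f w ≡ g w) → sumWords k f ≡ sumWords k g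
    sumWords-cong zero    eq = eq [] refl
    sumWords-cong (suc k) eq = sum-cong-≗ λ l → sumWords-cong k λ w len → eq (l ∷ w) (cong suc len)

    sumWords-zero : ∀ k {f : Word → ℤ} → (∀ w → length w ≡ k → f w ≡ ℤ.0ℤ) → sumWords k f ≡ ℤ.0ℤ
    sumWords-zero zero    eq = eq [] refl
    sumWords-zero (suc k) eq = sum-zero λ l → sumWords-zero k λ w len → eq (l ∷ w) (cong suc len)

    sumWords-+ : ∀ k (f g : Word → ℤ) → sumWords k (λ w → f w ℤ.+ g w) ≡ sumWords k f ℤ.+ sumWords k g
    sumWords-+ zero    f g = refl
    sumWords-+ (suc k) f g = trans (sum-cong-≗ λ l → sumWords-+ k (f ∘ (l ∷_)) (g ∘ (l ∷_)))
      (∑-distrib-+ (λ l → sumWords k (f ∘ (l ∷_))) (λ l → sumWords k (g ∘ (l ∷_))))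

    sumWords-∑ : ∀ k {n} (f : Fin n → Word → ℤ) →
                 sumWords k (λ w → sum λ i → f i w) ≡ sum λ i → sumWords k (f i)
    sumWords-∑ zero    f = refl
    sumWords-∑ (suc k) f = trans (sum-cong-≗ λ l → sumWords-∑ k λ i w → f i (l ∷ w)) (∑-comm λ l i → sumWords k (f i ∘ (l ∷_)))

    sumWords-++ : ∀ j k (f : Word → ℤ) →
                  sumWords (j ℕ.+ k) f ≡ sumWords j λ u → sumWords k λ v → f (u ++ v)
    sumWords-++ zero    k f = refl
    sumWords-++ (suc j) k f = sum-cong-≗ λ l → sumWords-++ j k (f ∘ (l ∷_))

    sumWords-single : ∀ w (f : Word → ℤ) → (∀ v → length v ≡ length w → v ≢ w → f v ≡ ℤ.0ℤ) →
                      sumWords (length w) f ≡ f w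
    sumWords-single []      f eq = refl
    sumWords-single (l ∷ w) f eq = trans
      (sum-single l _ λ i i≢l → sumWords-zero (length w) λ v len →
        eq (i ∷ v) (cong suc len) (i≢l ∘ Listₚ.∷-injectiveˡ))
      (sumWords-single w (f ∘ (l ∷_)) λ v len v≢w → eq (l ∷ v) (cong suc len) (v≢w ∘ Listₚ.∷-injectiveʳ))

    rotate : Word → Word
    rotate []      = []
    rotate (l ∷ w) = w ++ l ∷ []

    rotateBy : ℕ → Word → Word
    rotateBy zero    w = w
    rotateBy (suc i) w = rotateBy i (rotate w)

    sumWords-rotate : ∀ k (f : Word → ℤ) → sumWords k (f ∘ rotate) ≡ sumWords k f
    sumWords-rotate zero    f = refl
    sumWords-rotate (suc k) f = begin
      (sum λ l → sumWords k λ w → f (w ++ l ∷ []))  ≡⟨ sumWords-∑ k (λ l w → f (w ++ l ∷ [])) ⟨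
      (sumWords k λ w → sum λ l → f (w ++ l ∷ []))  ≡⟨ sumWords-++ k 1 f ⟨
      sumWords (k ℕ.+ 1) f  ≡⟨ cong (λ j → sumWords j f) (ℕₚ.+-comm k 1) ⟩
      sumWords (suc k) f                            ∎
      where open ≡-Reasoning

    sumWords-rotateBy : ∀ k i (f : Word → ℤ) → sumWords k (f ∘ rotateBy i) ≡ sumWords k f
    sumWords-rotateBy k zero    f = refl
    sumWords-rotateBy k (suc i) f = trans (sumWords-rotate k (f ∘ rotateBy i)) (sumWords-rotateBy k i f)

    rotateBy-+ : ∀ i j w → rotateBy (i ℕ.+ j) w ≡ rotateBy j (rotateBy i w)
    rotateBy-+ zero    j w = refl
    rotateBy-+ (suc i) j w = rotateBy-+ i j (rotate w)

    rotateBy-++ : ∀ u v → rotateBy (length u) (u ++ v) ≡ v ++ u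
    rotateBy-++ []      v = sym (Listₚ.++-identityʳ v)
    rotateBy-++ (l ∷ u) v = begin
      rotateBy (length u) ((u ++ v) ++ l ∷ [])  ≡⟨ cong (rotateBy (length u)) (Listₚ.++-assoc u v (l ∷ [])) ⟩
      rotateBy (length u) (u ++ v ++ l ∷ [])  ≡⟨ rotateBy-++ u (v ++ l ∷ []) ⟩
      (v ++ l ∷ []) ++ u  ≡⟨ Listₚ.++-assoc v (l ∷ []) u ⟩
      v ++ l ∷ u                                ∎
      where open ≡-Reasoning

    rotateBy-length : ∀ w → rotateBy (length w) w ≡ w
    rotateBy-length w = trans (cong (rotateBy (length w)) (sym (Listₚ.++-identityʳ w))) (rotateBy-++ w [])

    length-rotate : ∀ w → length (rotate w) ≡ length w
    length-rotate []      = refl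
    length-rotate (l ∷ w) = trans (Listₚ.length-++ w) (ℕₚ.+-comm (length w) 1)

    length-rotateBy : ∀ i w → length (rotateBy i w) ≡ length w
    length-rotateBy zero    w = refl
    length-rotateBy (suc i) w = trans (length-rotateBy i (rotate w)) (length-rotate w)

    IsPeriod : Word → ℕ → Set
    IsPeriod w i = rotateBy i w ≡ w

    period-* : ∀ {w i} → IsPeriod w i → ∀ k → IsPeriod w (k ℕ.* i)
    period-* per zero = refl
    period-* {w} {i} per (suc k) =
      trans (rotateBy-+ i (k ℕ.* i) w) (trans (cong (rotateBy (k ℕ.* i)) per) (period-* per k))

    period-∣ : ∀ {w i j} → i ∣ j → IsPeriod w i → IsPeriod w j
    period-∣ (divides k refl) per = period-* per k

    period-cancel : ∀ {w} i {j} → IsPeriod w j → IsPeriod w (i ℕ.+ j) → IsPeriod w i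
    period-cancel {w} i {j} perⱼ per = begin
      rotateBy i w               ≡⟨ cong (rotateBy i) perⱼ ⟨
      rotateBy i (rotateBy j w)  ≡⟨ rotateBy-+ j i w ⟨
      rotateBy (j ℕ.+ i) w  ≡⟨ cong (λ k → rotateBy k w) (ℕₚ.+-comm j i) ⟩
      rotateBy (i ℕ.+ j) w       ≡⟨ per ⟩
      w                          ∎
      where open ≡-Reasoning

    -- Periods are closed under multiples and, by `period-cancel`, under differences, so the Bézout
    -- identity applies.
    period-gcd : ∀ {w} i j → IsPeriod w i → IsPeriod w j → IsPeriod w (gcd i j)
    period-gcd {w} i j perᵢ perⱼ with Bézout.identity (gcd-GCD i j)
    ... | Bézout.+- x y eq = period-cancel (gcd i j) (period-* perⱼ y) (subst (IsPeriod w) (sym eq) (period-* perᵢ x))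
    ... | Bézout.-+ x y eq = period-cancel (gcd i j) (period-* perᵢ x) (subst (IsPeriod w) (sym eq) (period-* perⱼ y))

    rotateBy-% : ∀ w i .{{_ : NonZero (length w)}} → rotateBy (i % length w) w ≡ rotateBy i w
    rotateBy-% w i = begin
      rotateBy r w  ≡⟨ cong (rotateBy r) (period-* (rotateBy-length w) k) ⟨
      rotateBy r (rotateBy (k ℕ.* l) w)  ≡⟨ rotateBy-+ (k ℕ.* l) r w ⟨
      rotateBy (k ℕ.* l ℕ.+ r) w  ≡⟨ cong (λ j → rotateBy j w) (ℕₚ.+-comm (k ℕ.* l) r) ⟩
      rotateBy (r ℕ.+ k ℕ.* l) w  ≡⟨ cong (λ j → rotateBy j w) (m≡m%n+[m/n]*n i l) ⟨
      rotateBy i w                       ∎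
      where
      open ≡-Reasoning
      l = length w
      r = i % l
      k = i / l

    -- The word read as a number in base m, least significant digit first. It serves to order words
    -- of equal length and so to single out one rotation of each.
    code : Word → ℕ
    code []      = 0
    code (l ∷ w) = toℕ l ℕ.+ code w ℕ.* m

    code-injective : ∀ u v → length u ≡ length v → code u ≡ code v → u ≡ v
    code-injective []      []      _   _  = refl
    code-injective (k ∷ u) (l ∷ v) len eq = cong₂ _∷_ k≡l (code-injective u v (ℕₚ.suc-injective len) tails)
      where
      open ≡-Reasoning
      instance
        m≢0 : NonZero m
        m≢0 = Finₚ.nonZeroIndex k
      digit : ∀ (j : Fin m) w → (toℕ j ℕ.+ code w ℕ.* m) % m ≡ toℕ j
      digit j w = trans ([m+kn]%n≡m%n (toℕ j) (code w) m) (m<n⇒m%n≡m (Finₚ.toℕ<n j))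
      k≡l : k ≡ l
      k≡l = Finₚ.toℕ-injective (trans (sym (digit k u)) (trans (cong (_% m) eq) (digit l v)))
      tails : code u ≡ code v
      tails = ℕₚ.*-cancelʳ-≡ (code u) (code v) m (ℕₚ.+-cancelˡ-≡ (toℕ l) _ _
        (trans (cong (λ j → toℕ j ℕ.+ code u ℕ.* m) (sym k≡l)) eq))

    -- The code is least among all rotations. Bounding i by the length keeps this decidable;
    -- `canonical-≤` then covers every i.
    IsCanonical : Word → Set
    IsCanonical w = ∀ (i : Fin (length w)) → code w ℕ.≤ code (rotateBy (toℕ i) w)

    canonical? : ∀ w → Dec (IsCanonical w)
    canonical? w = Finₚ.all? λ i → code w ℕₚ.≤? code (rotateBy (toℕ i) w)

    canonical-≤ : ∀ {w} .{{_ : NonZero (length w)}} → IsCanonical w → ∀ i → code w ℕ.≤ code (rotateBy i w)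
    canonical-≤ {w} can i = subst (λ v → code w ℕ.≤ code v)
      (trans (cong (λ k → rotateBy k w) (Finₚ.toℕ-fromℕ< (m%n<n i (length w)))) (rotateBy-% w i))
      (can (fromℕ< (m%n<n i (length w))))

    canonical-exists : ∀ w .{{_ : NonZero (length w)}} → ∃ λ (i : Fin (length w)) → IsCanonical (rotateBy (toℕ i) w)
    canonical-exists w with argmin (length w) (λ i → code (rotateBy (toℕ i) w))
    ... | i , min = i , λ j → subst (λ v → code (rotateBy (toℕ i) w) ℕ.≤ code v)
      (trans (cong (λ k → rotateBy k w) (Finₚ.toℕ-fromℕ< (m%n<n (toℕ i ℕ.+ toℕ j) (length w))))
        (trans (rotateBy-% w (toℕ i ℕ.+ toℕ j)) (rotateBy-+ (toℕ i) (toℕ j) w)))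
      (min (fromℕ< (m%n<n (toℕ i ℕ.+ toℕ j) (length w))))

    -- Both rotations have the least code, so they are the same word; c letters complete the turn
    -- from the second one back to w, which shows that shifting by d changes nothing.
    canonical-period : ∀ {w} i d c → length w ≡ i ℕ.+ d ℕ.+ c → {{_ : NonZero (length w)}} →
                       IsCanonical (rotateBy i w) → IsCanonical (rotateBy (i ℕ.+ d) w) → IsPeriod w d
    canonical-period {w} i d c len canᵢ canⱼ = begin
      rotateBy d w  ≡⟨ cong (rotateBy d) per ⟨
      rotateBy d (rotateBy (i ℕ.+ d ℕ.+ c) w)  ≡⟨ rotateBy-+ (i ℕ.+ d ℕ.+ c) d w ⟨
      rotateBy (i ℕ.+ d ℕ.+ c ℕ.+ d) w  ≡⟨ cong (λ k → rotateBy k w) (ℕₚ.+-assoc (i ℕ.+ d) c d) ⟩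
      rotateBy (i ℕ.+ d ℕ.+ (c ℕ.+ d)) w  ≡⟨ rotateBy-+ (i ℕ.+ d) (c ℕ.+ d) w ⟩
      rotateBy (c ℕ.+ d) (rotateBy (i ℕ.+ d) w)  ≡⟨ cong (rotateBy (c ℕ.+ d)) equal ⟨
      rotateBy (c ℕ.+ d) (rotateBy i w)  ≡⟨ rotateBy-+ i (c ℕ.+ d) w ⟨
      rotateBy (i ℕ.+ (c ℕ.+ d)) w  ≡⟨ cong (λ k → rotateBy k w) reorder ⟩
      rotateBy (i ℕ.+ d ℕ.+ c) w                    ≡⟨ per ⟩
      w                                             ∎
      where
      open ≡-Reasoning
      per : IsPeriod w (i ℕ.+ d ℕ.+ c)
      per = subst (IsPeriod w) len (rotateBy-length w)
      reorder : i ℕ.+ (c ℕ.+ d) ≡ i ℕ.+ d ℕ.+ c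
      reorder = trans (cong (i ℕ.+_) (ℕₚ.+-comm c d)) (sym (ℕₚ.+-assoc i d c))
      nonEmpty : ∀ k → NonZero (length (rotateBy k w))
      nonEmpty k = subst NonZero (sym (length-rotateBy k w)) it
      equal : rotateBy i w ≡ rotateBy (i ℕ.+ d) w
      equal = code-injective _ _ (trans (length-rotateBy i w) (sym (length-rotateBy (i ℕ.+ d) w))) (ℕₚ.≤-antisym
        (subst (λ v → code (rotateBy i w) ℕ.≤ code v) (sym (rotateBy-+ i d w))
          (canonical-≤ {{nonEmpty i}} canᵢ d))
        (subst (λ v → code (rotateBy (i ℕ.+ d) w) ℕ.≤ code v)
          (begin
            rotateBy (c ℕ.+ i) (rotateBy (i ℕ.+ d) w)  ≡⟨ rotateBy-+ (i ℕ.+ d) (c ℕ.+ i) w ⟨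
            rotateBy (i ℕ.+ d ℕ.+ (c ℕ.+ i)) w  ≡⟨ cong (λ k → rotateBy k w) (ℕₚ.+-assoc (i ℕ.+ d) c i) ⟨
            rotateBy (i ℕ.+ d ℕ.+ c ℕ.+ i) w  ≡⟨ rotateBy-+ (i ℕ.+ d ℕ.+ c) i w ⟩
            rotateBy i (rotateBy (i ℕ.+ d ℕ.+ c) w)  ≡⟨ cong (rotateBy i) per ⟩
            rotateBy i w                               ∎)
          (canonical-≤ {{nonEmpty (i ℕ.+ d)}} canⱼ (c ℕ.+ i))))

    repeat : ℕ → Word → Word
    repeat zero    u = []
    repeat (suc k) u = u ++ repeat k u

    length-repeat : ∀ k u → length (repeat k u) ≡ k ℕ.* length u
    length-repeat zero    u = refl
    length-repeat (suc k) u = trans (Listₚ.length-++ u) (cong (length u ℕ.+_) (length-repeat k u))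

    repeat-comm : ∀ k u → u ++ repeat k u ≡ repeat k u ++ u
    repeat-comm zero    u = Listₚ.++-identityʳ u
    repeat-comm (suc k) u = trans (cong (u ++_) (repeat-comm k u)) (sym (Listₚ.++-assoc u (repeat k u) u))

    split : ∀ j {k} (w : Word) → length w ≡ j ℕ.+ k → ∃ λ (u : Word) → ∃ λ (v : Word) → w ≡ u ++ v × length u ≡ j × length v ≡ k
    split zero    w       len = [] , w , refl , refl , len
    split (suc j) {k} (l ∷ w) len with split j {k} w (ℕₚ.suc-injective len)
    ... | u , v , refl , lenᵤ , lenᵥ = l ∷ u , v , refl , cong suc lenᵤ , lenᵥ

    ++-equalˡ : ∀ (u u′ : Word) {v v′ : Word} → length u ≡ length u′ → u ++ v ≡ u′ ++ v′ → u ≡ u′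
    ++-equalˡ []      []       _   _  = refl
    ++-equalˡ (k ∷ u) (l ∷ u′) len eq = cong₂ _∷_ (Listₚ.∷-injectiveˡ eq)
      (++-equalˡ u u′ (ℕₚ.suc-injective len) (Listₚ.∷-injectiveʳ eq))

    -- A special case of the fact that commuting words are powers of a common word: here the length
    -- of v is a multiple of that of u, and copies of u can be split off v one at a time.
    commuting⇒repeat : ∀ k u v → length v ≡ k ℕ.* length u → u ++ v ≡ v ++ u → v ≡ repeat k u
    commuting⇒repeat zero    u []  _   _ = refl
    commuting⇒repeat (suc k) u v len eq with split (length u) {k ℕ.* length u} v len
    ... | u′ , v′ , refl , lenᵤ , lenᵥ with ++-equalˡ u u′ (sym lenᵤ) (trans eq (Listₚ.++-assoc u′ v′ u))
    ...   | refl = cong (u ++_) (commuting⇒repeat k u v′ lenᵥ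
                     (Listₚ.++-cancelˡ u _ _ (trans eq (Listₚ.++-assoc u v′ u))))

    module _ {p : ℕ} (pp : Prime p) (j : ℕ) where

      private
        instance
          p≢0 : NonZero p
          p≢0 = prime⇒nonZero pp
        Q q : ℕ
        Q = p ℕ.^ j
        q = p ℕ.^ suc j
        q≢0 : NonZero q
        q≢0 = ℕₚ.m^n≢0 p (suc j)

      -- The gcd of d and q = pʲ⁺¹ is again a period. It is a divisor of pʲ⁺¹ other than pʲ⁺¹
      -- itself, and therefore divides Q = pʲ.
      short-period : ∀ {w} d → 0 ℕ.< d → d ℕ.< length w → length w ≡ q → IsPeriod w d → IsPeriod w Q
      short-period {w} d d>0 d<len len per with divisor-prime^ pp j (gcd[m,n]∣n d q)
      ... | inj₁ gcd≡q = contradiction (∣⇒≤ {{ℕ.>-nonZero d>0}} (subst (_∣ d) gcd≡q (gcd[m,n]∣m d q)))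
                           (ℕₚ.<⇒≱ (subst (d ℕ.<_) len d<len))
      ... | inj₂ gcd∣Q = period-∣ gcd∣Q (period-gcd d q per (subst (IsPeriod w) len (rotateBy-length w)))

      -- Two canonical rotations would differ by a period shorter than the word, which
      -- `short-period` turns into the excluded period Q.
      aperiodic⇒one-canonical : ∀ w → length w ≡ q → ¬ IsPeriod w Q →
        sum {length w} (λ i → indicator (canonical? (rotateBy (toℕ i) w))) ≡ ℤ.1ℤ
      aperiodic⇒one-canonical w len aper with canonical-exists w {{subst NonZero (sym len) q≢0}}
      ... | i , canᵢ = trans (sum-single i _ λ k k≢i → indicator-no (canonical? _) λ canₖ → k≢i (unique k canₖ))
                         (indicator-yes (canonical? _) canᵢ)
        where
        instance
          w≢0 : NonZero (length w)
          w≢0 = subst NonZero (sym len) q≢0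
        ordered : ∀ (a b : Fin (length w)) → toℕ a ℕ.< toℕ b → IsCanonical (rotateBy (toℕ a) w) →
                  IsCanonical (rotateBy (toℕ b) w) → IsPeriod w Q
        ordered a b a<b canₐ canᵦ with ℕₚ.m≤n⇒∃[o]m+o≡n a<b | ℕₚ.m≤n⇒∃[o]m+o≡n (ℕₚ.<⇒≤ (Finₚ.toℕ<n b))
        ... | d , a+d≡b | c , b+c≡len = short-period (suc d) (ℕ.s≤s ℕ.z≤n)
              (ℕₚ.≤-<-trans (ℕₚ.≤-trans (ℕₚ.m≤n+m (suc d) (toℕ a)) (ℕₚ.≤-reflexive a+d)) (Finₚ.toℕ<n b)) len
              (canonical-period (toℕ a) (suc d) c (trans (sym b+c≡len) (cong (ℕ._+ c) (sym a+d))) canₐ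
                (subst (λ k → IsCanonical (rotateBy k w)) (sym a+d) canᵦ))
          where
          a+d : toℕ a ℕ.+ suc d ≡ toℕ b
          a+d = trans (ℕₚ.+-suc (toℕ a) d) a+d≡b
        unique : ∀ k → IsCanonical (rotateBy (toℕ k) w) → k ≡ i
        unique k canₖ with ℕₚ.<-cmp (toℕ k) (toℕ i)
        ... | tri< k<i _ _ = contradiction (ordered k i k<i canₖ canᵢ) aper
        ... | tri≈ _ k≡i _ = Finₚ.toℕ-injective k≡i
        ... | tri> _ _ i<k = contradiction (ordered i k i<k canᵢ canₖ) aper

      private
        period? : ∀ w → Dec (IsPeriod w Q)
        period? w = rotateBy Q w ≟ʷ w

      rotate-period : ∀ {w i} → IsPeriod w i → IsPeriod (rotate w) i
      rotate-period {w} {i} per = begin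
        rotateBy (1 ℕ.+ i) w  ≡⟨ cong (λ k → rotateBy k w) (ℕₚ.+-comm 1 i) ⟩
        rotateBy (i ℕ.+ 1) w    ≡⟨ rotateBy-+ i 1 w ⟩
        rotate (rotateBy i w)   ≡⟨ cong rotate per ⟩
        rotate w                ∎
        where open ≡-Reasoning

      rotateBy-period : ∀ {w i} k → IsPeriod w i → IsPeriod (rotateBy k w) i
      rotateBy-period zero    per = per
      rotateBy-period {i = i} (suc k) per = rotateBy-period {i = i} k (rotate-period {i = i} per)

      rotate-period⁻ : ∀ {w i} → IsPeriod (rotate w) i → IsPeriod w i
      rotate-period⁻ {[]}    {i} per = per
      -- Rotating `length w` further completes the turn and returns to `l ∷ w`.
      rotate-period⁻ {l ∷ w} {i} per =
        subst (λ v → IsPeriod v i) (rotateBy-length (l ∷ w)) (rotateBy-period {i = i} (length w) per)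

      -- A word without period pʲ has pʲ⁺¹ distinct rotations, exactly one of them
      -- canonical, so that these words contribute a multiple of pʲ⁺¹; the others
      -- are the p-fold repetitions of words of length pʲ.

      necklace : (f : Word → ℤ) → (∀ w → f (rotate w) ≡ f w) →
                 + q ∣ℤ sumWords q f ℤ.- sumWords Q (f ∘ repeat p)
      necklace f inv = ℤᵈ.divides (sumWords q (λ w → g w ℤ.* indicator (canonical? w))) (begin
          sumWords q f ℤ.- sumWords Q (f ∘ repeat p)  ≡⟨ cong₂ ℤ._-_ split-f sum-h ⟨
          (sumWords q g ℤ.+ sumWords q h) ℤ.- sumWords q h  ≡⟨ ℤₚ.+-assoc (sumWords q g) _ _ ⟩
          sumWords q g ℤ.+ (sumWords q h ℤ.- sumWords q h)  ≡⟨ cong (λ z → sumWords q g ℤ.+ z) (ℤₚ.+-inverseʳ (sumWords q h)) ⟩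
          sumWords q g ℤ.+ ℤ.0ℤ  ≡⟨ ℤₚ.+-identityʳ _ ⟩
          sumWords q g  ≡⟨ sum-g ⟩
          + q ℤ.* sumWords q (λ w → g w ℤ.* indicator (canonical? w)) ≡⟨ ℤₚ.*-comm (+ q) _ ⟩
          sumWords q (λ w → g w ℤ.* indicator (canonical? w)) ℤ.* + q ∎)
        where
        open ≡-Reasoning
        g h gᶜ : Word → ℤ
        g w = f w ℤ.* indicator (¬? (period? w))
        h w = f w ℤ.* indicator (period? w)
        gᶜ w = g w ℤ.* indicator (canonical? w)

        split-f : sumWords q g ℤ.+ sumWords q h ≡ sumWords q f
        split-f = trans (sym (sumWords-+ q g h)) (sumWords-cong q λ w _ → split-at (f w) (period? w))
          where
          split-at : ∀ x {P : Set} (d : Dec P) → x ℤ.* indicator (¬? d) ℤ.+ x ℤ.* indicator d ≡ x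
          split-at x (yes _) = trans (cong₂ ℤ._+_ (ℤₚ.*-zeroʳ x) (ℤₚ.*-identityʳ x)) (ℤₚ.+-identityˡ x)
          split-at x (no _)  = trans (cong₂ ℤ._+_ (ℤₚ.*-identityʳ x) (ℤₚ.*-zeroʳ x)) (ℤₚ.+-identityʳ x)

        g-rotateBy : ∀ i w → g (rotateBy i w) ≡ g w
        g-rotateBy zero    w = refl
        g-rotateBy (suc i) w = trans (g-rotateBy i (rotate w)) (cong₂ ℤ._*_ (inv w)
          (indicator-⇔ (¬? (period? (rotate w))) (¬? (period? w))
            (λ aper per → aper (rotate-period {i = Q} per)) (λ aper per → aper (rotate-period⁻ {i = Q} per))))

        -- Where `g` is nonzero exactly one rotation is canonical, so multiplying by their number
        -- changes nothing. Once the sums are exchanged, all q rotations contribute equally, and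
        -- this produces the factor q.
        g-spread : ∀ w → length w ≡ q → g w ≡ sum {q} λ i → gᶜ (rotateBy (toℕ i) w)
        g-spread w len = begin
          g w  ≡⟨ count ⟩
          g w ℤ.* sum {q} (λ i → indicator (canonical? (rotateBy (toℕ i) w)))  ≡⟨ *-distribˡ-sum {q} (g w) (λ i → indicator (canonical? (rotateBy (toℕ i) w))) ⟩
          sum {q} (λ i → g w ℤ.* indicator (canonical? (rotateBy (toℕ i) w)))  ≡⟨ sum-cong-≗ {q} (λ i → cong (ℤ._* indicator (canonical? (rotateBy (toℕ i) w))) (g-rotateBy (toℕ i) w)) ⟨
          sum {q} (λ i → gᶜ (rotateBy (toℕ i) w))  ∎
          where
          count : g w ≡ g w ℤ.* sum {q} (λ i → indicator (canonical? (rotateBy (toℕ i) w)))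
          count with period? w
          ... | yes _ = trans (ℤₚ.*-zeroʳ (f w)) (sym (cong (ℤ._* sum {q} (λ i → indicator (canonical? (rotateBy (toℕ i) w)))) (ℤₚ.*-zeroʳ (f w))))
          ... | no aper = sym (trans (cong (f w ℤ.* ℤ.1ℤ ℤ.*_)
                  (subst (λ k → sum {k} (λ i → indicator (canonical? (rotateBy (toℕ i) w))) ≡ ℤ.1ℤ) len
                    (aperiodic⇒one-canonical w len aper)))
                  (ℤₚ.*-identityʳ (f w ℤ.* ℤ.1ℤ)))

        sum-g : sumWords q g ≡ + q ℤ.* sumWords q gᶜ
        sum-g = begin
          sumWords q g  ≡⟨ sumWords-cong q g-spread ⟩
          sumWords q (λ w → sum {q} λ i → gᶜ (rotateBy (toℕ i) w))  ≡⟨ sumWords-∑ q (λ (i : Fin q) w → gᶜ (rotateBy (toℕ i) w)) ⟩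
          (sum {q} λ i → sumWords q (gᶜ ∘ rotateBy (toℕ i)))  ≡⟨ sum-cong-≗ {q} (λ i → sumWords-rotateBy q (toℕ i) gᶜ) ⟩
          (sum {q} λ i → sumWords q gᶜ)  ≡⟨ sum-const q (sumWords q gᶜ) ⟩
          + q ℤ.* sumWords q gᶜ  ∎

        -- A word of period Q is determined by its first Q letters u: the remainder commutes with u
        -- and is thus a repetition of it. So for each u the inner sum has a single nonzero term.
        sum-h : sumWords q h ≡ sumWords Q (f ∘ repeat p)
        sum-h = begin
          sumWords q h  ≡⟨ cong (λ k → sumWords (k ℕ.* Q) h) (ℕₚ.suc-pred p) ⟨
          sumWords (Q ℕ.+ ℕ.pred p ℕ.* Q) h  ≡⟨ sumWords-++ Q (ℕ.pred p ℕ.* Q) h ⟩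
          (sumWords Q λ u → sumWords (ℕ.pred p ℕ.* Q) λ v → h (u ++ v)) ≡⟨ sumWords-cong Q inner ⟩
          sumWords Q (f ∘ repeat p)  ∎
          where
          inner : ∀ u → length u ≡ Q → sumWords (ℕ.pred p ℕ.* Q) (λ v → h (u ++ v)) ≡ f (repeat p u)
          inner u len = begin
            sumWords (ℕ.pred p ℕ.* Q) F  ≡⟨ cong (λ k → sumWords k F) lenᵣ ⟨
            sumWords (length r) F  ≡⟨ sumWords-single r F others ⟩
            F r  ≡⟨ cong (f (u ++ r) ℤ.*_) (indicator-yes (period? (u ++ r)) perᵣ) ⟩
            f (u ++ r) ℤ.* ℤ.1ℤ  ≡⟨ ℤₚ.*-identityʳ _ ⟩
            f (u ++ r)  ≡⟨ cong (λ k → f (repeat k u)) (ℕₚ.suc-pred p) ⟩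
            f (repeat p u)                     ∎
            where
            F : Word → ℤ
            F v = h (u ++ v)
            r : Word
            r = repeat (ℕ.pred p) u
            lenᵣ : length r ≡ ℕ.pred p ℕ.* Q
            lenᵣ = trans (length-repeat (ℕ.pred p) u) (cong (ℕ.pred p ℕ.*_) len)
            rotated : ∀ v → rotateBy Q (u ++ v) ≡ v ++ u
            rotated v = trans (cong (λ k → rotateBy k (u ++ v)) (sym len)) (rotateBy-++ u v)
            perᵣ : IsPeriod (u ++ r) Q
            perᵣ = trans (rotated r) (sym (repeat-comm (ℕ.pred p) u))
            others : ∀ v → length v ≡ length r → v ≢ r → F v ≡ ℤ.0ℤ
            others v lenᵥ v≢r = trans (cong (f (u ++ v) ℤ.*_) (indicator-no (period? (u ++ v)) λ per →
                v≢r (commuting⇒repeat (ℕ.pred p) u v (trans lenᵥ (length-repeat (ℕ.pred p) u))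
                  (trans (sym per) (rotated v)))))
              (ℤₚ.*-zeroʳ (f (u ++ v)))

open Necklaces

-- The group ring and its centre

module Convolution {n : ℕ} (G : FinGroup n) where
  open import Data.Integer.Base as ℤ using (ℤ; +_)
  import Data.Integer.Properties as ℤₚ
  open import Relation.Binary.PropositionalEquality
  open Sums ℤₚ.+-*-commutativeRing

  open FinGroup G

  infixl 7 _⋆_
  -- The product of ℤ[G], whose elements are given by their coefficients; `IsClass` describes the
  -- centre.
  _⋆_ : (Fin n → ℤ) → (Fin n → ℤ) → Fin n → ℤ
  (a ⋆ b) g = sum λ h → a h ℤ.* b (h ⁻¹ ∙ g)

  δ : Fin n → ℤ
  δ g = indicator (g Finₚ.≟ ε)

  IsClass : (Fin n → ℤ) → Set
  IsClass a = ∀ g x → a (conjugate g x) ≡ a x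

  class-comm : ∀ {a} → IsClass a → ∀ x y → a (x ∙ y) ≡ a (y ∙ x)
  class-comm {a} cl x y = begin
    a (x ∙ y)               ≡⟨ cong a (cancelʳ-∙⁻¹ x (x ∙ y)) ⟨
    a (x ∙ y ∙ x ∙ x ⁻¹)  ≡⟨ cong (λ z → a (z ∙ x ⁻¹)) (assoc x y x) ⟩
    a (conjugate x (y ∙ x)) ≡⟨ cl x (y ∙ x) ⟩
    a (y ∙ x)               ∎
    where open ≡-Reasoning

  sum-translate : ∀ x (f : Fin n → ℤ) → sum f ≡ sum (λ y → f (x ∙ y))
  sum-translate x f = sum-bijection f (x ∙_) (x ⁻¹ ∙_) (cancel-∙⁻¹ x) (cancel-⁻¹∙ x)

  sum-translateʳ : ∀ x (f : Fin n → ℤ) → sum f ≡ sum (λ y → f (y ∙ x))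
  sum-translateʳ x f = sum-bijection f (_∙ x) (_∙ x ⁻¹) (cancelʳ-⁻¹∙ x) (cancelʳ-∙⁻¹ x)

  conjugate-inv : ∀ g x → (conjugate g x) ⁻¹ ≡ conjugate g (x ⁻¹)
  conjugate-inv g x = sym (inverseʳ-unique (conjugate g x) (conjugate g (x ⁻¹))
    (trans (conjugate-∙ g x (x ⁻¹)) (trans (cong (conjugate g) (inverseʳ x)) (conjugate-ε g))))

  conjugate-⁻¹′ : ∀ g x → conjugate g (conjugate (g ⁻¹) x) ≡ x
  conjugate-⁻¹′ g x = trans (cong (λ h → conjugate h (conjugate (g ⁻¹) x)) (sym (⁻¹-involutive g)))
    (conjugate-⁻¹ (g ⁻¹) x)

  ⋆-cong : ∀ {a a′ b b′} → a ≗ a′ → b ≗ b′ → a ⋆ b ≗ a′ ⋆ b′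
  ⋆-cong p q g = sum-cong-≗ λ h → cong₂ ℤ._*_ (p h) (q (h ⁻¹ ∙ g))

  -- Substituting k⁻¹g for the summation variable turns the argument of a into g⁻¹kg, a conjugate of
  -- k.
  ⋆-comm : ∀ {a} → IsClass a → ∀ b → a ⋆ b ≗ b ⋆ a
  ⋆-comm {a} cl b g = sym (begin
    (sum λ h → b h ℤ.* a (h ⁻¹ ∙ g))
      ≡⟨ sum-bijection (λ h → b h ℤ.* a (h ⁻¹ ∙ g)) (λ k → k ⁻¹ ∙ g) (λ h → g ∙ h ⁻¹) στ τσ ⟩
    (sum λ k → b (k ⁻¹ ∙ g) ℤ.* a ((k ⁻¹ ∙ g) ⁻¹ ∙ g))
      ≡⟨ sum-cong-≗ (λ k → trans (cong (b (k ⁻¹ ∙ g) ℤ.*_) (value k)) (ℤₚ.*-comm (b (k ⁻¹ ∙ g)) (a k))) ⟩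
    (sum λ k → a k ℤ.* b (k ⁻¹ ∙ g)) ∎)
    where
    open ≡-Reasoning
    inv : ∀ k → (k ⁻¹ ∙ g) ⁻¹ ≡ g ⁻¹ ∙ k
    inv k = trans (⁻¹-anti-homo-∙ (k ⁻¹) g) (cong (g ⁻¹ ∙_) (⁻¹-involutive k))
    στ : ∀ h → (g ∙ h ⁻¹) ⁻¹ ∙ g ≡ h
    στ h = trans (cong (_∙ g) (trans (⁻¹-anti-homo-∙ g (h ⁻¹)) (cong (_∙ g ⁻¹) (⁻¹-involutive h)))) (cancelʳ-⁻¹∙ g h)
    τσ : ∀ k → g ∙ (k ⁻¹ ∙ g) ⁻¹ ≡ k
    τσ k = trans (cong (g ∙_) (inv k)) (cancel-∙⁻¹ g k)
    value : ∀ k → a ((k ⁻¹ ∙ g) ⁻¹ ∙ g) ≡ a k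
    value k = trans (cong (λ z → a (z ∙ g)) (inv k))
      (trans (class-comm {a} cl (g ⁻¹ ∙ k) g) (cong a (cancel-∙⁻¹ g k)))

  ⋆-assoc : ∀ a b c → (a ⋆ b) ⋆ c ≗ a ⋆ (b ⋆ c)
  ⋆-assoc a b c g = begin
    (sum λ h → sum (λ k → a k ℤ.* b (k ⁻¹ ∙ h)) ℤ.* c (h ⁻¹ ∙ g))
      ≡⟨ sum-cong-≗ (λ h → *-distribʳ-sum (c (h ⁻¹ ∙ g)) (λ k → a k ℤ.* b (k ⁻¹ ∙ h))) ⟩
    (sum λ h → sum λ k → a k ℤ.* b (k ⁻¹ ∙ h) ℤ.* c (h ⁻¹ ∙ g))
      ≡⟨ ∑-comm (λ h k → a k ℤ.* b (k ⁻¹ ∙ h) ℤ.* c (h ⁻¹ ∙ g)) ⟩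
    (sum λ k → sum λ h → a k ℤ.* b (k ⁻¹ ∙ h) ℤ.* c (h ⁻¹ ∙ g))
      ≡⟨ sum-cong-≗ (λ k → inner k) ⟩
    (sum λ k → a k ℤ.* (b ⋆ c) (k ⁻¹ ∙ g)) ∎
    where
    open ≡-Reasoning
    inner : ∀ k → sum (λ h → a k ℤ.* b (k ⁻¹ ∙ h) ℤ.* c (h ⁻¹ ∙ g)) ≡ a k ℤ.* (b ⋆ c) (k ⁻¹ ∙ g)
    inner k = begin
      (sum λ h → a k ℤ.* b (k ⁻¹ ∙ h) ℤ.* c (h ⁻¹ ∙ g))
        ≡⟨ sum-translate k (λ h → a k ℤ.* b (k ⁻¹ ∙ h) ℤ.* c (h ⁻¹ ∙ g)) ⟩
      (sum λ h → a k ℤ.* b (k ⁻¹ ∙ (k ∙ h)) ℤ.* c ((k ∙ h) ⁻¹ ∙ g))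
        ≡⟨ sum-cong-≗ (λ h → trans (cong₂ (λ u v → a k ℤ.* b u ℤ.* c v) (cancel-⁻¹∙ k h)
             (trans (cong (_∙ g) (⁻¹-anti-homo-∙ k h)) (assoc (h ⁻¹) (k ⁻¹) g)))
             (ℤₚ.*-assoc (a k) (b h) (c (h ⁻¹ ∙ (k ⁻¹ ∙ g))))) ⟩
      (sum λ h → a k ℤ.* (b h ℤ.* c (h ⁻¹ ∙ (k ⁻¹ ∙ g))))
        ≡⟨ *-distribˡ-sum (a k) (λ h → b h ℤ.* c (h ⁻¹ ∙ (k ⁻¹ ∙ g))) ⟨
      a k ℤ.* (b ⋆ c) (k ⁻¹ ∙ g) ∎

  ⋆-scaledˡ : ∀ k a → (λ g → k ℤ.* δ g) ⋆ a ≗ (λ g → k ℤ.* a g)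
  ⋆-scaledˡ k a g = begin
    (sum λ h → k ℤ.* δ h ℤ.* a (h ⁻¹ ∙ g))
      ≡⟨ sum-single ε (λ h → k ℤ.* δ h ℤ.* a (h ⁻¹ ∙ g)) (λ h h≢ε → trans
           (cong (λ z → k ℤ.* z ℤ.* a (h ⁻¹ ∙ g)) (indicator-no (h Finₚ.≟ ε) h≢ε))
           (cong (ℤ._* a (h ⁻¹ ∙ g)) (ℤₚ.*-zeroʳ k))) ⟩
    k ℤ.* δ ε ℤ.* a (ε ⁻¹ ∙ g)
      ≡⟨ cong₂ (λ z w → k ℤ.* z ℤ.* a w) (indicator-yes (ε Finₚ.≟ ε) refl)
           (trans (cong (_∙ g) ε⁻¹≈ε) (identityˡ g)) ⟩
    k ℤ.* ℤ.1ℤ ℤ.* a g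
      ≡⟨ cong (ℤ._* a g) (ℤₚ.*-identityʳ k) ⟩
    k ℤ.* a g ∎
    where open ≡-Reasoning

  ⋆-identityˡ : ∀ a → δ ⋆ a ≗ a
  ⋆-identityˡ a g = trans (⋆-cong {b = a} (λ h → sym (ℤₚ.*-identityˡ (δ h))) (λ _ → refl) g)
    (trans (⋆-scaledˡ ℤ.1ℤ a g) (ℤₚ.*-identityˡ (a g)))

  ⋆-distribˡ : ∀ a b c → a ⋆ (λ g → b g ℤ.+ c g) ≗ λ g → (a ⋆ b) g ℤ.+ (a ⋆ c) g
  ⋆-distribˡ a b c g = trans
    (sum-cong-≗ λ h → ℤₚ.*-distribˡ-+ (a h) (b (h ⁻¹ ∙ g)) (c (h ⁻¹ ∙ g)))
    (∑-distrib-+ (λ h → a h ℤ.* b (h ⁻¹ ∙ g)) (λ h → a h ℤ.* c (h ⁻¹ ∙ g)))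

  δ-class : IsClass δ
  δ-class g x = indicator-⇔ (conjugate g x Finₚ.≟ ε) (x Finₚ.≟ ε)
    (λ eq → trans (sym (conjugate-⁻¹ g x)) (trans (cong (conjugate (g ⁻¹)) eq) (conjugate-ε (g ⁻¹))))
    (λ eq → trans (cong (conjugate g) eq) (conjugate-ε g))

  ⋆-class : ∀ {a b} → IsClass a → IsClass b → IsClass (a ⋆ b)
  ⋆-class {a} {b} clₐ clᵦ x g = begin
    (sum λ h → a h ℤ.* b (h ⁻¹ ∙ conjugate x g))
      ≡⟨ sum-bijection (λ h → a h ℤ.* b (h ⁻¹ ∙ conjugate x g)) (conjugate x) (conjugate (x ⁻¹))
           (conjugate-⁻¹′ x) (conjugate-⁻¹ x) ⟩
    (sum λ k → a (conjugate x k) ℤ.* b ((conjugate x k) ⁻¹ ∙ conjugate x g))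
      ≡⟨ sum-cong-≗ (λ k → cong₂ ℤ._*_ (clₐ x k) (trans (cong b (trans
           (cong (_∙ conjugate x g) (conjugate-inv x k)) (conjugate-∙ x (k ⁻¹) g))) (clᵦ x (k ⁻¹ ∙ g)))) ⟩
    (sum λ k → a k ℤ.* b (k ⁻¹ ∙ g)) ∎
    where open ≡-Reasoning

  ClassFunction : Set
  ClassFunction = ∃ IsClass

  infix 4 _≈_
  _≈_ : ClassFunction → ClassFunction → Set
  a ≈ b = proj₁ a ≗ proj₁ b

  -- The centre of ℤ[G] is treated as a ring in its own right because the Frobenius argument needs
  -- (xy)ᵏ = xᵏyᵏ.
  classFunctionRing : CommutativeRing 0ℓ 0ℓ
  classFunctionRing = record
    { Carrier = ClassFunction
    ; _≈_     = _≈_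
    ; _+_     = λ (a , clₐ) (b , clᵦ) → (λ g → a g ℤ.+ b g) , λ g x → cong₂ ℤ._+_ (clₐ g x) (clᵦ g x)
    ; _*_     = λ (a , clₐ) (b , clᵦ) → (a ⋆ b) , ⋆-class clₐ clᵦ
    ; -_      = λ (a , clₐ) → (λ g → ℤ.- a g) , λ g x → cong ℤ.-_ (clₐ g x)
    ; 0#      = (λ _ → ℤ.0ℤ) , λ _ _ → refl
    ; 1#      = δ , δ-class
    ; isCommutativeRing = record
      { isRing = record
        { +-isAbelianGroup = record
          { isGroup = record
            { isMonoid = record
              { isSemigroup = record
                { isMagma = record
                  { isEquivalence = record
                    { refl = λ _ → refl ; sym = λ p g → sym (p g) ; trans = λ p q g → trans (p g) (q g) }
                  ; ∙-cong = λ p q g → cong₂ ℤ._+_ (p g) (q g)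
                  }
                ; assoc = λ (a , _) (b , _) (c , _) g → ℤₚ.+-assoc (a g) (b g) (c g)
                }
              ; identity = (λ (a , _) g → ℤₚ.+-identityˡ (a g)) , (λ (a , _) g → ℤₚ.+-identityʳ (a g))
              }
            ; inverse = (λ (a , _) g → ℤₚ.+-inverseˡ (a g)) , (λ (a , _) g → ℤₚ.+-inverseʳ (a g))
            ; ⁻¹-cong = λ p g → cong ℤ.-_ (p g)
            }
          ; comm = λ (a , _) (b , _) g → ℤₚ.+-comm (a g) (b g)
          }
        ; *-cong     = λ p q → ⋆-cong p q
        ; *-assoc    = λ (a , _) (b , _) (c , _) → ⋆-assoc a b c
        ; *-identity = (λ (a , _) → ⋆-identityˡ a)
                     , (λ (a , clₐ) g → trans (⋆-comm clₐ δ g) (⋆-identityˡ a g))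
        ; distrib    = (λ (a , _) (b , _) (c , _) → ⋆-distribˡ a b c)
                     , (λ (a , clₐ) (b , clᵦ) (c , clᶜ) g → trans
                         (sym (⋆-comm clₐ (λ h → b h ℤ.+ c h) g))
                         (trans (⋆-distribˡ a b c g) (cong₂ ℤ._+_ (⋆-comm clₐ b g) (⋆-comm clₐ c g))))
        }
      ; *-comm = λ (a , clₐ) (b , _) → ⋆-comm clₐ b
      }
    }

-- Congruences and lifts of Frobenius

module Congruence {c ℓ : Level} (R : CommutativeRing c ℓ) where
  import Algebra.Properties.CommutativeSemiring.Exp as Exp
  import Algebra.Solver.Ring.NaturalCoefficients.Default as NaturalSolver
  open import Relation.Binary.PropositionalEquality as ≡ using (_≡_)

  open CommutativeRing R hiding (zero)
  open Exp commutativeSemiring public using (_^_; ^-homo-*; ^-assocʳ; ^-distrib-*)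
  open NaturalSolver commutativeSemiring

  infix 4 _≡_[mod_]
  _≡_[mod_] : Carrier → Carrier → Carrier → Set (c Level.⊔ ℓ)
  x ≡ y [mod κ ] = ∃ λ z → x ≈ y + κ * z

  module _ {κ : Carrier} where

    mod-reflexive : ∀ {x y} → x ≈ y → x ≡ y [mod κ ]
    mod-reflexive {x} {y} x≈y = 0# , trans x≈y (solve 2 (λ y κ → y := y :+ κ :* con 0) refl y κ)

    mod-trans : ∀ {x y z} → x ≡ y [mod κ ] → y ≡ z [mod κ ] → x ≡ z [mod κ ]
    mod-trans {z = z} (u , p) (v , q) = v + u , trans p (trans (+-congʳ q)
      (solve 4 (λ z κ v u → z :+ κ :* v :+ κ :* u := z :+ κ :* (v :+ u)) refl z κ v u))

    mod-sym : ∀ {x y} → x ≡ y [mod κ ] → y ≡ x [mod κ ]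
    mod-sym {x} {y} (z , p) = - z , sym (begin
      x + κ * - z              ≈⟨ +-congʳ p ⟩
      y + κ * z + κ * - z  ≈⟨ solve 4 (λ y κ z w → y :+ κ :* z :+ κ :* w := y :+ κ :* (z :+ w)) refl y κ z (- z) ⟩
      y + κ * (z - z)  ≈⟨ +-congˡ (*-congˡ (-‿inverseʳ z)) ⟩
      y + κ * 0#  ≈⟨ solve 2 (λ y κ → y :+ κ :* con 0 := y) refl y κ ⟩
      y                        ∎)
      where open import Relation.Binary.Reasoning.Setoid setoid

    mod-* : ∀ {x x′ y y′} → x ≡ x′ [mod κ ] → y ≡ y′ [mod κ ] → x * y ≡ x′ * y′ [mod κ ]
    mod-* {x′ = x′} {y′ = y′} (u , p) (v , q) = u * y′ + x′ * v + κ * u * v , trans (*-cong p q)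
      (solve 5 (λ x y κ u v → (x :+ κ :* u) :* (y :+ κ :* v)
                 := x :* y :+ κ :* (u :* y :+ x :* v :+ κ :* u :* v)) refl x′ y′ κ u v)

    mod-^ : ∀ {x y} k → x ≡ y [mod κ ] → x ^ k ≡ y ^ k [mod κ ]
    mod-^ zero    p = mod-reflexive refl
    mod-^ (suc k) p = mod-* p (mod-^ k p)

  mod-∣ : ∀ {κ μ x y} → x ≡ y [mod κ * μ ] → x ≡ y [mod κ ]
  mod-∣ {κ} {μ} (z , p) = μ * z , trans p (+-congˡ (*-assoc κ μ z))

  mod-∣^ : ∀ {π x y} {i j} → i ℕ.≤ j → x ≡ y [mod π ^ j ] → x ≡ y [mod π ^ i ]
  mod-∣^ {π} {i = i} i≤j p with ℕₚ.m≤n⇒∃[o]m+o≡n i≤j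
  ... | d , ≡.refl = mod-∣ (proj₁ p , trans (proj₂ p) (+-congˡ (*-congʳ (^-homo-* π i d))))

  -- If the additive map F lifts Frobenius so well that F (x ^ pʲ⁺¹) ≡ x ^ pʲ
  -- modulo πʲ⁺¹, and is of finite order, then it is multiplicative modulo
  -- every πʲ: by the case j = 0 every element is a pʲ-th power modulo π, which
  -- improves a congruence modulo πʲ to one modulo πʲ⁺¹.

  module FrobeniusLift
    (p : ℕ) (π : Carrier) (F : Carrier → Carrier)
    (F-cong : ∀ {x y} → x ≈ y → F x ≈ F y)
    (F-+ : ∀ x y → F (x + y) ≈ F x + F y)
    (F-π : ∀ x → F (π * x) ≈ π * F x)
    (F-^ : ∀ x j → F (x ^ (p ℕ.^ suc j)) ≡ x ^ (p ℕ.^ j) [mod π ^ suc j ])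
    (F^ : ℕ → Carrier → Carrier)
    (F^-zero : ∀ x → F^ 0 x ≈ x)
    (F^-suc : ∀ i x → F^ (suc i) x ≈ F (F^ i x))
    (recurs : ∀ j → ∃ λ i → j ℕ.≤ i × (∀ x → F^ (suc i) x ≈ x))
    where

    F-affine : ∀ x y → F (x + π * y) ≈ F x + π * F y
    F-affine x y = trans (F-+ x (π * y)) (+-congˡ (F-π y))

    F-mod : ∀ {x y} → x ≡ y [mod π ] → F x ≡ F y [mod π ]
    F-mod {y = y} (z , p) = F z , trans (F-cong p) (F-affine y z)

    -- Since p⁰ = 1, the case j = 0 of `F-^` says that F undoes the p-th power modulo π; this is
    -- iterated i times.
    F^-power : ∀ i x → F^ i (x ^ (p ℕ.^ i)) ≡ x [mod π ]
    F^-power zero    x = mod-reflexive (trans (F^-zero (x ^ 1)) (*-identityʳ x))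
    F^-power (suc i) x = mod-trans (mod-reflexive (F^-suc i (x ^ (p ℕ.^ suc i))))
      (mod-trans (F-mod (mod-trans
        (mod-reflexive (F^-cong i (sym (^-assocʳ x p (p ℕ.^ i)))))
        (F^-power i (x ^ p))))
      (mod-trans (mod-reflexive (F-cong (^-congʳ x (≡.sym (ℕₚ.*-identityʳ p)))))
        (mod-trans (mod-∣ (F-^ x 0)) (mod-reflexive (*-identityʳ x)))))
      where
      ^-congʳ : ∀ x {j k} → j ≡ k → x ^ j ≈ x ^ k
      ^-congʳ x ≡.refl = refl
      F^-cong : ∀ i {x y} → x ≈ y → F^ i x ≈ F^ i y
      F^-cong zero    eq = trans (F^-zero _) (trans eq (sym (F^-zero _)))
      F^-cong (suc i) eq = trans (F^-suc i _) (trans (F-cong (F^-cong i eq)) (sym (F^-suc i _)))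

    multiplicative : ∀ j x y → F (x * y) ≡ F x * F y [mod π ^ j ]
    multiplicative zero x y =
      F (x * y) - F x * F y , sym (trans (+-congˡ (*-identityˡ _)) (xyx⁻¹ (F x * F y) (F (x * y))))
      where
      xyx⁻¹ : ∀ u v → u + (v - u) ≈ v
      xyx⁻¹ u v = trans (+-comm u (v - u)) (trans (+-assoc v (- u) u) (trans (+-congˡ (-‿inverseˡ u)) (+-identityʳ v)))
    multiplicative (suc j) x y with recurs j
    ... | i , j≤i , F^≈id = reduceˡ
      where
      Q : ℕ
      Q = p ℕ.^ suc i

      -- The (i+1)-st iterate of F is the identity, so `F^-power` becomes a statement about x alone.
      approximate : ∀ x → x ≡ x ^ Q [mod π ]
      approximate x = mod-sym (mod-trans (mod-reflexive (sym (F^≈id (x ^ Q)))) (F^-power (suc i) x))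

      -- Both sides are congruent to (xy) to the power pⁱ modulo πⁱ⁺¹; as i ≥ j, this is sharp
      -- enough for πʲ⁺¹.
      powers : F (x ^ Q * y ^ Q) ≡ F (x ^ Q) * F (y ^ Q) [mod π ^ suc j ]
      powers = mod-∣^ (ℕ.s≤s j≤i) (mod-trans (mod-reflexive (F-cong (sym (^-distrib-* x y Q))))
        (mod-trans (F-^ (x * y) i) (mod-trans (mod-reflexive (^-distrib-* x y (p ℕ.^ i)))
          (mod-sym (mod-* (F-^ x i) (F-^ y i))))))

      -- Adding π x₁ to one factor changes the two sides by π F(x₁ z) and π F(x₁) F(z). These agree
      -- modulo πʲ⁺¹, because the induction hypothesis modulo πʲ gains the factor π.
      reduce : ∀ {x₀} x₁ z → F (x₀ * z) ≡ F x₀ * F z [mod π ^ suc j ] →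
               F ((x₀ + π * x₁) * z) ≡ F (x₀ + π * x₁) * F z [mod π ^ suc j ]
      reduce {x₀} x₁ z (u , eq) with multiplicative j x₁ z
      ... | v , eq′ = u + v , (begin
        F ((x₀ + π * x₁) * z)  ≈⟨ F-cong (solve 4 (λ a b c d → (a :+ b :* c) :* d := a :* d :+ b :* (c :* d)) refl x₀ π x₁ z) ⟩
        F (x₀ * z + π * (x₁ * z))  ≈⟨ F-affine (x₀ * z) (x₁ * z) ⟩
        F (x₀ * z) + π * F (x₁ * z)  ≈⟨ +-cong eq (*-congˡ eq′) ⟩
        F x₀ * F z + π ^ suc j * u + π * (F x₁ * F z + π ^ j * v)
          ≈⟨ solve 7 (λ a b c d e f g → a :* b :+ c :* d :* e :+ c :* (f :* b :+ d :* g) := (a :+ c :* f) :* b :+ c :* d :* (e :+ g)) refl (F x₀) (F z) π (π ^ j) u (F x₁) v ⟩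
        (F x₀ + π * F x₁) * F z + π ^ suc j * (u + v) ≈⟨ +-congʳ (*-congʳ (F-affine x₀ x₁)) ⟨
        F (x₀ + π * x₁) * F z + π ^ suc j * (u + v) ∎)
        where open import Relation.Binary.Reasoning.Setoid setoid

      respects : ∀ {a a′ b b′} → a ≈ a′ → b ≈ b′ → F (a′ * b′) ≡ F a′ * F b′ [mod π ^ suc j ] →
                 F (a * b) ≡ F a * F b [mod π ^ suc j ]
      respects a≈ b≈ (u , eq) = u , trans (F-cong (*-cong a≈ b≈))
        (trans eq (+-congʳ (*-cong (F-cong (sym a≈)) (F-cong (sym b≈)))))

      swap : ∀ {a b} → F (a * b) ≡ F a * F b [mod π ^ suc j ] → F (b * a) ≡ F b * F a [mod π ^ suc j ]
      swap {a} {b} (u , eq) = u , trans (F-cong (*-comm b a)) (trans eq (+-congʳ (*-comm (F a) (F b))))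

      -- Starting from `powers`, the Q-th powers are replaced by the original factors one at a time,
      -- that of y before that of x.
      reduceʳ : F (x ^ Q * y) ≡ F (x ^ Q) * F y [mod π ^ suc j ]
      reduceʳ = swap {y} {x ^ Q} (respects {y} {y ^ Q + π * y₁} {x ^ Q} {x ^ Q} (proj₂ (approximate y)) refl
        (reduce {y ^ Q} y₁ (x ^ Q) (swap {x ^ Q} {y ^ Q} powers)))
        where
        y₁ : Carrier
        y₁ = proj₁ (approximate y)

      reduceˡ : F (x * y) ≡ F x * F y [mod π ^ suc j ]
      reduceˡ = respects {x} {x ^ Q + π * x₁} {y} {y} (proj₂ (approximate x)) refl (reduce {x ^ Q} x₁ y reduceʳ)
        where
        x₁ : Carrier
        x₁ = proj₁ (approximate x)

-- Adams operations on class functions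

module PowerOperations where
  open import Data.Fin.Base using (splitAt)
  open import Data.Integer.Base as ℤ using (ℤ; +_)
  import Data.Integer.Properties as ℤₚ
  open import Data.Integer.Divisibility.Signed as ℤᵈ using () renaming (_∣_ to _∣ℤ_)
  open import Data.Integer.DivMod using (_%ℕ_; _/ℕ_; a≡a%ℕn+[a/ℕn]*n)
  open import Data.Integer.Solver using (module +-*-Solver)
  open import Data.List.Base using ([]; _∷_; _++_)
  open import Data.List.Relation.Unary.All using (All; []; _∷_)
  open import Data.Nat.Base using (NonZero)
  open import Data.Nat.Coprimality using (Coprime)
  open import Data.Nat.Divisibility using (_∣_; divides; ∣⇒≤; ∣-trans; m∣m*n; n∣m*n)
  open import Data.Nat.ListAction using (product)
  open import Data.Nat.Primality using (Prime; prime⇒nonZero; prime⇒nonTrivial)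
  open import Data.Nat.Primality.Factorisation using (factorise; PrimeFactorisation)
  open import Data.Sum.Base using ([_,_]′)
  open import Function.Base using (const)
  open import Relation.Binary.PropositionalEquality
  open Sums ℤₚ.+-*-commutativeRing

  -- An alphabet with b(u) letters labelled u turns a sum with nonnegative integer weights into an
  -- unweighted one, so that powers in the group ring can be computed by counting words.
  letters : ∀ {n} (b : Fin n → ℕ) → ∃ λ m → ∃ λ (π : Fin m → Fin n) →
            ∀ f → sum (f ∘ π) ≡ sum λ u → + b u ℤ.* f u
  letters {zero}  b = 0 , (λ ()) , λ f → refl
  letters {suc n} b with letters (b ∘ suc)
  ... | m , π , eq = b zero ℕ.+ m , π′ , λ f → trans (sum-++ (b zero) (f ∘ π′)) (cong₂ ℤ._+_
        (trans (sum-cong-≗ λ i → cong (f ∘ [ const zero , suc ∘ π ]′) (Finₚ.splitAt-↑ˡ (b zero) i m))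
          (sum-const (b zero) (f zero)))
        (trans (sum-cong-≗ λ i → cong (f ∘ [ const zero , suc ∘ π ]′) (Finₚ.splitAt-↑ʳ (b zero) m i))
          (eq (f ∘ suc))))
    where
    π′ : Fin (b zero ℕ.+ m) → Fin (suc n)
    π′ = [ const zero , suc ∘ π ]′ ∘ splitAt (b zero)

  -- Taking j = |z| suffices, as pʲ > j.
  ∣-powers⇒≡0 : ∀ {p z} → 2 ℕ.≤ p → (∀ j → + (p ℕ.^ j) ∣ℤ z) → z ≡ ℤ.0ℤ
  ∣-powers⇒≡0 {p} {z} 2≤p div = ℤₚ.∣i∣≡0⇒i≡0 (absurd ℤ.∣ z ∣ refl)
    where
    absurd : ∀ k → ℤ.∣ z ∣ ≡ k → k ≡ 0
    absurd zero    _  = refl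
    absurd (suc k) eq = contradiction (∣⇒≤ (subst (p ℕ.^ suc k ∣_) eq (ℤᵈ.∣⇒∣ᵤ (div (suc k)))))
                          (ℕₚ.<⇒≱ (n<m^n 2≤p (suc k)))

  module ClassFunctionPowers {n : ℕ} (G : FinGroup n) where
    open FinGroup G using (_∙_; ε; _⁻¹; conjugate; conjugate-^; HasExponent; power-recurs; ^-*; ^-1; assoc;
        identityˡ; identityʳ; inverseˡ; ^-suc; ^-ε; cancel-⁻¹∙; cancel-∙⁻¹; ⁻¹-anti-homo-∙; inverseʳ-unique)
      renaming (_^_ to infixr 9 _^ᴳ_)
    open Convolution G
    open CommutativeRing classFunctionRing using (_+_; _*_)
    private module R = CommutativeRing classFunctionRing
    open Congruence classFunctionRing

    value : ClassFunction → Fin n → ℤ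
    value = proj₁

    scalar : ℤ → ClassFunction
    scalar k = (λ g → k ℤ.* δ g) , λ g x → cong (k ℤ.*_) (δ-class g x)

    scalar-* : ∀ k a x → value (scalar k * a) x ≡ k ℤ.* value a x
    scalar-* k a = ⋆-scaledˡ k (value a)

    scalar-^ : ∀ p j → scalar (+ p) ^ j ≈ scalar (+ (p ℕ.^ j))
    scalar-^ p zero    x = sym (ℤₚ.*-identityˡ (δ x))
    scalar-^ p (suc j) x = begin
      value (scalar (+ p) * scalar (+ p) ^ j) x  ≡⟨ scalar-* (+ p) (scalar (+ p) ^ j) x ⟩
      + p ℤ.* value (scalar (+ p) ^ j) x  ≡⟨ cong (+ p ℤ.*_) (scalar-^ p j x) ⟩
      + p ℤ.* (+ (p ℕ.^ j) ℤ.* δ x)  ≡⟨ ℤₚ.*-assoc (+ p) (+ (p ℕ.^ j)) (δ x) ⟨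
      + p ℤ.* + (p ℕ.^ j) ℤ.* δ x  ≡⟨ cong (ℤ._* δ x) (ℤₚ.pos-* p (p ℕ.^ j)) ⟨
      + (p ℕ.* p ℕ.^ j) ℤ.* δ x                  ∎
      where open ≡-Reasoning

    ∣⇒mod : ∀ q .{{_ : NonZero q}} a b → (∀ x → + q ∣ℤ value a x ℤ.- value b x) → a ≡ b [mod scalar (+ q) ]
    ∣⇒mod q a b div = (z , z-class) , λ x → begin
        value a x  ≡⟨ solve 2 (λ u v → u := v :+ (u :- v)) refl (value a x) (value b x) ⟩
        value b x ℤ.+ (value a x ℤ.- value b x)  ≡⟨ cong (λ w → value b x ℤ.+ w) (difference x) ⟩
        value b x ℤ.+ + q ℤ.* z x  ≡⟨ cong (λ w → value b x ℤ.+ w) (scalar-* (+ q) (z , z-class) x) ⟨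
        value (b + scalar (+ q) * (z , z-class)) x     ∎
      where
      open ≡-Reasoning
      open +-*-Solver
      z : Fin n → ℤ
      z x = ℤᵈ._∣_.quotient (div x)
      difference : ∀ x → value a x ℤ.- value b x ≡ + q ℤ.* z x
      difference x = trans (ℤᵈ._∣_.equality (div x)) (ℤₚ.*-comm (z x) (+ q))
      -- Congruence refers to the ring of class functions, so the quotient must itself be one. This
      -- holds because the nonzero factor q cancels.
      z-class : IsClass z
      z-class g x = ℤₚ.*-cancelˡ-≡ (+ q) (z (conjugate g x)) (z x) (begin
        + q ℤ.* z (conjugate g x)  ≡⟨ difference (conjugate g x) ⟨
        value a (conjugate g x) ℤ.- value b (conjugate g x)  ≡⟨ cong₂ ℤ._-_ (proj₂ a g x) (proj₂ b g x) ⟩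
        value a x ℤ.- value b x  ≡⟨ difference x ⟩
        + q ℤ.* z x  ∎)

    mod⇒∣ : ∀ q a b → a ≡ b [mod scalar (+ q) ] → ∀ x → + q ∣ℤ value a x ℤ.- value b x
    mod⇒∣ q a b (z , eq) x = ℤᵈ.divides (value z x) (begin
        value a x ℤ.- value b x  ≡⟨ cong (ℤ._- value b x) (eq x) ⟩
        value b x ℤ.+ value (scalar (+ q) * z) x ℤ.- value b x ≡⟨ cong (λ w → value b x ℤ.+ w ℤ.- value b x) (scalar-* (+ q) z x) ⟩
        value b x ℤ.+ + q ℤ.* value z x ℤ.- value b x  ≡⟨ solve 3 (λ u q z → u :+ q :* z :- u := z :* q) refl (value b x) (+ q) (value z x) ⟩
        value z x ℤ.* + q                                ∎)
      where
      open ≡-Reasoning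
      open +-*-Solver

    -- The letters represent the element b of the group ring with b(u) = a(u r),
    -- that is a r⁻¹; since a is central, aᵏ(rᵏ) is the coefficient of bᵏ at ε,
    -- which counts the words of length k with value ε.

    module _ (a : ClassFunction) (r : Fin n) {m : ℕ} (π : Fin m → Fin n)
             (counts : ∀ f → sum (f ∘ π) ≡ sum λ u → value a (u ∙ r) ℤ.* f u) where
      open Words m

      evaluate : Word → Fin n
      evaluate []      = ε
      evaluate (l ∷ w) = π l ∙ evaluate w

      evaluate-++ : ∀ u v → evaluate (u ++ v) ≡ evaluate u ∙ evaluate v
      evaluate-++ []      v = sym (identityˡ (evaluate v))
      evaluate-++ (l ∷ u) v = trans (cong (π l ∙_) (evaluate-++ u v)) (sym (assoc (π l) (evaluate u) (evaluate v)))

      evaluate-repeat : ∀ k u → evaluate (repeat k u) ≡ evaluate u ^ᴳ k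
      evaluate-repeat zero    u = refl
      evaluate-repeat (suc k) u = trans (evaluate-++ u (repeat k u)) (cong (evaluate u ∙_) (evaluate-repeat k u))

      count-words : ∀ k g → sumWords k (λ w → indicator (evaluate w Finₚ.≟ g)) ≡ value (a ^ k) (g ∙ r ^ᴳ k)
      count-words zero    g = indicator-⇔ (ε Finₚ.≟ g) (g ∙ ε Finₚ.≟ ε)
        (λ eq → trans (identityʳ g) (sym eq)) (λ eq → trans (sym eq) (identityʳ g))
      count-words (suc k) g = begin
        (sum λ l → sumWords k λ w → indicator (π l ∙ evaluate w Finₚ.≟ g))
          ≡⟨ sum-cong-≗ (λ l → sumWords-cong k λ w _ → indicator-⇔ (π l ∙ evaluate w Finₚ.≟ g) (evaluate w Finₚ.≟ π l ⁻¹ ∙ g)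
               (λ eq → trans (sym (cancel-⁻¹∙ (π l) (evaluate w))) (cong (π l ⁻¹ ∙_) eq))
               (λ eq → trans (cong (π l ∙_) eq) (cancel-∙⁻¹ (π l) g))) ⟩
        (sum λ l → sumWords k λ w → indicator (evaluate w Finₚ.≟ π l ⁻¹ ∙ g))
          ≡⟨ sum-cong-≗ (λ l → count-words k (π l ⁻¹ ∙ g)) ⟩
        (sum λ l → value (a ^ k) (π l ⁻¹ ∙ g ∙ r ^ᴳ k))
          ≡⟨ counts (λ u → value (a ^ k) (u ⁻¹ ∙ g ∙ r ^ᴳ k)) ⟩
        (sum λ u → value a (u ∙ r) ℤ.* value (a ^ k) (u ⁻¹ ∙ g ∙ r ^ᴳ k))
          ≡⟨ sum-cong-≗ (λ u → cong (value a (u ∙ r) ℤ.*_) (shift u)) ⟨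
        (sum λ u → value a (u ∙ r) ℤ.* value (a ^ k) ((u ∙ r) ⁻¹ ∙ (g ∙ r ^ᴳ suc k)))
          ≡⟨ sum-translateʳ r (λ h → value a h ℤ.* value (a ^ k) (h ⁻¹ ∙ (g ∙ r ^ᴳ suc k))) ⟨
        value (a ^ suc k) (g ∙ r ^ᴳ suc k) ∎
        where
        open ≡-Reasoning
        shift : ∀ u → value (a ^ k) ((u ∙ r) ⁻¹ ∙ (g ∙ r ^ᴳ suc k)) ≡ value (a ^ k) (u ⁻¹ ∙ g ∙ r ^ᴳ k)
        shift u = begin
          value (a ^ k) ((u ∙ r) ⁻¹ ∙ (g ∙ r ^ᴳ suc k))  ≡⟨ cong (value (a ^ k)) (cong₂ (λ v w → v ∙ (g ∙ w)) (⁻¹-anti-homo-∙ u r) (^-suc r k)) ⟩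
          value (a ^ k) (r ⁻¹ ∙ u ⁻¹ ∙ (g ∙ (r ^ᴳ k ∙ r)))  ≡⟨ cong (value (a ^ k)) (begin
            r ⁻¹ ∙ u ⁻¹ ∙ (g ∙ (r ^ᴳ k ∙ r))  ≡⟨ cong (r ⁻¹ ∙ u ⁻¹ ∙_) (assoc g (r ^ᴳ k) r) ⟨
            r ⁻¹ ∙ u ⁻¹ ∙ (g ∙ r ^ᴳ k ∙ r)  ≡⟨ assoc (r ⁻¹ ∙ u ⁻¹) (g ∙ r ^ᴳ k) r ⟨
            r ⁻¹ ∙ u ⁻¹ ∙ (g ∙ r ^ᴳ k) ∙ r  ≡⟨ cong (_∙ r) (assoc (r ⁻¹) (u ⁻¹) (g ∙ r ^ᴳ k)) ⟩
            r ⁻¹ ∙ (u ⁻¹ ∙ (g ∙ r ^ᴳ k)) ∙ r  ≡⟨ cong (λ v → r ⁻¹ ∙ v ∙ r) (assoc (u ⁻¹) g (r ^ᴳ k)) ⟨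
            r ⁻¹ ∙ (u ⁻¹ ∙ g ∙ r ^ᴳ k) ∙ r      ∎) ⟩
          value (a ^ k) (r ⁻¹ ∙ (u ⁻¹ ∙ g ∙ r ^ᴳ k) ∙ r)  ≡⟨ class-comm {value (a ^ k)} (proj₂ (a ^ k)) (r ⁻¹ ∙ (u ⁻¹ ∙ g ∙ r ^ᴳ k)) r ⟩
          value (a ^ k) (r ∙ (r ⁻¹ ∙ (u ⁻¹ ∙ g ∙ r ^ᴳ k)))  ≡⟨ cong (value (a ^ k)) (cancel-∙⁻¹ r (u ⁻¹ ∙ g ∙ r ^ᴳ k)) ⟩
          value (a ^ k) (u ⁻¹ ∙ g ∙ r ^ᴳ k)                     ∎

      -- Having value ε is invariant under rotation, as xy = ε implies yx = ε, so `necklace` applies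
      -- to the words counted. The p-fold repetition of w has value ε exactly when w has, since the
      -- group has no p-torsion.
      necklace-power : ∀ {p} → Prime p → (∀ x → x ^ᴳ p ≡ ε → x ≡ ε) → ∀ j →
        + (p ℕ.^ suc j) ∣ℤ value (a ^ (p ℕ.^ suc j)) (r ^ᴳ (p ℕ.^ suc j)) ℤ.- value (a ^ (p ℕ.^ j)) (r ^ᴳ (p ℕ.^ j))
      necklace-power {p} pp torsionFree j =
        subst (+ (p ℕ.^ suc j) ∣ℤ_) (cong₂ ℤ._-_ (counted (p ℕ.^ suc j)) (trans
            (sumWords-cong (p ℕ.^ j) λ w _ → indicator-⇔ (evaluate (repeat p w) Finₚ.≟ ε) (evaluate w Finₚ.≟ ε)
              (λ eq → torsionFree (evaluate w) (trans (sym (evaluate-repeat p w)) eq))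
              (λ eq → trans (evaluate-repeat p w) (trans (cong (_^ᴳ p) eq) (^-ε p))))
            (counted (p ℕ.^ j))))
          (necklace pp j (λ w → indicator (evaluate w Finₚ.≟ ε)) rotation)
        where
        counted : ∀ k → sumWords k (λ w → indicator (evaluate w Finₚ.≟ ε)) ≡ value (a ^ k) (r ^ᴳ k)
        counted k = trans (count-words k ε) (cong (value (a ^ k)) (identityˡ (r ^ᴳ k)))
        commute : ∀ x y → x ∙ y ≡ ε → y ∙ x ≡ ε
        commute x y eq = trans (cong (_∙ x) (inverseʳ-unique x y eq)) (inverseˡ x)
        rotation : ∀ w → indicator (evaluate (rotate w) Finₚ.≟ ε) ≡ indicator (evaluate w Finₚ.≟ ε)
        rotation []      = refl
        rotation (l ∷ w) = indicator-⇔ (evaluate (w ++ l ∷ []) Finₚ.≟ ε) (π l ∙ evaluate w Finₚ.≟ ε)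
          (λ eq → commute (evaluate w) (π l) (trans (sym last) eq)) (λ eq → trans last (commute (π l) (evaluate w) eq))
          where
          last : evaluate (w ++ l ∷ []) ≡ evaluate w ∙ π l
          last = trans (evaluate-++ w (l ∷ [])) (cong (evaluate w ∙_) (identityʳ (π l)))

    -- Reducing the coefficients of a to their residues modulo pʲ⁺¹ affects its powers only modulo
    -- pʲ⁺¹, and gives coefficients to which `necklace-power` applies.
    power-congruence : ∀ {p} → Prime p → (∀ x → x ^ᴳ p ≡ ε → x ≡ ε) → ∀ a r j →
      + (p ℕ.^ suc j) ∣ℤ value (a ^ (p ℕ.^ suc j)) (r ^ᴳ (p ℕ.^ suc j)) ℤ.- value (a ^ (p ℕ.^ j)) (r ^ᴳ (p ℕ.^ j))
    power-congruence {p} pp torsionFree a r j = subst (+ q ∣ℤ_)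
        (solve 4 (λ s t u v → (s :- u) :+ (u :- v) :- (t :- v) := s :- t) refl
          (at a q) (at a (p ℕ.^ j)) (at a⁺ q) (at a⁺ (p ℕ.^ j)))
        (ℤᵈ.∣m∣n⇒∣m-n (ℤᵈ.∣m∣n⇒∣m+n (reduce q) nonNegative) (reduce (p ℕ.^ j)))
      where
      open +-*-Solver
      q : ℕ
      q = p ℕ.^ suc j
      instance
        q≢0 : NonZero q
        q≢0 = ℕₚ.m^n≢0 p (suc j) {{prime⇒nonZero pp}}
      -- Words can only be counted for nonnegative coefficients.
      a⁺ : ClassFunction
      a⁺ = (λ x → + (value a x %ℕ q)) , λ g x → cong (λ z → + (z %ℕ q)) (proj₂ a g x)
      at : ClassFunction → ℕ → ℤ
      at b k = value (b ^ k) (r ^ᴳ k)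
      a≡a⁺ : a ≡ a⁺ [mod scalar (+ q) ]
      a≡a⁺ = ∣⇒mod q a a⁺ λ x → ℤᵈ.divides (value a x /ℕ q) (trans
        (cong (ℤ._- + (value a x %ℕ q)) (a≡a%ℕn+[a/ℕn]*n (value a x) q))
        (solve 2 (λ u v → u :+ v :- u := v) refl (+ (value a x %ℕ q)) ((value a x /ℕ q) ℤ.* + q)))
      reduce : ∀ k → + q ∣ℤ at a k ℤ.- at a⁺ k
      reduce k = mod⇒∣ q (a ^ k) (a⁺ ^ k) (mod-^ {scalar (+ q)} {a} {a⁺} k a≡a⁺) (r ^ᴳ k)
      labelled = letters (λ u → value a (u ∙ r) %ℕ q)
      nonNegative : + q ∣ℤ at a⁺ q ℤ.- at a⁺ (p ℕ.^ j)
      nonNegative = necklace-power a⁺ r (proj₁ (proj₂ labelled)) (proj₂ (proj₂ labelled)) pp torsionFree j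

    -- The k-th Adams operation.
    ψ : ℕ → ClassFunction → ClassFunction
    ψ k a = (λ x → value a (x ^ᴳ k)) , λ g x → trans (cong (value a) (conjugate-^ g x k)) (proj₂ a g (x ^ᴳ k))

    recursion-iterate : ∀ {m} → (∀ x → x ^ᴳ m ≡ x) → ∀ j x → x ^ᴳ (m ℕ.^ j) ≡ x
    recursion-iterate         eq zero    x = ^-1 x
    recursion-iterate {m = m} eq (suc j) x = begin
      x ^ᴳ (m ℕ.* m ℕ.^ j)   ≡⟨ ^-* x (m ℕ.^ j) m ⟨
      (x ^ᴳ (m ℕ.^ j)) ^ᴳ m  ≡⟨ eq (x ^ᴳ (m ℕ.^ j)) ⟩
      x ^ᴳ (m ℕ.^ j)         ≡⟨ recursion-iterate {m} eq j x ⟩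
      x                      ∎
      where open ≡-Reasoning

    module _ {e : ℕ} .{{_ : NonZero e}} (exp : HasExponent e) where

      module _ {p : ℕ} (pp : Prime p) (coprime : Coprime p e) where
        private
          instance
            p≢0 : NonZero p
            p≢0 = prime⇒nonZero pp
          φ : ℕ
          φ = proj₁ (power-recurs exp coprime)

          -- The exponents multiply to the j-th power of p^(1+φ), and x ↦ x^(p^(1+φ)) is the
          -- identity.
          root : ∀ j x → ∃ λ r → r ^ᴳ (p ℕ.^ j) ≡ x
          root j x = x ^ᴳ (p ℕ.^ (j ℕ.* φ)) , (begin
              (x ^ᴳ (p ℕ.^ (j ℕ.* φ))) ^ᴳ (p ℕ.^ j)  ≡⟨ ^-* x (p ℕ.^ (j ℕ.* φ)) (p ℕ.^ j) ⟩
              x ^ᴳ (p ℕ.^ j ℕ.* p ℕ.^ (j ℕ.* φ))  ≡⟨ cong (x ^ᴳ_) (ℕₚ.^-distribˡ-+-* p j (j ℕ.* φ)) ⟨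
              x ^ᴳ (p ℕ.^ (j ℕ.+ j ℕ.* φ))  ≡⟨ cong (λ k → x ^ᴳ (p ℕ.^ k)) (trans (sym (ℕₚ.*-suc j φ)) (ℕₚ.*-comm j (suc φ))) ⟩
              x ^ᴳ (p ℕ.^ (suc φ ℕ.* j))  ≡⟨ cong (x ^ᴳ_) (ℕₚ.^-*-assoc p (suc φ) j) ⟨
              x ^ᴳ ((p ℕ.^ suc φ) ℕ.^ j)  ≡⟨ recursion-iterate {p ℕ.^ suc φ} (proj₂ (power-recurs exp coprime)) j x ⟩
              x                                      ∎)
            where open ≡-Reasoning

          torsionFree : ∀ x → x ^ᴳ p ≡ ε → x ≡ ε
          torsionFree x eq = begin
            x  ≡⟨ proj₂ (power-recurs exp coprime) x ⟨
            x ^ᴳ (p ℕ.* p ℕ.^ φ)  ≡⟨ cong (x ^ᴳ_) (ℕₚ.*-comm p (p ℕ.^ φ)) ⟩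
            x ^ᴳ (p ℕ.^ φ ℕ.* p)       ≡⟨ ^-* x p (p ℕ.^ φ) ⟨
            (x ^ᴳ p) ^ᴳ (p ℕ.^ φ)  ≡⟨ cong (_^ᴳ (p ℕ.^ φ)) eq ⟩
            ε ^ᴳ (p ℕ.^ φ)             ≡⟨ ^-ε (p ℕ.^ φ) ⟩
            ε                          ∎
            where open ≡-Reasoning

          ψ-scalar-* : ∀ a → ψ p (scalar (+ p) * a) ≈ scalar (+ p) * ψ p a
          ψ-scalar-* a x = trans (scalar-* (+ p) a (x ^ᴳ p)) (sym (scalar-* (+ p) (ψ p a) x))

          rescale : ∀ {a b} j → a ≡ b [mod scalar (+ (p ℕ.^ j)) ] → a ≡ b [mod scalar (+ p) ^ j ]
          rescale {a} {b} j (z , eq) = z , λ x → trans (eq x) (cong (λ w → value b x ℤ.+ w)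
            (R.*-congʳ {z} {scalar (+ (p ℕ.^ j))} {scalar (+ p) ^ j} (λ y → sym (scalar-^ p j y)) x))

          unscale : ∀ {a b} j → a ≡ b [mod scalar (+ p) ^ j ] → a ≡ b [mod scalar (+ (p ℕ.^ j)) ]
          unscale {a} {b} j (z , eq) = z , λ x → trans (eq x) (cong (λ w → value b x ℤ.+ w)
            (R.*-congʳ {z} {scalar (+ p) ^ j} {scalar (+ (p ℕ.^ j))} (scalar-^ p j) x))

          -- Evaluated at a pʲ-th root r of x, `power-congruence` compares values at x^p and x.
          ψ-^ : ∀ a j → ψ p (a ^ (p ℕ.^ suc j)) ≡ a ^ (p ℕ.^ j) [mod scalar (+ p) ^ suc j ]
          ψ-^ a j = rescale {ψ p (a ^ (p ℕ.^ suc j))} {a ^ (p ℕ.^ j)} (suc j)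
            (∣⇒mod (p ℕ.^ suc j) {{ℕₚ.m^n≢0 p (suc j)}} (ψ p (a ^ (p ℕ.^ suc j))) (a ^ (p ℕ.^ j)) λ x →
              subst₂ (λ y z → + (p ℕ.^ suc j) ∣ℤ value (a ^ (p ℕ.^ suc j)) y ℤ.- value (a ^ (p ℕ.^ j)) z)
                (trans (sym (^-* (proj₁ (root j x)) (p ℕ.^ j) p)) (cong (_^ᴳ p) (proj₂ (root j x))))
                (proj₂ (root j x))
                (power-congruence pp torsionFree a (proj₁ (root j x)) j))

          recurs : ∀ j → ∃ λ i → j ℕ.≤ i × (∀ a → ψ (p ℕ.^ suc i) a ≈ a)
          -- Chosen so that its successor is (j + 1)(φ + 1), a multiple of φ + 1 that is large
          -- enough.
          recurs j = φ ℕ.+ j ℕ.* suc φ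
                   , ℕₚ.≤-trans (ℕₚ.m≤m*n j (suc φ)) (ℕₚ.m≤n+m (j ℕ.* suc φ) φ)
                   , λ a x → cong (value a) (trans
                       (cong (x ^ᴳ_) (trans (cong (p ℕ.^_) (ℕₚ.*-comm (suc j) (suc φ))) (sym (ℕₚ.^-*-assoc p (suc φ) (suc j)))))
                       (recursion-iterate {p ℕ.^ suc φ} (proj₂ (power-recurs exp coprime)) (suc j) x))

          module Lift = FrobeniusLift p (scalar (+ p)) (ψ p)
            (λ eq x → eq (x ^ᴳ p)) (λ a b x → refl) ψ-scalar-* ψ-^
            (λ i → ψ (p ℕ.^ i)) (λ a x → cong (value a) (^-1 x))
            (λ i a x → cong (value a) (trans (cong (x ^ᴳ_) (ℕₚ.*-comm p (p ℕ.^ i))) (sym (^-* x p (p ℕ.^ i)))))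
            recurs

        -- The two sides are congruent modulo every power of p, so their integer values coincide.
        ψ-* : ∀ a b → ψ p (a * b) ≈ ψ p a * ψ p b
        ψ-* a b x = ℤₚ.i-j≡0⇒i≡j (value (ψ p (a * b)) x) (value (ψ p a * ψ p b) x)
          (∣-powers⇒≡0 {p} (ℕ.nonTrivial⇒n>1 p {{prime⇒nonTrivial pp}}) λ j →
            mod⇒∣ (p ℕ.^ j) (ψ p (a * b)) (ψ p a * ψ p b)
              (unscale {ψ p (a * b)} {ψ p a * ψ p b} j (Lift.multiplicative j a b)) x)

        ψ-fixed-^ : ∀ {a} → ψ p a ≈ a → ∀ k → ψ p (a ^ k) ≈ a ^ k
        ψ-fixed-^ fixed zero x = indicator-⇔ (x ^ᴳ p Finₚ.≟ ε) (x Finₚ.≟ ε)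
          (torsionFree x) (λ eq → trans (cong (_^ᴳ p) eq) (^-ε p))
        ψ-fixed-^ {a} fixed (suc k) x = trans (ψ-* a (a ^ k) x)
          (R.*-cong {ψ p a} {a} {ψ p (a ^ k)} {a ^ k} fixed (ψ-fixed-^ {a} fixed k) x)

      PowerInvariant : ClassFunction → Set
      PowerInvariant a = ∀ u .{{_ : NonZero u}} → Coprime u e → ∀ x → value a (x ^ᴳ u) ≡ value a x

      prime-power-invariant : ∀ {a} → (∀ {p} → Prime p → Coprime p e → ψ p a ≈ a) → PowerInvariant a
      prime-power-invariant {a} fixed u coprime x = trans (cong (λ k → value a (x ^ᴳ k)) isFactorisation)
          (product-invariant factors factorsPrime (subst (λ k → Coprime k e) isFactorisation coprime) x)
        where
        open PrimeFactorisation (factorise u)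
        product-invariant : ∀ ps → All Prime ps → Coprime (product ps) e → ∀ x → value a (x ^ᴳ product ps) ≡ value a x
        product-invariant []       []         c x = cong (value a) (^-1 x)
        product-invariant (p ∷ ps) (pp ∷ all) c x = begin
          value a (x ^ᴳ (p ℕ.* product ps))  ≡⟨ cong (value a) (^-* x (product ps) p) ⟨
          value a ((x ^ᴳ product ps) ^ᴳ p)  ≡⟨ fixed pp (λ (d∣p , d∣e) → c (∣-trans d∣p (m∣m*n (product ps)) , d∣e)) (x ^ᴳ product ps) ⟩
          value a (x ^ᴳ product ps)  ≡⟨ product-invariant ps all (λ (d∣ps , d∣e) → c (∣-trans d∣ps (n∣m*n p) , d∣e)) x ⟩
          value a x                            ∎
          where open ≡-Reasoning

      power-invariant-^ : ∀ {a} → PowerInvariant a → ∀ k → PowerInvariant (a ^ k)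
      power-invariant-^ {a} inv k = prime-power-invariant {a ^ k} λ pp c →
        ψ-fixed-^ pp c {a} (inv _ {{prime⇒nonZero pp}} c) k

open PowerOperations

-- The length function and its invariance under powers

module WordLengths where
  open import Defs using (Walk; []; _∷_; IsDistanceMatrix)
  open import Data.Integer.Base as ℤ using (ℤ; +_; 0ℤ)
  import Data.Integer.Properties as ℤₚ
  open import Data.Nat.Base using (NonZero)
  open import Data.Nat.Coprimality using (Coprime)
  open import Relation.Binary.Core using (Rel)
  open import Relation.Binary.PropositionalEquality
  open Sums ℤₚ.+-*-commutativeRing

  sum-nonNegative : ∀ {n} (f : Fin n → ℤ) → (∀ i → 0ℤ ℤ.≤ f i) → 0ℤ ℤ.≤ sum f
  sum-nonNegative {zero}  f f≥0 = ℤₚ.≤-refl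
  sum-nonNegative {suc n} f f≥0 = ℤₚ.+-mono-≤ (f≥0 zero) (sum-nonNegative (f ∘ suc) (f≥0 ∘ suc))

  sum-positive : ∀ {n} (f : Fin n → ℤ) → (∀ i → 0ℤ ℤ.≤ f i) → ∀ i → 0ℤ ℤ.< f i → 0ℤ ℤ.< sum f
  sum-positive f f≥0 zero    f₀>0 = ℤₚ.+-mono-<-≤ f₀>0 (sum-nonNegative (f ∘ suc) (f≥0 ∘ suc))
  sum-positive f f≥0 (suc i) fᵢ>0 = ℤₚ.+-mono-≤-< (f≥0 zero) (sum-positive (f ∘ suc) (f≥0 ∘ suc) i fᵢ>0)

  positive-summand : ∀ {n} (f : Fin n → ℤ) → 0ℤ ℤ.< sum f → ∃ λ i → 0ℤ ℤ.< f i
  positive-summand {zero}  f (ℤ.+<+ ())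
  positive-summand {suc n} f Σ>0 with 0ℤ ℤₚ.<? f zero
  ... | yes f₀>0 = zero , f₀>0
  ... | no  f₀≯0 with positive-summand (f ∘ suc) (ℤₚ.<-≤-trans Σ>0 (ℤₚ.≤-trans
                        (ℤₚ.+-monoˡ-≤ (sum (f ∘ suc)) (ℤₚ.≮⇒≥ f₀≯0)) (ℤₚ.≤-reflexive (ℤₚ.+-identityˡ (sum (f ∘ suc))))))
  ...   | i , fᵢ>0 = suc i , fᵢ>0

  walk-map : ∀ {a r} {A : Set a} {R : Rel A r} (f : A → A) → (∀ {x y} → R x y → R (f x) (f y)) →
             ∀ {k x y} → Walk R k x y → Walk R k (f x) (f y)
  walk-map f hom []      = []
  walk-map f hom (r ∷ w) = hom r ∷ walk-map f hom w

  walk-++ : ∀ {a r} {A : Set a} {R : Rel A r} {j k x y z} → Walk R j x y → Walk R k y z → Walk R (j ℕ.+ k) x z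
  walk-++ []      v = v
  walk-++ (r ∷ w) v = r ∷ walk-++ w v

  distance-invariant : ∀ {r m} {Adj : Rel (Fin m) r} {D} → IsDistanceMatrix Adj D → (σ τ : Fin m → Fin m) →
                       (∀ i → τ (σ i) ≡ i) → (∀ {i j} → Adj i j → Adj (σ i) (σ j)) →
                       (∀ {i j} → Adj i j → Adj (τ i) (τ j)) → ∀ i j → D (σ i) (σ j) ≡ D i j
  distance-invariant {Adj = Adj} {D} isD σ τ τσ homσ homτ i j = ℕₚ.≤-antisym
    (proj₂ (isD (σ i) (σ j)) (D i j) (walk-map σ homσ (proj₁ (isD i j))))
    (proj₂ (isD i j) (D (σ i) (σ j)) (subst₂ (Walk Adj (D (σ i) (σ j))) (τσ i) (τσ j)
      (walk-map τ homτ (proj₁ (isD (σ i) (σ j))))))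

  module WordLength {n : ℕ} (G : FinGroup n) {e : ℕ} .{{_ : NonZero e}} (exp : FinGroup.HasExponent G e)
    {r : Level} {Adj : Rel (Fin n) r} {D : Fin n → Fin n → ℕ} (isD : IsDistanceMatrix Adj D)
    (left-invariant : ∀ x {i j} → Adj i j → Adj (FinGroup._∙_ G x i) (FinGroup._∙_ G x j))
    (right-invariant : ∀ x {i j} → Adj i j → Adj (FinGroup._∙_ G i x) (FinGroup._∙_ G j x))
    (power-closed : ∀ u .{{_ : NonZero u}} → Coprime u e → ∀ {x} →
                    Adj (FinGroup.ε G) x → Adj (FinGroup.ε G) (FinGroup._^_ G x u))
    where

    open FinGroup G using (_∙_; ε; _⁻¹; conjugate; conjugate-ε; power-recurs; ^-*; ^-ε; inverseˡ;
        cancel-⁻¹∙; cancelʳ-∙⁻¹)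
      renaming (_^_ to infixr 9 _^ᴳ_)
    open Convolution G
    open Congruence classFunctionRing
    open ClassFunctionPowers G using (value; PowerInvariant; power-invariant-^)

    D-left : ∀ x i j → D (x ∙ i) (x ∙ j) ≡ D i j
    D-left x = distance-invariant isD (x ∙_) (x ⁻¹ ∙_) (cancel-⁻¹∙ x) (left-invariant x) (left-invariant (x ⁻¹))

    D-right : ∀ x i j → D (i ∙ x) (j ∙ x) ≡ D i j
    D-right x = distance-invariant isD (_∙ x) (_∙ x ⁻¹) (cancelʳ-∙⁻¹ x) (right-invariant x) (right-invariant (x ⁻¹))

    ℓ : Fin n → ℕ
    ℓ = D ε

    ℓ-conjugate : ∀ g x → ℓ (conjugate g x) ≡ ℓ x
    ℓ-conjugate g x = begin
      D ε (conjugate g x)  ≡⟨ cong (λ y → D y (conjugate g x)) (conjugate-ε g) ⟨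
      D (conjugate g ε) (conjugate g x) ≡⟨ D-right (g ⁻¹) (g ∙ ε) (g ∙ x) ⟩
      D (g ∙ ε) (g ∙ x)                 ≡⟨ D-left g ε x ⟩
      D ε x                             ∎
      where open ≡-Reasoning

    ℓ-quotient : ∀ y x → ℓ (y ⁻¹ ∙ x) ≡ D y x
    ℓ-quotient y x = trans (cong (λ z → D z (y ⁻¹ ∙ x)) (sym (inverseˡ y))) (D-left (y ⁻¹) y x)

    ℓ-ε : ℓ ε ≡ 0
    ℓ-ε = ℕₚ.n≤0⇒n≡0 (proj₂ (isD ε ε) 0 [])

    -- As the ball contains ε, the support of its k-th power is the ball of radius k.

    ball : ClassFunction
    ball = (λ x → indicator (ℓ x ℕₚ.≤? 1))
         , λ g x → cong (λ k → indicator (k ℕₚ.≤? 1)) (ℓ-conjugate g x)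

    short-power : ∀ u .{{_ : NonZero u}} → Coprime u e → ∀ {x} → ℓ x ℕ.≤ 1 → ℓ (x ^ᴳ u) ℕ.≤ 1
    short-power u c {x} ℓx≤1 with ℓ x | ℓx≤1 | proj₁ (isD ε x)
    ... | 0 | _         | []       = ℕₚ.≤-trans (ℕₚ.≤-reflexive (trans (cong ℓ (^-ε u)) ℓ-ε)) ℕ.z≤n
    ... | 1 | ℕ.s≤s ℕ.z≤n | adj ∷ [] = proj₂ (isD ε (x ^ᴳ u)) 1 (power-closed u c adj ∷ [])

    ball-power-invariant : PowerInvariant exp ball
    ball-power-invariant u c x = indicator-⇔ (ℓ (x ^ᴳ u) ℕₚ.≤? 1) (ℓ x ℕₚ.≤? 1) back (short-power u c)
      where
      φ : ℕ
      φ = proj₁ (power-recurs exp c)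
      -- The inverse of x ↦ x^u is raising to the power u^φ, whose exponent is also prime to e, so
      -- `short-power` applies to it too.
      back : ℓ (x ^ᴳ u) ℕ.≤ 1 → ℓ x ℕ.≤ 1
      back le = subst (λ y → ℓ y ℕ.≤ 1)
        (trans (^-* x u (u ℕ.^ φ)) (trans (cong (x ^ᴳ_) (ℕₚ.*-comm (u ℕ.^ φ) u)) (proj₂ (power-recurs exp c) x)))
        (short-power (u ℕ.^ φ) {{ℕₚ.m^n≢0 u φ}} (coprime-^ φ c) le)

    private
      nonNegative-indicator : ∀ {p} {P : Set p} (d : Dec P) {z} → 0ℤ ℤ.≤ z → 0ℤ ℤ.≤ indicator d ℤ.* z
      nonNegative-indicator (yes _) z≥0 = subst (0ℤ ℤ.≤_) (sym (ℤₚ.*-identityˡ _)) z≥0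
      nonNegative-indicator (no _) {z} z≥0 = ℤₚ.≤-reflexive (sym (ℤₚ.*-zeroˡ z))

      positive-indicator : ∀ {p} {P : Set p} (d : Dec P) {z} → 0ℤ ℤ.< indicator d ℤ.* z → P × 0ℤ ℤ.< z
      positive-indicator (yes p) {z} >0 = p , subst (0ℤ ℤ.<_) (ℤₚ.*-identityˡ z) >0
      positive-indicator (no _)  {z} >0 = contradiction (subst (0ℤ ℤ.<_) (ℤₚ.*-zeroˡ z) >0) (ℤₚ.<-irrefl refl)

      indicator-positive : ∀ {p} {P : Set p} (d : Dec P) {z} → P → 0ℤ ℤ.< z → 0ℤ ℤ.< indicator d ℤ.* z
      indicator-positive d {z} p z>0 = subst (0ℤ ℤ.<_)
        (sym (trans (cong (ℤ._* z) (indicator-yes d p)) (ℤₚ.*-identityˡ z))) z>0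

    ball-^-nonNegative : ∀ k x → 0ℤ ℤ.≤ value (ball ^ k) x
    ball-^-nonNegative zero x with x Finₚ.≟ ε
    ... | yes _ = ℤ.+≤+ ℕ.z≤n
    ... | no _  = ℤ.+≤+ ℕ.z≤n
    ball-^-nonNegative (suc k) x = sum-nonNegative (λ h → value ball h ℤ.* value (ball ^ k) (h ⁻¹ ∙ x))
      λ h → nonNegative-indicator (ℓ h ℕₚ.≤? 1) (ball-^-nonNegative k (h ⁻¹ ∙ x))

    ball-^-positive⇒ : ∀ k x → 0ℤ ℤ.< value (ball ^ k) x → ℓ x ℕ.≤ k
    ball-^-positive⇒ zero x >0 with x Finₚ.≟ ε
    ... | yes refl = ℕₚ.≤-reflexive ℓ-ε
    ... | no _     = contradiction >0 (ℤₚ.<-irrefl refl)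
    ball-^-positive⇒ (suc k) x >0 with positive-summand (λ h → value ball h ℤ.* value (ball ^ k) (h ⁻¹ ∙ x)) >0
    ... | h , summand>0 with positive-indicator (ℓ h ℕₚ.≤? 1) summand>0
    ...   | ℓh≤1 , rest>0 = ℕₚ.≤-trans
            (proj₂ (isD ε x) (ℓ h ℕ.+ D h x) (walk-++ (proj₁ (isD ε h)) (proj₁ (isD h x))))
            (ℕₚ.+-mono-≤ ℓh≤1 (subst (ℕ._≤ k) (ℓ-quotient h x) (ball-^-positive⇒ k (h ⁻¹ ∙ x) rest>0)))

    ⇒ball-^-positive : ∀ k x → ℓ x ℕ.≤ k → 0ℤ ℤ.< value (ball ^ k) x
    ⇒ball-^-positive zero x ℓx≤0 with ℓ x | ℓx≤0 | proj₁ (isD ε x)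
    ... | 0 | _ | [] = subst (0ℤ ℤ.<_) (sym (indicator-yes (ε Finₚ.≟ ε) refl)) (ℤ.+<+ (ℕ.s≤s ℕ.z≤n))
    ⇒ball-^-positive (suc k) x ℓx≤ = via (first-step (ℓ x) ℓx≤ (proj₁ (isD ε x)))
      where
      first-step : ∀ l → l ℕ.≤ suc k → Walk Adj l ε x → ∃ λ h → ℓ h ℕ.≤ 1 × D h x ℕ.≤ k
      first-step _       _           []            = ε , ℕₚ.≤-trans (ℕₚ.≤-reflexive ℓ-ε) ℕ.z≤n
                                                       , ℕₚ.≤-trans (ℕₚ.≤-reflexive ℓ-ε) ℕ.z≤n
      first-step (suc l) (ℕ.s≤s l≤k) (_∷_ {y = h} adj w) = h , proj₂ (isD ε h) 1 (adj ∷ [])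
                                                       , ℕₚ.≤-trans (proj₂ (isD h x) l w) l≤k
      via : (∃ λ h → ℓ h ℕ.≤ 1 × D h x ℕ.≤ k) → 0ℤ ℤ.< value (ball ^ suc k) x
      via (h , ℓh≤1 , Dhx≤k) = sum-positive (λ h → value ball h ℤ.* value (ball ^ k) (h ⁻¹ ∙ x))
        (λ h → nonNegative-indicator (ℓ h ℕₚ.≤? 1) (ball-^-nonNegative k (h ⁻¹ ∙ x))) h
        (indicator-positive (ℓ h ℕₚ.≤? 1) ℓh≤1
          (⇒ball-^-positive k (h ⁻¹ ∙ x) (subst (ℕ._≤ k) (sym (ℓ-quotient h x)) Dhx≤k)))

    -- The length of x is the least k for which `ball ^ k` is positive at x, and every power of
    -- `ball` takes equal values at x and x^u.
    ℓ-power : ∀ u .{{_ : NonZero u}} → Coprime u e → ∀ x → ℓ (x ^ᴳ u) ≡ ℓ x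
    ℓ-power u c x = ℕₚ.≤-antisym
      (ball-^-positive⇒ (ℓ x) (x ^ᴳ u) (subst (0ℤ ℤ.<_) (sym (invariant (ℓ x))) (⇒ball-^-positive (ℓ x) x ℕₚ.≤-refl)))
      (ball-^-positive⇒ (ℓ (x ^ᴳ u)) x (subst (0ℤ ℤ.<_) (invariant (ℓ (x ^ᴳ u)))
        (⇒ball-^-positive (ℓ (x ^ᴳ u)) (x ^ᴳ u) ℕₚ.≤-refl)))
      where
      invariant : ∀ k → value (ball ^ k) (x ^ᴳ u) ≡ value (ball ^ k) x
      invariant k = power-invariant-^ exp {ball} ball-power-invariant k u c x

    lengthFunction : ClassFunction
    lengthFunction = (λ x → + ℓ x) , λ g x → cong +_ (ℓ-conjugate g x)

    length-^-power-invariant : ∀ k → PowerInvariant exp (lengthFunction ^ k)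
    length-^-power-invariant = power-invariant-^ exp {lengthFunction} λ u c x → cong +_ (ℓ-power u c x)

open WordLengths

-- Rank factorisations, traces and kernels

module Matrices {c ℓ : Level} (K : CommutativeRing c ℓ) where
  import Algebra.Properties.Ring as RingProperties
  open import Data.Empty using (⊥; ⊥-elim)
  open import Relation.Binary.PropositionalEquality as ≡ using (_≡_)

  open CommutativeRing K hiding (zero)
  open RingProperties ring using (-‿distribʳ-*; -0#≈0#)
  open Sums K
  open import Relation.Binary.Reasoning.Setoid setoid

  Vector : ℕ → Set c
  Vector n = Fin n → Carrier

  Matrix : ℕ → ℕ → Set c
  Matrix m n = Fin m → Vector n

  infix 4 _≈ᴹ_
  _≈ᴹ_ : ∀ {m n} → Matrix m n → Matrix m n → Set ℓ
  A ≈ᴹ B = ∀ i j → A i j ≈ B i j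

  infix 7 _∙_
  _∙_ : ∀ {n} → Vector n → Vector n → Carrier
  u ∙ v = sum λ i → u i * v i

  infixl 8 _·_
  _·_ : ∀ {m k n} → Matrix m k → Matrix k n → Matrix m n
  (A · B) i j = A i ∙ λ k → B k j

  1ᴹ : ∀ {n} → Matrix n n
  1ᴹ i j = indicator (i Finₚ.≟ j)

  trace : ∀ {n} → Matrix n n → Carrier
  trace A = sum λ i → A i i

  ∙-cong : ∀ {n} {u u′ v v′ : Vector n} → (∀ i → u i ≈ u′ i) → (∀ i → v i ≈ v′ i) → u ∙ v ≈ u′ ∙ v′
  ∙-cong p q = sum-cong-≋ λ i → *-cong (p i) (q i)

  ∙-+ : ∀ {n} (u v w : Vector n) → u ∙ (λ i → v i + w i) ≈ u ∙ v + u ∙ w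
  ∙-+ u v w = trans (sum-cong-≋ λ i → distribˡ (u i) (v i) (w i)) (∑-distrib-+ (λ i → u i * v i) (λ i → u i * w i))

  ∙-neg : ∀ {n} (u v : Vector n) → u ∙ (λ i → - v i) ≈ - (u ∙ v)
  ∙-neg {zero}  u v = sym -0#≈0#
  ∙-neg {suc n} u v = begin
    u zero * - v zero + (u ∘ suc) ∙ (λ i → - v (suc i)) ≈⟨ +-cong (sym (-‿distribʳ-* (u zero) (v zero))) (∙-neg (u ∘ suc) (v ∘ suc)) ⟩
    - (u zero * v zero) - (u ∘ suc) ∙ (v ∘ suc)  ≈⟨ ⁻¹-∙-comm (u zero * v zero) ((u ∘ suc) ∙ (v ∘ suc)) ⟩
    - (u ∙ v)                                           ∎
    where open import Algebra.Properties.AbelianGroup +-abelianGroup using (⁻¹-∙-comm)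

  ∙-sub : ∀ {n} (u v w : Vector n) → u ∙ (λ i → v i - w i) ≈ u ∙ v - u ∙ w
  ∙-sub u v w = trans (∙-+ u v (λ i → - w i)) (+-congˡ (∙-neg u w))

  ∙-comm : ∀ {n} (u v : Vector n) → u ∙ v ≈ v ∙ u
  ∙-comm u v = sum-cong-≋ λ i → *-comm (u i) (v i)

  ∙-zeroʳ : ∀ {n} (u : Vector n) {v : Vector n} → (∀ i → v i ≈ 0#) → u ∙ v ≈ 0#
  ∙-zeroʳ u v≈0 = sum-zero λ i → trans (*-congˡ (v≈0 i)) (zeroʳ (u i))

  ∙-zeroˡ : ∀ {n} {u : Vector n} (v : Vector n) → (∀ i → u i ≈ 0#) → u ∙ v ≈ 0#
  ∙-zeroˡ v u≈0 = sum-zero λ i → trans (*-congʳ (u≈0 i)) (zeroˡ (v i))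

  *-∙ : ∀ {n} k (u v : Vector n) → k * (u ∙ v) ≈ (λ i → k * u i) ∙ v
  *-∙ k u v = trans (*-distribˡ-sum k (λ i → u i * v i)) (sum-cong-≋ λ i → sym (*-assoc k (u i) (v i)))

  ∙-assoc : ∀ {m n} (u : Vector m) (A : Matrix m n) (v : Vector n) →
            u ∙ (λ i → A i ∙ v) ≈ (λ j → u ∙ λ i → A i j) ∙ v
  ∙-assoc u A v = begin
    (sum λ i → u i * sum λ j → A i j * v j)  ≈⟨ sum-cong-≋ (λ i → *-distribˡ-sum (u i) (λ j → A i j * v j)) ⟩
    (sum λ i → sum λ j → u i * (A i j * v j))  ≈⟨ ∑-comm (λ i j → u i * (A i j * v j)) ⟩
    (sum λ j → sum λ i → u i * (A i j * v j))  ≈⟨ sum-cong-≋ (λ j → sum-cong-≋ λ i → *-assoc (u i) (A i j) (v j)) ⟨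
    (sum λ j → sum λ i → u i * A i j * v j)  ≈⟨ sum-cong-≋ (λ j → *-distribʳ-sum (v j) (λ i → u i * A i j)) ⟨
    (sum λ j → (sum λ i → u i * A i j) * v j)  ∎

  1ᴹ-∙ : ∀ {n} (i : Fin n) (v : Vector n) → 1ᴹ i ∙ v ≈ v i
  1ᴹ-∙ i v = trans
    (sum-single i (λ j → 1ᴹ i j * v j) λ j j≢i → trans
      (*-congʳ (reflexive (indicator-no (i Finₚ.≟ j) (j≢i ∘ ≡.sym)))) (zeroˡ (v j)))
    (trans (*-congʳ (reflexive (indicator-yes (i Finₚ.≟ i) ≡.refl))) (*-identityˡ (v i)))

  ∙-1ᴹ : ∀ {n} (u : Vector n) (j : Fin n) → u ∙ (λ i → 1ᴹ i j) ≈ u j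
  ∙-1ᴹ u j = trans
    (sum-single j (λ i → u i * 1ᴹ i j) λ i i≢j → trans
      (*-congˡ (reflexive (indicator-no (i Finₚ.≟ j) i≢j))) (zeroʳ (u i)))
    (trans (*-congˡ (reflexive (indicator-yes (j Finₚ.≟ j) ≡.refl))) (*-identityʳ (u j)))

  1ᴹ-suc : ∀ {n} (i j : Fin n) → 1ᴹ (suc i) (suc j) ≈ 1ᴹ i j
  1ᴹ-suc i j = reflexive (indicator-⇔ (suc i Finₚ.≟ suc j) (i Finₚ.≟ j) Finₚ.suc-injective (≡.cong suc))

  trace-comm : ∀ {m n} (A : Matrix m n) (B : Matrix n m) → trace (A · B) ≈ trace (B · A)
  trace-comm A B = trans (∑-comm λ i k → A i k * B k i) (sum-cong-≋ λ k → sum-cong-≋ λ i → *-comm (A i k) (B k i))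

  -- The full-rank factorisation A = BC, with one-sided inverses as data in place of linear
  -- independence: traces and kernels are then computed by cancelling B on the left and C on the
  -- right.
  record RankFactorisation {m n : ℕ} (A : Matrix m n) : Set (c Level.⊔ ℓ) where
    field
      rank       : ℕ
      B          : Matrix m rank
      C          : Matrix rank n
      B⁻         : Matrix rank m
      C⁻         : Matrix n rank
      factorises : A ≈ᴹ B · C
      B⁻B        : B⁻ · B ≈ᴹ 1ᴹ
      CC⁻        : C · C⁻ ≈ᴹ 1ᴹ

  module AddColumn {m n : ℕ} (A : Matrix m (suc n)) (F : RankFactorisation (λ i j → A i (suc j))) where
    open RankFactorisation F

    column coefficients residue : Vector _
    column i = A i zero
    coefficients k = B⁻ k ∙ column
    -- The part of the new column left after applying the projection B B⁻ onto the span of the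
    -- columns of B; it decides whether the rank grows.
    residue i = column i - B i ∙ coefficients

    B⁻-residue : ∀ k → B⁻ k ∙ residue ≈ 0#
    B⁻-residue k = begin
      B⁻ k ∙ residue  ≈⟨ ∙-sub (B⁻ k) column (λ i → B i ∙ coefficients) ⟩
      coefficients k - B⁻ k ∙ (λ i → B i ∙ coefficients) ≈⟨ +-congˡ (-‿cong (∙-assoc (B⁻ k) B coefficients)) ⟩
      coefficients k - (B⁻ · B) k ∙ coefficients  ≈⟨ +-congˡ (-‿cong (∙-cong (B⁻B k) (λ _ → refl))) ⟩
      coefficients k - 1ᴹ k ∙ coefficients  ≈⟨ +-congˡ (-‿cong (1ᴹ-∙ k coefficients)) ⟩
      coefficients k - coefficients k  ≈⟨ -‿inverseʳ (coefficients k) ⟩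
      0#                                              ∎

    column-decomposition : ∀ i → residue i + B i ∙ coefficients ≈ column i
    column-decomposition i = trans (+-assoc (column i) (- (B i ∙ coefficients)) (B i ∙ coefficients))
      (trans (+-congˡ (-‿inverseˡ (B i ∙ coefficients))) (+-identityʳ (column i)))

    dependent : (∀ i → residue i ≈ 0#) → RankFactorisation A
    dependent residue≈0 = record
      { rank = rank ; B = B ; B⁻ = B⁻
      ; C = λ { k zero → coefficients k ; k (suc j) → C k j }
      ; C⁻ = λ { zero k → 0# ; (suc j) k → C⁻ j k }
      ; factorises = λ { i zero → trans (sym (column-decomposition i)) (trans (+-congʳ (residue≈0 i)) (+-identityˡ _))
                       ; i (suc j) → factorises i j }
      ; B⁻B = B⁻B
      ; CC⁻ = λ k l → trans (+-cong (zeroʳ (coefficients k)) (CC⁻ k l)) (+-identityˡ (1ᴹ k l))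
      }

    module _ (p : Fin m) (y : Carrier) (pivot : y * residue p ≈ 1#) where
      private
        B⁺ : Matrix m (suc rank)
        B⁺ i zero    = residue i
        B⁺ i (suc k) = B i k
        C⁺ : Matrix (suc rank) (suc n)
        C⁺ zero    zero    = 1#
        C⁺ zero    (suc j) = 0#
        C⁺ (suc k) zero    = coefficients k
        C⁺ (suc k) (suc j) = C k j
        row : Vector m
        -- Row p of 1 - B B⁻: it annihilates the columns of B and takes `residue` to its entry at p,
        -- which y inverts.
        row i = 1ᴹ p i - B p ∙ λ k → B⁻ k i
        B⁺⁻ : Matrix (suc rank) m
        B⁺⁻ zero    i = y * row i
        B⁺⁻ (suc k) i = B⁻ k i
        C⁺⁻ : Matrix (suc n) (suc rank)
        C⁺⁻ zero    zero    = 1#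
        C⁺⁻ zero    (suc k) = 0#
        -- Compensates for the entries `coefficients` that `C⁺` has in its first column.
        C⁺⁻ (suc j) zero    = - (C⁻ j ∙ coefficients)
        C⁺⁻ (suc j) (suc k) = C⁻ j k

        factorises⁺ : A ≈ᴹ B⁺ · C⁺
        factorises⁺ i zero    = trans (sym (column-decomposition i)) (+-congʳ (sym (*-identityʳ (residue i))))
        factorises⁺ i (suc j) = trans (factorises i j) (sym (trans (+-congʳ (zeroʳ (residue i))) (+-identityˡ _)))

        row-∙ : ∀ v → row ∙ v ≈ v p - B p ∙ λ k → B⁻ k ∙ v
        row-∙ v = begin
          row ∙ v  ≈⟨ ∙-comm row v ⟩
          v ∙ row  ≈⟨ ∙-sub v (1ᴹ p) (λ i → B p ∙ λ k → B⁻ k i) ⟩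
          v ∙ 1ᴹ p - v ∙ (λ i → B p ∙ λ k → B⁻ k i)  ≈⟨ +-cong (trans (∙-comm v (1ᴹ p)) (1ᴹ-∙ p v))
                                                          (-‿cong (trans (∙-comm v (λ i → B p ∙ λ k → B⁻ k i)) (sym (∙-assoc (B p) B⁻ v)))) ⟩
          v p - B p ∙ (λ k → B⁻ k ∙ v)               ∎

        x-0≈x : ∀ {x z} → z ≈ 0# → x - z ≈ x
        x-0≈x {x} z≈0 = trans (+-congˡ (trans (-‿cong z≈0) -0#≈0#)) (+-identityʳ x)

        B⁻B⁺ : B⁺⁻ · B⁺ ≈ᴹ 1ᴹ
        B⁻B⁺ zero zero = begin
          (λ i → y * row i) ∙ residue  ≈⟨ *-∙ y row residue ⟨
          y * (row ∙ residue)  ≈⟨ *-congˡ (trans (row-∙ residue) (x-0≈x (∙-zeroʳ (B p) B⁻-residue))) ⟩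
          y * residue p                ≈⟨ pivot ⟩
          1#                           ∎
        B⁻B⁺ zero (suc l) = begin
          (λ i → y * row i) ∙ (λ i → B i l)  ≈⟨ *-∙ y row (λ i → B i l) ⟨
          y * (row ∙ λ i → B i l)  ≈⟨ *-congˡ (row-∙ (λ i → B i l)) ⟩
          y * (B p l - B p ∙ λ k → (B⁻ · B) k l) ≈⟨ *-congˡ (+-congˡ (-‿cong (∙-cong {u = B p} (λ _ → refl) (λ k → B⁻B k l)))) ⟩
          y * (B p l - B p ∙ λ k → 1ᴹ k l)  ≈⟨ *-congˡ (+-congˡ (-‿cong (∙-1ᴹ (B p) l))) ⟩
          y * (B p l - B p l)  ≈⟨ *-congˡ (-‿inverseʳ (B p l)) ⟩
          y * 0#                             ≈⟨ zeroʳ y ⟩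
          0#                                 ∎
        B⁻B⁺ (suc k) zero    = B⁻-residue k
        B⁻B⁺ (suc k) (suc l) = trans (B⁻B k l) (sym (1ᴹ-suc k l))

        CC⁻⁺ : C⁺ · C⁺⁻ ≈ᴹ 1ᴹ
        CC⁻⁺ zero zero = trans (+-cong (*-identityˡ 1#) (∙-zeroˡ {u = λ _ → 0#} (λ j → - (C⁻ j ∙ coefficients)) (λ _ → refl))) (+-identityʳ 1#)
        CC⁻⁺ zero (suc l) = trans (+-cong (zeroʳ 1#) (∙-zeroˡ {u = λ _ → 0#} (λ j → C⁻ j l) (λ _ → refl))) (+-identityʳ 0#)
        CC⁻⁺ (suc k) zero = begin
          coefficients k * 1# + C k ∙ (λ j → - (C⁻ j ∙ coefficients))  ≈⟨ +-cong (*-identityʳ _) (∙-neg (C k) (λ j → C⁻ j ∙ coefficients)) ⟩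
          coefficients k - C k ∙ (λ j → C⁻ j ∙ coefficients)  ≈⟨ +-congˡ (-‿cong (∙-assoc (C k) C⁻ coefficients)) ⟩
          coefficients k - (C · C⁻) k ∙ coefficients  ≈⟨ +-congˡ (-‿cong (∙-cong (CC⁻ k) (λ _ → refl))) ⟩
          coefficients k - 1ᴹ k ∙ coefficients  ≈⟨ +-congˡ (-‿cong (1ᴹ-∙ k coefficients)) ⟩
          coefficients k - coefficients k  ≈⟨ -‿inverseʳ _ ⟩
          0#  ∎
        CC⁻⁺ (suc k) (suc l) = trans (+-cong (zeroʳ (coefficients k)) (CC⁻ k l))
          (trans (+-identityˡ (1ᴹ k l)) (sym (1ᴹ-suc k l)))

      independent : RankFactorisation A
      independent = record
        { rank = suc rank ; B = B⁺ ; C = C⁺ ; B⁻ = B⁺⁻ ; C⁻ = C⁺⁻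
        ; factorises = factorises⁺ ; B⁻B = B⁻B⁺ ; CC⁻ = CC⁻⁺ }

  module _ (invertible : ∀ x → ¬ ¬ (x ≈ 0# ⊎ ∃ λ y → y * x ≈ 1#)) where

    zero-or-pivot : ∀ {n} (v : Vector n) → ¬ ¬ ((∀ i → v i ≈ 0#) ⊎ ∃ λ i → ∃ λ y → y * v i ≈ 1#)
    zero-or-pivot {zero}  v k = k (inj₁ λ ())
    zero-or-pivot {suc n} v k = invertible (v zero) λ where
      (inj₂ (y , eq)) → k (inj₂ (zero , y , eq))
      (inj₁ v₀≈0) → zero-or-pivot (v ∘ suc) λ where
        (inj₂ (i , y , eq)) → k (inj₂ (suc i , y , eq))
        (inj₁ v≈0) → k (inj₁ λ { zero → v₀≈0 ; (suc i) → v≈0 i })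

    -- Elimination column by column. The only choice is whether the residue of a new column vanishes
    -- or has an invertible entry, and this is where the double negation enters.
    rankFactorisation : ∀ {m n} (A : Matrix m n) → ¬ ¬ RankFactorisation A
    rankFactorisation {n = zero} A k = k (record
      { rank = 0 ; B = λ _ () ; C = λ () ; B⁻ = λ () ; C⁻ = λ () ; factorises = λ _ () ; B⁻B = λ () ; CC⁻ = λ () })
    rankFactorisation {n = suc n} A k = rankFactorisation (λ i j → A i (suc j)) λ F →
      zero-or-pivot (AddColumn.residue A F) λ where
        (inj₁ residue≈0)       → k (AddColumn.dependent A F residue≈0)
        (inj₂ (p , y , pivot)) → k (AddColumn.independent A F p y pivot)

  module _ {n : ℕ} {A : Matrix n n} (F : RankFactorisation A) where
    open RankFactorisation F

    zero-rank : rank ≡ 0 → ∀ i j → A i j ≈ 0#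
    zero-rank rank≡0 i j = trans (factorises i j) (sum-zero λ k → ⊥-elim (empty rank≡0 k))
      where
      empty : ∀ {r} → r ≡ 0 → Fin r → ⊥
      empty ≡.refl ()

    -- The trace of BC is that of CB, a matrix of size `rank` with every diagonal entry equal to κ.
    -- Allowing a factor κ covers sums over cyclic groups, which are idempotent only after division
    -- by the number of terms.
    trace-of-scaled-idempotent : ∀ κ → A · A ≈ᴹ (λ i j → κ * A i j) → trace A ≈ sum {rank} (λ _ → κ)
    trace-of-scaled-idempotent κ AA≈κA = begin
      trace A  ≈⟨ sum-cong-≋ (λ i → factorises i i) ⟩
      trace (B · C)          ≈⟨ trace-comm B C ⟩
      trace (C · B)          ≈⟨ sum-cong-≋ diagonal ⟩
      sum {rank} (λ _ → κ)   ∎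
      where
      -- Cancelling B on the left and C on the right of B C B C ≈ κ B C leaves C B ≈ κ.
      AC⁻ : ∀ i l → A i ∙ (λ j → C⁻ j l) ≈ B i l
      AC⁻ i l = begin
        A i ∙ (λ j → C⁻ j l)  ≈⟨ ∙-cong (factorises i) (λ _ → refl) ⟩
        (B · C) i ∙ (λ j → C⁻ j l)  ≈⟨ ∙-assoc (B i) C (λ j → C⁻ j l) ⟨
        B i ∙ (λ k → (C · C⁻) k l)  ≈⟨ ∙-cong {u = B i} (λ _ → refl) (λ k → CC⁻ k l) ⟩
        B i ∙ (λ k → 1ᴹ k l)        ≈⟨ ∙-1ᴹ (B i) l ⟩
        B i l                       ∎
      B⁻A : ∀ k j → B⁻ k ∙ (λ i → A i j) ≈ C k j
      B⁻A k j = begin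
        B⁻ k ∙ (λ i → A i j)  ≈⟨ ∙-cong {u = B⁻ k} (λ _ → refl) (λ i → factorises i j) ⟩
        B⁻ k ∙ (λ i → B i ∙ λ l → C l j)  ≈⟨ ∙-assoc (B⁻ k) B (λ l → C l j) ⟩
        (B⁻ · B) k ∙ (λ l → C l j)  ≈⟨ ∙-cong (B⁻B k) (λ _ → refl) ⟩
        1ᴹ k ∙ (λ l → C l j)  ≈⟨ 1ᴹ-∙ k (λ l → C l j) ⟩
        C k j                             ∎
      diagonal : ∀ k → (C · B) k k ≈ κ
      diagonal k = begin
        C k ∙ (λ i → B i k)  ≈⟨ ∙-cong (λ j → sym (B⁻A k j)) (λ i → sym (AC⁻ i k)) ⟩
        (λ j → B⁻ k ∙ λ i → A i j) ∙ (λ i → A i ∙ λ j → C⁻ j k) ≈⟨ ∙-assoc (B⁻ k) A (λ i → A i ∙ λ j → C⁻ j k) ⟨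
        B⁻ k ∙ (λ i → A i ∙ λ h → A h ∙ λ j → C⁻ j k)  ≈⟨ ∙-cong {u = B⁻ k} (λ _ → refl) (λ i → ∙-assoc (A i) A (λ j → C⁻ j k)) ⟩
        B⁻ k ∙ (λ i → (A · A) i ∙ λ j → C⁻ j k)  ≈⟨ ∙-cong {u = B⁻ k} (λ _ → refl) (λ i → ∙-cong (AA≈κA i) (λ _ → refl)) ⟩
        B⁻ k ∙ (λ i → (λ j → κ * A i j) ∙ λ j → C⁻ j k)  ≈⟨ ∙-cong {u = B⁻ k} (λ _ → refl) (λ i → trans (sym (*-∙ κ (A i) (λ j → C⁻ j k))) (*-congˡ (AC⁻ i k))) ⟩
        B⁻ k ∙ (λ i → κ * B i k)  ≈⟨ ∙-comm (B⁻ k) (λ i → κ * B i k) ⟩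
        (λ i → κ * B i k) ∙ B⁻ k  ≈⟨ *-∙ κ (λ i → B i k) (B⁻ k) ⟨
        κ * ((λ i → B i k) ∙ B⁻ k)  ≈⟨ *-congˡ (trans (∙-comm (λ i → B i k) (B⁻ k)) (B⁻B k k)) ⟩
        κ * 1ᴹ k k  ≈⟨ *-congˡ (reflexive (indicator-yes (k Finₚ.≟ k) ≡.refl)) ⟩
        κ * 1#  ≈⟨ *-identityʳ κ ⟩
        κ                                                  ∎

    -- C⁻C is idempotent with the same kernel as A, because B is left-invertible and C C⁻ = 1.
    kernelProjection : Matrix n n
    kernelProjection i j = 1ᴹ i j - (C⁻ · C) i j

    kernel⇒fixed : ∀ {v} → (∀ i → A i ∙ v ≈ 0#) → ∀ i → kernelProjection i ∙ v ≈ v i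
    kernel⇒fixed {v} Av≈0 i = begin
      kernelProjection i ∙ v  ≈⟨ ∙-comm (kernelProjection i) v ⟩
      v ∙ kernelProjection i  ≈⟨ ∙-sub v (1ᴹ i) ((C⁻ · C) i) ⟩
      v ∙ 1ᴹ i - v ∙ (C⁻ · C) i  ≈⟨ +-cong (trans (∙-comm v (1ᴹ i)) (1ᴹ-∙ i v)) (-‿cong (begin
        v ∙ (C⁻ · C) i  ≈⟨ ∙-comm v ((C⁻ · C) i) ⟩
        (C⁻ · C) i ∙ v                     ≈⟨ ∙-assoc (C⁻ i) C v ⟨
        C⁻ i ∙ (λ k → C k ∙ v)  ≈⟨ ∙-zeroʳ (C⁻ i) Cv≈0 ⟩
        0#                                 ∎)) ⟩
      v i - 0#                           ≈⟨ +-congˡ -0#≈0# ⟩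
      v i + 0#                           ≈⟨ +-identityʳ (v i) ⟩
      v i                                ∎
      where
      Cv≈0 : ∀ k → C k ∙ v ≈ 0#
      Cv≈0 k = begin
        C k ∙ v  ≈⟨ 1ᴹ-∙ k (λ l → C l ∙ v) ⟨
        1ᴹ k ∙ (λ l → C l ∙ v)  ≈⟨ ∙-cong (λ l → sym (B⁻B k l)) (λ _ → refl) ⟩
        (B⁻ · B) k ∙ (λ l → C l ∙ v)  ≈⟨ ∙-assoc (B⁻ k) B (λ l → C l ∙ v) ⟨
        B⁻ k ∙ (λ i → B i ∙ λ l → C l ∙ v) ≈⟨ ∙-zeroʳ (B⁻ k) (λ i → begin
          B i ∙ (λ l → C l ∙ v)             ≈⟨ ∙-assoc (B i) C v ⟩
          (B · C) i ∙ v  ≈⟨ ∙-cong (λ j → sym (factorises i j)) (λ _ → refl) ⟩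
          A i ∙ v                           ≈⟨ Av≈0 i ⟩
          0#                                ∎) ⟩
        0#                                ∎

    kernelProjection-kernel : ∀ i j → (A · kernelProjection) i j ≈ 0#
    kernelProjection-kernel i j = begin
      A i ∙ (λ k → 1ᴹ k j - (C⁻ · C) k j)  ≈⟨ ∙-sub (A i) (λ k → 1ᴹ k j) (λ k → (C⁻ · C) k j) ⟩
      A i ∙ (λ k → 1ᴹ k j) - A i ∙ (λ k → (C⁻ · C) k j) ≈⟨ +-cong (trans (∙-1ᴹ (A i) j) (factorises i j)) (-‿cong (begin
        A i ∙ (λ k → C⁻ k ∙ λ l → C l j)  ≈⟨ ∙-cong (factorises i) (λ _ → refl) ⟩
        (B · C) i ∙ (λ k → C⁻ k ∙ λ l → C l j)  ≈⟨ ∙-assoc (B i) C (λ k → C⁻ k ∙ λ l → C l j) ⟨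
        B i ∙ (λ h → C h ∙ λ k → C⁻ k ∙ λ l → C l j)  ≈⟨ ∙-cong {u = B i} (λ _ → refl) (λ h → ∙-assoc (C h) C⁻ (λ l → C l j)) ⟩
        B i ∙ (λ h → (C · C⁻) h ∙ λ l → C l j)  ≈⟨ ∙-cong {u = B i} (λ _ → refl) (λ h → trans (∙-cong (CC⁻ h) (λ _ → refl)) (1ᴹ-∙ h (λ l → C l j))) ⟩
        B i ∙ (λ h → C h j)                              ∎)) ⟩
      (B · C) i j - (B · C) i j  ≈⟨ -‿inverseʳ ((B · C) i j) ⟩
      0#                                              ∎

-- The character on an eigenspace of an invariant matrix

module EigenspaceCharacter {c ℓ : Level} (K : CommutativeRing c ℓ) {n : ℕ} (G : FinGroup n) where
  import Algebra.Properties.Ring as RingProperties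
  import Algebra.Properties.Semiring.Mult as Mult
  open import Relation.Binary.PropositionalEquality as ≡ using (_≡_; _≢_)

  open CommutativeRing K hiding (zero)
  open RingProperties ring using (+-cancelʳ)
  open Mult semiring using (×-assoc-*; ×-assocˡ; ×-congʳ) renaming (_×_ to _×ᴷ_)
  open Sums K
  open Matrices K using (Vector; Matrix; 1ᴹ; trace; ∙-sub; ∙-comm; *-∙; 1ᴹ-∙; RankFactorisation;
      rankFactorisation; trace-of-scaled-idempotent; zero-rank; kernelProjection; kernel⇒fixed;
      kernelProjection-kernel; _≈ᴹ_; _·_; ∙-zeroˡ)
    renaming (_∙_ to infix 7 _•_)
  open FinGroup G using (_∙_; ε; _⁻¹; ^-+; identityˡ; assoc; cancel-∙⁻¹; cancel-⁻¹∙; cancelʳ-⁻¹∙;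
      cancelʳ-∙⁻¹)
    renaming (_^_ to infixr 9 _^ᴳ_)
  open import Relation.Binary.Reasoning.Setoid setoid

  sum-shift : ∀ e (f : ℕ → Carrier) →
              sum {e} (λ i → f (toℕ i)) + f e ≈ f 0 + sum {e} (λ i → f (suc (toℕ i)))
  sum-shift zero    f = +-comm 0# (f 0)
  sum-shift (suc e) f = trans (+-assoc (f 0) (sum {e} (λ i → f (suc (toℕ i)))) (f (suc e)))
    (+-congˡ (trans (sum-shift e (f ∘ suc)) refl))

  sum-cycle : ∀ e (f : ℕ → Carrier) → f e ≈ f 0 → sum {e} (λ i → f (suc (toℕ i))) ≈ sum {e} (λ i → f (toℕ i))
  sum-cycle e f fₑ≈f₀ = +-cancelʳ (f 0) (sum {e} (λ i → f (suc (toℕ i)))) (sum {e} (λ i → f (toℕ i)))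
    (trans (+-comm (sum {e} (λ i → f (suc (toℕ i)))) (f 0)) (trans (sym (sum-shift e f)) (+-congˡ fₑ≈f₀)))

  sum-cycles : ∀ e (f : ℕ → Carrier) → (∀ i → f (i ℕ.+ e) ≈ f i) → ∀ k →
               sum {e} (λ i → f (k ℕ.+ toℕ i)) ≈ sum {e} (λ i → f (toℕ i))
  sum-cycles e f periodic zero    = refl
  sum-cycles e f periodic (suc k) = trans
    (trans (sum-cong-≋ {e} λ i → reflexive (≡.cong f (≡.sym (ℕₚ.+-suc k (toℕ i)))))
      (sum-cycle e (f ∘ (k ℕ.+_)) (trans (periodic k) (reflexive (≡.cong f (≡.sym (ℕₚ.+-identityʳ k)))))))
    (sum-cycles e f periodic k)

  module _ (invertible : ∀ x → ¬ ¬ (x ≈ 0# ⊎ ∃ λ y → y * x ≈ 1#))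
           (M : Matrix n n) (μ : Carrier)
           (M-left : ∀ x i j → M (x ∙ i) (x ∙ j) ≈ M i j)
           (M-right : ∀ x i j → M (i ∙ x) (j ∙ x) ≈ M i j)
           where

    private
      N : Matrix n n
      N i j = M i j - μ * 1ᴹ i j

      N-left : ∀ x i j → N (x ∙ i) (x ∙ j) ≈ N i j
      N-left x i j = +-cong (M-left x i j) (-‿cong (*-congˡ (reflexive (indicator-⇔ (x ∙ i Finₚ.≟ x ∙ j) (i Finₚ.≟ j)
        (λ eq → ≡.trans (≡.sym (cancel-⁻¹∙ x i)) (≡.trans (≡.cong (x ⁻¹ ∙_) eq) (cancel-⁻¹∙ x j)))
        (≡.cong (x ∙_))))))

      N-• : ∀ i v → N i • v ≈ M i • v - μ * v i
      N-• i v = begin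
        N i • v                                ≈⟨ ∙-comm (N i) v ⟩
        v • N i  ≈⟨ ∙-sub v (M i) (λ j → μ * 1ᴹ i j) ⟩
        v • M i - v • (λ j → μ * 1ᴹ i j)  ≈⟨ +-cong (∙-comm v (M i)) (-‿cong (begin
          v • (λ j → μ * 1ᴹ i j)  ≈⟨ ∙-comm v (λ j → μ * 1ᴹ i j) ⟩
          (λ j → μ * 1ᴹ i j) • v  ≈⟨ *-∙ μ (1ᴹ i) v ⟨
          μ * (1ᴹ i • v)  ≈⟨ *-congˡ (1ᴹ-∙ i v) ⟩
          μ * v i                                ∎)) ⟩
        M i • v - μ * v i                      ∎

    -- The facts about the character from which integrality is deduced. In `χ-average` the number m
    -- arises as the rank of the sum over the powers of x, that is, as the dimension of the vectors
    -- they fix.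
    record Character : Set (c Level.⊔ ℓ) where
      field
        χ          : Fin n → Carrier
        degree     : ℕ
        degree≢0   : degree ≢ 0
        χ-ε        : χ ε ≈ degree ×ᴷ 1#
        χ-eigen    : ∀ x → sum (λ y → M ε y * χ (y ∙ x)) ≈ μ * χ x
        χ-average  : ∀ x e → x ^ᴳ e ≡ ε →
                     ¬ ¬ ∃ λ m → sum {e} (λ i → χ (x ^ᴳ toℕ i)) ≈ (m ℕ.* e) ×ᴷ 1#

    module _ (F : RankFactorisation N) where
      private
        Q : Matrix n n
        Q = kernelProjection F

        Kernel : Matrix n n → Set ℓ
        Kernel X = ∀ i j → N i • (λ k → X k j) ≈ 0#

        Q-fixes : ∀ X → Kernel X → Q · X ≈ᴹ X
        Q-fixes X NX≈0 i j = kernel⇒fixed F (λ k → NX≈0 k j) i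

        translate : Fin n → Matrix n n → Matrix n n
        translate x X i j = X (x ∙ i) j

        translate-kernel : ∀ x X → Kernel X → Kernel (translate x X)
        translate-kernel x X NX≈0 i j = begin
          (sum λ k → N i k * X (x ∙ k) j)  ≈⟨ sum-cong-≋ (λ k → *-congʳ (N-left x i k)) ⟨
          (sum λ k → N (x ∙ i) (x ∙ k) * X (x ∙ k) j)  ≈⟨ sum-bijection (λ k → N (x ∙ i) k * X k j) (x ∙_) (x ⁻¹ ∙_) (cancel-∙⁻¹ x) (cancel-⁻¹∙ x) ⟨
          (sum λ k → N (x ∙ i) k * X k j)  ≈⟨ NX≈0 (x ∙ i) j ⟩
          0#                                           ∎

        -- Translation f ↦ f(x ∙ _) preserves the kernel of `N`, onto which `Q` projects, so this is
        -- the trace of the translation on the eigenspace.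
        χ : Fin n → Carrier
        χ x = trace (translate x Q)

        χ-ε : χ ε ≈ trace Q
        χ-ε = sum-cong-≋ λ i → reflexive (≡.cong (λ k → Q k i) (identityˡ i))

        MQ : ∀ i j → M i • (λ k → Q k j) ≈ μ * Q i j
        MQ i j = begin
          M i • q                          ≈⟨ +-identityʳ _ ⟨
          M i • q + 0#  ≈⟨ +-congˡ (-‿inverseˡ (μ * Q i j)) ⟨
          M i • q + (- (μ * Q i j) + μ * Q i j) ≈⟨ +-assoc _ _ _ ⟨
          M i • q - μ * Q i j + μ * Q i j  ≈⟨ +-congʳ (N-• i q) ⟨
          N i • q + μ * Q i j  ≈⟨ +-congʳ (kernelProjection-kernel F i j) ⟩
          0# + μ * Q i j                   ≈⟨ +-identityˡ _ ⟩
          μ * Q i j                        ∎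
          where
          q : Vector n
          q k = Q k j

        -- Right invariance turns M(ε, y) into M(xa, yxa). For each a the sum over y is then an
        -- entry of M Q = μ Q.
        χ-eigen : ∀ x → sum (λ y → M ε y * χ (y ∙ x)) ≈ μ * χ x
        χ-eigen x = begin
          (sum λ y → M ε y * sum λ a → Q (y ∙ x ∙ a) a)  ≈⟨ sum-cong-≋ (λ y → *-distribˡ-sum (M ε y) (λ a → Q (y ∙ x ∙ a) a)) ⟩
          (sum λ y → sum λ a → M ε y * Q (y ∙ x ∙ a) a)  ≈⟨ ∑-comm (λ y a → M ε y * Q (y ∙ x ∙ a) a) ⟩
          (sum λ a → sum λ y → M ε y * Q (y ∙ x ∙ a) a)  ≈⟨ sum-cong-≋ column ⟩
          (sum λ a → μ * Q (x ∙ a) a)  ≈⟨ *-distribˡ-sum μ (λ a → Q (x ∙ a) a) ⟨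
          μ * χ x                                          ∎
          where
          column : ∀ a → sum (λ y → M ε y * Q (y ∙ x ∙ a) a) ≈ μ * Q (x ∙ a) a
          column a = begin
            (sum λ y → M ε y * Q (y ∙ x ∙ a) a)  ≈⟨ sum-cong-≋ (λ y → *-cong
                 (trans (sym (M-right (x ∙ a) ε y)) (reflexive (≡.cong (λ k → M k (y ∙ (x ∙ a))) (identityˡ (x ∙ a)))))
                 (reflexive (≡.cong (λ k → Q k a) (assoc y x a)))) ⟩
            (sum λ y → M (x ∙ a) (y ∙ (x ∙ a)) * Q (y ∙ (x ∙ a)) a) ≈⟨ sum-bijection (λ k → M (x ∙ a) k * Q k a) (_∙ (x ∙ a)) (_∙ (x ∙ a) ⁻¹)
                                                                    (cancelʳ-⁻¹∙ (x ∙ a)) (cancelʳ-∙⁻¹ (x ∙ a)) ⟨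
            M (x ∙ a) • (λ k → Q k a)  ≈⟨ MQ (x ∙ a) a ⟩
            μ * Q (x ∙ a) a                                    ∎

        module _ (x : Fin n) (e : ℕ) (xᵉ≡ε : x ^ᴳ e ≡ ε) where

          -- The projection `Q` followed by the sum of the translations by ε, x, ..., x^(e-1); it is
          -- e times an averaging projection.
          A : Matrix n n
          A i j = sum {e} λ k → Q (x ^ᴳ toℕ k ∙ i) j

          A-kernel : Kernel A
          A-kernel i j = begin
            (sum λ l → N i l * sum {e} λ k → Q (x ^ᴳ toℕ k ∙ l) j)  ≈⟨ sum-cong-≋ (λ l → *-distribˡ-sum (N i l) (λ (k : Fin e) → Q (x ^ᴳ toℕ k ∙ l) j)) ⟩
            (sum λ l → sum {e} λ k → N i l * Q (x ^ᴳ toℕ k ∙ l) j)  ≈⟨ ∑-comm (λ l (k : Fin e) → N i l * Q (x ^ᴳ toℕ k ∙ l) j) ⟩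
            (sum {e} λ k → sum λ l → N i l * Q (x ^ᴳ toℕ k ∙ l) j)  ≈⟨ sum-zero {e} (λ k → translate-kernel (x ^ᴳ toℕ k) Q (kernelProjection-kernel F) i j) ⟩
            0#  ∎

          A-translate : ∀ k i j → A (x ^ᴳ k ∙ i) j ≈ A i j
          A-translate k i j = begin
            sum {e} (λ l → Q (x ^ᴳ toℕ l ∙ (x ^ᴳ k ∙ i)) j)  ≈⟨ sum-cong-≋ {e} (λ l → reflexive (≡.cong (λ z → Q z j) (shifted (toℕ l)))) ⟩
            sum {e} (λ l → Q (x ^ᴳ (k ℕ.+ toℕ l) ∙ i) j)  ≈⟨ sum-cycles e (λ l → Q (x ^ᴳ l ∙ i) j) periodic k ⟩
            sum {e} (λ l → Q (x ^ᴳ toℕ l ∙ i) j)             ∎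
            where
            shifted : ∀ l → x ^ᴳ l ∙ (x ^ᴳ k ∙ i) ≡ x ^ᴳ (k ℕ.+ l) ∙ i
            shifted l = ≡.trans (≡.sym (assoc (x ^ᴳ l) (x ^ᴳ k) i))
              (≡.cong (_∙ i) (≡.trans (≡.sym (^-+ x l k)) (≡.cong (x ^ᴳ_) (ℕₚ.+-comm l k))))
            periodic : ∀ l → Q (x ^ᴳ (l ℕ.+ e) ∙ i) j ≈ Q (x ^ᴳ l ∙ i) j
            periodic l = reflexive (≡.cong (λ z → Q (z ∙ i) j) (≡.trans (≡.cong (x ^ᴳ_) (ℕₚ.+-comm l e))
              (≡.trans (^-+ x e l) (≡.trans (≡.cong (_∙ x ^ᴳ l) xᵉ≡ε) (identityˡ (x ^ᴳ l))))))

          -- The columns of `A` lie in the kernel, so Q A = A; what remains is a sum of e translates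
          -- of `A`, each equal to `A`.
          A-scaled-idempotent : A · A ≈ᴹ λ i j → e ×ᴷ 1# * A i j
          A-scaled-idempotent i j = begin
            (sum λ l → (sum {e} λ k → Q (x ^ᴳ toℕ k ∙ i) l) * A l j)  ≈⟨ sum-cong-≋ (λ l → *-distribʳ-sum (A l j) (λ (k : Fin e) → Q (x ^ᴳ toℕ k ∙ i) l)) ⟩
            (sum λ l → sum {e} λ k → Q (x ^ᴳ toℕ k ∙ i) l * A l j)  ≈⟨ ∑-comm (λ l (k : Fin e) → Q (x ^ᴳ toℕ k ∙ i) l * A l j) ⟩
            (sum {e} λ k → (Q · A) (x ^ᴳ toℕ k ∙ i) j)  ≈⟨ sum-cong-≋ {e} (λ k → trans (Q-fixes A A-kernel (x ^ᴳ toℕ k ∙ i) j) (A-translate (toℕ k) i j)) ⟩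
            (sum {e} λ _ → A i j)  ≈⟨ sum-replicate e {A i j} ⟩
            e ×ᴷ A i j  ≈⟨ trans (×-assoc-* e 1# (A i j)) (×-congʳ e (*-identityˡ (A i j))) ⟨
            e ×ᴷ 1# * A i j  ∎

          trace-A : trace A ≈ sum {e} (λ i → χ (x ^ᴳ toℕ i))
          trace-A = ∑-comm λ i (k : Fin e) → Q (x ^ᴳ toℕ k ∙ i) i

          multiple : ∀ k → sum {k} (λ _ → e ×ᴷ 1#) ≈ (k ℕ.* e) ×ᴷ 1#
          multiple k = begin
            sum {k} (λ _ → e ×ᴷ 1#)  ≈⟨ sum-replicate k {e ×ᴷ 1#} ⟩
            k ×ᴷ (e ×ᴷ 1#)               ≈⟨ ×-assocˡ 1# k e ⟩
            (k ℕ.* e) ×ᴷ 1#              ∎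

          χ-average : ¬ ¬ ∃ λ m → sum {e} (λ i → χ (x ^ᴳ toℕ i)) ≈ (m ℕ.* e) ×ᴷ 1#
          χ-average k = rankFactorisation invertible A λ F′ → k (RankFactorisation.rank F′ ,
            trans (sym trace-A) (trans (trace-of-scaled-idempotent F′ (e ×ᴷ 1#) A-scaled-idempotent)
              (multiple (RankFactorisation.rank F′))))

      character : ∀ v → (∀ i → M i • v ≈ μ * v i) → (∃ λ i → ¬ v i ≈ 0#) → ¬ ¬ Character
      character v Mv≈μv (p , vₚ≉0) k = rankFactorisation invertible Q λ F′ → k record
        { χ = χ
        ; degree = RankFactorisation.rank F′
        -- If the rank were 0, then `Q` and with it v = Q v would vanish.
        ; degree≢0 = λ rank≡0 → vₚ≉0 (trans (sym (fixed p)) (∙-zeroˡ v (zero-rank F′ rank≡0 p)))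
        ; χ-ε = trans χ-ε (trans (trace-of-scaled-idempotent F′ 1# (λ i j → trans
                  (Q-fixes Q (kernelProjection-kernel F) i j) (sym (*-identityˡ (Q i j)))))
                  (sum-replicate (RankFactorisation.rank F′) {1#}))
        ; χ-eigen = χ-eigen
        ; χ-average = χ-average
        }
        where
        fixed : ∀ i → Q i • v ≈ v i
        fixed = kernel⇒fixed F λ i → trans (N-• i v) (trans (+-congʳ (Mv≈μv i)) (-‿inverseʳ (μ * v i)))

    eigenvector⇒character : ∀ v → (∀ i → M i • v ≈ μ * v i) → (∃ λ i → ¬ v i ≈ 0#) → ¬ ¬ Character
    eigenvector⇒character v Mv≈μv v≉0 k = rankFactorisation invertible N λ F → character F v Mv≈μv v≉0 k

-- Integrality of the eigenvalue

module IntegralEigenvalues where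
  import Algebra.Properties.Semiring.Mult as Mult
  import Algebra.Properties.CommutativeSemiring.Exp as Exp
  open import Data.Empty using (⊥)
  open import Data.Fin.Base using (_↑ˡ_; _↑ʳ_)
  open import Data.Integer.Base as ℤ using (ℤ; +_)
  import Data.Integer.Properties as ℤₚ
  open import Data.Integer.Divisibility.Signed as ℤᵈ using ()
  open import Data.Nat.Coprimality as Coprimality using (Coprime; coprime-divisor; gcd≡1⇒coprime;
    coprime⇒gcd≡1; coprime-/gcd)
  open import Data.Nat.Divisibility using (_∣_; divides; _∣?_; ∣⇒≤; ∣-trans; ∣m∣n⇒∣m+n; ∣m+n∣m⇒∣n; ∣-refl;
    *-cancelˡ-∣; _∣0; 0∣⇒≡0)
  open import Data.Nat.DivMod using (_/_; m/n*n≡m)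
  open import Data.Nat.GCD using (gcd; gcd[m,n]∣m; gcd[m,n]∣n; gcd-greatest; gcd[m,n]≢0)
  open import Data.Nat.Induction using (<-wellFounded)
  open import Induction.WellFounded using (Acc; acc)
  open import Relation.Binary.PropositionalEquality as ≡ using (_≡_; _≢_)

  powers-∣⇒≡1 : ∀ c g .{{_ : ℕ.NonZero c}} .{{_ : ℕ.NonZero g}} → (∀ k → c ℕ.^ k ∣ g) → c ≡ 1
  powers-∣⇒≡1 1             g div = ≡.refl
  powers-∣⇒≡1 (suc (suc c)) g div = contradiction (∣⇒≤ (div g)) (ℕₚ.<⇒≱ (n<m^n (ℕ.s≤s (ℕ.s≤s ℕ.z≤n)) g))

  -- Cancelling gᵏ leaves cᵏ dividing rᵏ⁺¹ g, hence cᵏ divides g for every k, which is impossible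
  -- for c > 1.
  coprime-∣^⇒≡1 : ∀ c r g .{{_ : ℕ.NonZero c}} .{{_ : ℕ.NonZero g}} → Coprime c r →
                  (∀ k → (c ℕ.* g) ℕ.^ k ∣ (r ℕ.* g) ℕ.^ suc k) → c ≡ 1
  coprime-∣^⇒≡1 c r g coprime div = powers-∣⇒≡1 c g λ k → coprime-divisor
      (Coprimality.sym (coprime-^ (suc k) (Coprimality.sym (coprime-^ k coprime))))
      (*-cancelˡ-∣ (g ℕ.^ k) {{ℕₚ.m^n≢0 g k}} (≡.subst₂ _∣_
        (≡.trans (^-distribʳ-* k c g) (ℕₚ.*-comm (c ℕ.^ k) (g ℕ.^ k))) (right k) (div k)))
    where
    right : ∀ k → (r ℕ.* g) ℕ.^ suc k ≡ g ℕ.^ k ℕ.* (r ℕ.^ suc k ℕ.* g)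
    right k = begin
      (r ℕ.* g) ℕ.^ suc k  ≡⟨ ^-distribʳ-* (suc k) r g ⟩
      r ℕ.^ suc k ℕ.* (g ℕ.* g ℕ.^ k)  ≡⟨ ℕₚ.*-assoc (r ℕ.^ suc k) g (g ℕ.^ k) ⟨
      r ℕ.^ suc k ℕ.* g ℕ.* g ℕ.^ k  ≡⟨ ℕₚ.*-comm (r ℕ.^ suc k ℕ.* g) (g ℕ.^ k) ⟩
      g ℕ.^ k ℕ.* (r ℕ.^ suc k ℕ.* g)       ∎
      where open ≡.≡-Reasoning

  -- Dividing c and r by their gcd reduces to the coprime case, where the quotient of c turns out to
  -- be 1.
  ∣^⇒∣ : ∀ c r .{{_ : ℕ.NonZero c}} → (∀ k → c ℕ.^ k ∣ r ℕ.^ suc k) → c ∣ r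
  ∣^⇒∣ c r div = ≡.subst (_∣ r) gcd≡c (gcd[m,n]∣n c r)
    where
    instance
      gcd≢0 : ℕ.NonZero (gcd c r)
      gcd≢0 = ℕ.≢-nonZero (gcd[m,n]≢0 c r (inj₁ (ℕ.≢-nonZero⁻¹ c)))
      quotient≢0 : ℕ.NonZero (c / gcd c r)
      quotient≢0 = ℕ.≢-nonZero λ eq → ℕ.≢-nonZero⁻¹ c
          (≡.trans (≡.sym (m/n*n≡m (gcd[m,n]∣m c r))) (≡.cong (ℕ._* gcd c r) eq))
    quotient≡1 : c / gcd c r ≡ 1
    quotient≡1 = coprime-∣^⇒≡1 (c / gcd c r) (r / gcd c r) (gcd c r) (coprime-/gcd c r) λ k →
      ≡.subst₂ (λ x y → x ℕ.^ k ∣ y ℕ.^ suc k) (≡.sym (m/n*n≡m (gcd[m,n]∣m c r))) (≡.sym (m/n*n≡m (gcd[m,n]∣n c r))) (div k)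
    gcd≡c : gcd c r ≡ c
    gcd≡c = ≡.trans (≡.sym (ℕₚ.*-identityˡ (gcd c r)))
      (≡.trans (≡.cong (ℕ._* gcd c r) (≡.sym quotient≡1)) (m/n*n≡m (gcd[m,n]∣m c r)))

  module Integrality {c ℓ : Level} (K : CommutativeRing c ℓ)
    (invertible : ∀ x → ¬ ¬ (CommutativeRing._≈_ K x (CommutativeRing.0# K) ⊎
                             ∃ λ y → CommutativeRing._≈_ K (CommutativeRing._*_ K y x) (CommutativeRing.1# K)))
    (ι : ℤ → CommutativeRing.Carrier K)
    (ι-+ : ∀ i j → CommutativeRing._≈_ K (ι (i ℤ.+ j)) (CommutativeRing._+_ K (ι i) (ι j)))
    (ι-* : ∀ i j → CommutativeRing._≈_ K (ι (i ℤ.* j)) (CommutativeRing._*_ K (ι i) (ι j)))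
    (ι-neg : ∀ i → CommutativeRing._≈_ K (ι (ℤ.- i)) (CommutativeRing.-_ K (ι i)))
    (ι-0 : CommutativeRing._≈_ K (ι (+ 0)) (CommutativeRing.0# K))
    (ι-1 : CommutativeRing._≈_ K (ι (+ 1)) (CommutativeRing.1# K))
    (ι-injective : ∀ {i j} → CommutativeRing._≈_ K (ι i) (ι j) → i ≡ j)
    where

    open CommutativeRing K hiding (zero)
    open Mult semiring using () renaming (_×_ to _×ᴷ_)
    open Exp commutativeSemiring using (_^_; ^-congˡ; ^-distrib-*)
    open Sums K
    private module ℤΣ = Sums ℤₚ.+-*-commutativeRing
    open import Relation.Binary.Reasoning.Setoid setoid

    -- Doubly negated because the ranks and inverses behind it exist only in that sense; all closure
    -- properties pass through the double negation.
    IsInteger : Carrier → Set ℓ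
    IsInteger x = ¬ ¬ ∃ λ k → x ≈ ι k

    integer-cong : ∀ {x y} → x ≈ y → IsInteger y → IsInteger x
    integer-cong x≈y int k = int λ (i , y≈i) → k (i , trans x≈y y≈i)

    integer-ι : ∀ i → IsInteger (ι i)
    integer-ι i k = k (i , refl)

    integer-+ : ∀ {x y} → IsInteger x → IsInteger y → IsInteger (x + y)
    integer-+ int-x int-y k = int-x λ (i , x≈i) → int-y λ (j , y≈j) →
      k (i ℤ.+ j , trans (+-cong x≈i y≈j) (sym (ι-+ i j)))

    integer-* : ∀ {x y} → IsInteger x → IsInteger y → IsInteger (x * y)
    integer-* int-x int-y k = int-x λ (i , x≈i) → int-y λ (j , y≈j) →
      k (i ℤ.* j , trans (*-cong x≈i y≈j) (sym (ι-* i j)))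

    integer-neg : ∀ {x} → IsInteger x → IsInteger (- x)
    integer-neg int-x k = int-x λ (i , x≈i) → k (ℤ.- i , trans (-‿cong x≈i) (sym (ι-neg i)))

    integer-0 : IsInteger 0#
    integer-0 = integer-cong (sym ι-0) (integer-ι (+ 0))

    integer-1 : IsInteger 1#
    integer-1 = integer-cong (sym ι-1) (integer-ι (+ 1))

    integer-× : ∀ n → IsInteger (n ×ᴷ 1#)
    integer-× zero    = integer-0
    integer-× (suc n) = integer-+ integer-1 (integer-× n)

    integer-sum : ∀ {n} {f : Fin n → Carrier} → (∀ i → IsInteger (f i)) → IsInteger (sum f)
    integer-sum {zero}  int = integer-0
    integer-sum {suc n} int = integer-+ (int zero) (integer-sum (int ∘ suc))

    integer-cancelˡ : ∀ {x y} → IsInteger x → IsInteger (x + y) → IsInteger y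
    integer-cancelˡ {x} {y} int-x int-x+y = integer-cong
      (begin
        y              ≈⟨ +-identityˡ y ⟨
        0# + y         ≈⟨ +-congʳ (-‿inverseˡ x) ⟨
        - x + x + y    ≈⟨ +-assoc (- x) x y ⟩
        - x + (x + y)  ∎)
      (integer-+ (integer-neg int-x) int-x+y)

    integer-summand : ∀ {n} (k : Fin n) {f : Fin n → Carrier} → (∀ i → i ≢ k → IsInteger (f i)) →
                      IsInteger (sum f) → IsInteger (f k)
    integer-summand zero    int int-Σ = integer-cancelˡ (integer-sum λ i → int (suc i) λ ())
      (integer-cong (+-comm _ _) int-Σ)
    integer-summand (suc k) int int-Σ = integer-summand k (λ i i≢k → int (suc i) (i≢k ∘ Finₚ.suc-injective))
      (integer-cancelˡ (int zero λ ()) int-Σ)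

    ι-sum : ∀ {n} (f : Fin n → ℤ) → ι (ℤΣ.sum f) ≈ sum (λ i → ι (f i))
    ι-sum {zero}  f = ι-0
    ι-sum {suc n} f = trans (ι-+ (f zero) _) (+-congˡ (ι-sum (f ∘ suc)))

    ι-indicator : ∀ {p} {P : Set p} (d : Dec P) → ι (ℤΣ.indicator d) ≈ indicator d
    ι-indicator (yes _) = ι-1
    ι-indicator (no _)  = ι-0

    ι-^ : ∀ i k → ι (i ℤ.^ k) ≈ ι i ^ k
    ι-^ i zero    = ι-1
    ι-^ i (suc k) = trans (ι-* i (i ℤ.^ k)) (*-congˡ (ι-^ i k))

    -- From dμ = r and dμᵏ⁺¹ = z it follows that dᵏ z = rᵏ⁺¹. So every dᵏ divides rᵏ⁺¹, hence d
    -- divides r, and d can be cancelled from dμ = r.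
    bounded-denominator⇒integer : ∀ d .{{_ : ℕ.NonZero ℤ.∣ d ∣}} μ → (∀ k → IsInteger (ι d * μ ^ k)) → IsInteger μ
    bounded-denominator⇒integer d μ int stop = int 1 λ (r , dμ≈r) → conclude r (trans (*-congˡ (sym (*-identityʳ μ))) dμ≈r)
      where
      module _ (r : ℤ) (dμ≈r : ι d * μ ≈ ι r) where
        power : ∀ k z → ι d * μ ^ suc k ≈ ι z → d ℤ.^ k ℤ.* z ≡ r ℤ.^ suc k
        power k z eq = ι-injective (begin
          ι (d ℤ.^ k ℤ.* z)  ≈⟨ trans (ι-* (d ℤ.^ k) z) (*-cong (ι-^ d k) (sym eq)) ⟩
          ι d ^ k * (ι d * μ ^ suc k)  ≈⟨ *-assoc (ι d ^ k) (ι d) (μ ^ suc k) ⟨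
          ι d ^ k * ι d * μ ^ suc k  ≈⟨ *-congʳ (*-comm (ι d ^ k) (ι d)) ⟩
          ι d ^ suc k * μ ^ suc k  ≈⟨ ^-distrib-* (ι d) μ (suc k) ⟨
          (ι d * μ) ^ suc k  ≈⟨ ^-congˡ (suc k) dμ≈r ⟩
          ι r ^ suc k                      ≈⟨ ι-^ r (suc k) ⟨
          ι (r ℤ.^ suc k)                  ∎)
        abs-^ : ∀ i k → ℤ.∣ i ℤ.^ k ∣ ≡ ℤ.∣ i ∣ ℕ.^ k
        abs-^ i zero    = ≡.refl
        abs-^ i (suc k) = ≡.trans (ℤₚ.abs-* i (i ℤ.^ k)) (≡.cong (ℤ.∣ i ∣ ℕ.*_) (abs-^ i k))
        divisible : ∀ k → ℤ.∣ d ∣ ℕ.^ k ∣ ℤ.∣ r ∣ ℕ.^ suc k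
        divisible k = decidable-stable (_ ∣? _) λ ∤ → int (suc k) λ (z , eq) → ∤ (divides ℤ.∣ z ∣ (≡.trans
          (≡.sym (abs-^ r (suc k))) (≡.trans (≡.cong ℤ.∣_∣ (≡.sym (power k z eq))) (≡.trans (ℤₚ.abs-* (d ℤ.^ k) z)
            (≡.trans (≡.cong (ℕ._* ℤ.∣ z ∣) (abs-^ d k)) (ℕₚ.*-comm (ℤ.∣ d ∣ ℕ.^ k) ℤ.∣ z ∣))))))
        divide : d ℤᵈ.∣ r → ⊥
        divide (ℤᵈ.divides s r≡sd) = invertible (ι d) λ where
          (inj₁ d≈0) → ℕ.≢-nonZero⁻¹ ℤ.∣ d ∣ (≡.cong ℤ.∣_∣ (ι-injective (trans d≈0 (sym ι-0))))
          (inj₂ (y , yd≈1)) → stop (s , (begin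
            μ                  ≈⟨ *-identityˡ μ ⟨
            1# * μ             ≈⟨ *-congʳ yd≈1 ⟨
            y * ι d * μ        ≈⟨ *-assoc y (ι d) μ ⟩
            y * (ι d * μ)  ≈⟨ *-congˡ (trans dμ≈r (trans (reflexive (≡.cong ι r≡sd)) (trans (ι-* s d) (*-comm (ι s) (ι d))))) ⟩
            y * (ι d * ι s)    ≈⟨ *-assoc y (ι d) (ι s) ⟨
            y * ι d * ι s      ≈⟨ *-congʳ yd≈1 ⟩
            1# * ι s           ≈⟨ *-identityˡ (ι s) ⟩
            ι s                ∎))
        conclude : ⊥
        conclude = divide (ℤᵈ.∣ᵤ⇒∣ (∣^⇒∣ ℤ.∣ d ∣ ℤ.∣ r ∣ divisible))

    sum-multiples : ∀ d .{{_ : ℕ.NonZero d}} k (f : ℕ → Carrier) →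
      sum {k ℕ.* d} (λ i → indicator (d ∣? toℕ i) * f (toℕ i)) ≈ sum {k} (λ i → f (toℕ i ℕ.* d))
    sum-multiples d zero    f = refl
    sum-multiples (suc d) (suc k) f = begin
      sum {suc k ℕ.* suc d} (λ i → term (toℕ i))  ≈⟨ sum-++ (suc d) {k ℕ.* suc d} (λ i → term (toℕ i)) ⟩
      sum {suc d} (λ i → term (toℕ (i ↑ˡ k ℕ.* suc d))) + sum {k ℕ.* suc d} (λ i → term (toℕ (suc d ↑ʳ i)))
        ≈⟨ +-cong (reflexive (sum-cong-≗ {suc d} λ i → ≡.cong term (Finₚ.toℕ-↑ˡ i (k ℕ.* suc d))))
                  (reflexive (sum-cong-≗ {k ℕ.* suc d} λ i → ≡.cong term (Finₚ.toℕ-↑ʳ (suc d) i))) ⟩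
      sum {suc d} (λ i → term (toℕ i)) + sum {k ℕ.* suc d} (λ i → term (suc d ℕ.+ toℕ i))
        ≈⟨ +-cong first rest ⟩
      f 0 + sum {k} (λ i → f (suc d ℕ.+ toℕ i ℕ.* suc d)) ∎
      where
      term : ℕ → Carrier
      term i = indicator (suc d ∣? i) * f i
      first : sum {suc d} (λ i → term (toℕ i)) ≈ f 0
      first = trans (sum-single {suc d} zero (λ i → term (toℕ i)) others)
        (trans (*-congʳ (reflexive (indicator-yes (suc d ∣? 0) (suc d ∣0)))) (*-identityˡ (f 0)))
        where
        others : ∀ i → i ≢ zero → term (toℕ i) ≈ 0#
        others zero    0≢0 = contradiction ≡.refl 0≢0
        others (suc i) _   = trans (*-congʳ (reflexive (indicator-no (suc d ∣? suc (toℕ i))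
          λ div → ℕₚ.<⇒≱ (Finₚ.toℕ<n (suc i)) (∣⇒≤ div)))) (zeroˡ (f (suc (toℕ i))))
      rest : sum {k ℕ.* suc d} (λ i → term (suc d ℕ.+ toℕ i)) ≈ sum {k} (λ i → f (suc d ℕ.+ toℕ i ℕ.* suc d))
      rest = trans
        (sum-cong-≋ {k ℕ.* suc d} λ i → *-congʳ (reflexive (indicator-⇔ (suc d ∣? suc d ℕ.+ toℕ i) (suc d ∣? toℕ i)
          (λ div → ∣m+n∣m⇒∣n div ∣-refl) (λ div → ∣m∣n⇒∣m+n ∣-refl div))))
        (sum-multiples (suc d) k (λ i → f (suc d ℕ.+ i)))

    -- Grouping the indices i by the value g(i).
    sum-by-value : ∀ {m} (p : Fin m → Carrier) n (g : Fin m → ℕ) → (∀ i → g i ℕ.< n) → (w : ℕ → Carrier) →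
      sum {n} (λ v → w (toℕ v) * sum λ i → indicator (g i ℕₚ.≟ toℕ v) * p i) ≈ sum (λ i → w (g i) * p i)
    sum-by-value p n g g<n w = begin
      sum {n} (λ v → w (toℕ v) * sum λ i → indicator (g i ℕₚ.≟ toℕ v) * p i)
        ≈⟨ sum-cong-≋ {n} (λ v → *-distribˡ-sum (w (toℕ v)) (λ i → indicator (g i ℕₚ.≟ toℕ v) * p i)) ⟩
      sum {n} (λ v → sum λ i → w (toℕ v) * (indicator (g i ℕₚ.≟ toℕ v) * p i))
        ≈⟨ ∑-comm {n} (λ v i → w (toℕ v) * (indicator (g i ℕₚ.≟ toℕ v) * p i)) ⟩
      sum (λ i → sum {n} λ v → w (toℕ v) * (indicator (g i ℕₚ.≟ toℕ v) * p i))
        ≈⟨ sum-cong-≋ (λ i → trans (sum-single (fromℕ< (g<n i)) (λ v → w (toℕ v) * (indicator (g i ℕₚ.≟ toℕ v) * p i))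
             λ v v≢ → trans (*-congˡ (trans (*-congʳ (reflexive (indicator-no (g i ℕₚ.≟ toℕ v) λ eq →
               v≢ (Finₚ.toℕ-injective (≡.trans (≡.sym eq) (≡.sym (Finₚ.toℕ-fromℕ< (g<n i)))))))) (zeroˡ (p i)))) (zeroʳ (w (toℕ v))))
             (*-cong (reflexive (≡.cong w (Finₚ.toℕ-fromℕ< (g<n i)))) (trans
               (*-congʳ (reflexive (indicator-yes (g i ℕₚ.≟ toℕ (fromℕ< (g<n i))) (≡.sym (Finₚ.toℕ-fromℕ< (g<n i)))))) (*-identityˡ (p i))))) ⟩
      sum (λ i → w (g i) * p i) ∎

    module _ {n : ℕ} (G : FinGroup n) {e : ℕ} .{{_ : ℕ.NonZero e}} (exp : FinGroup.HasExponent G e) where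
      open FinGroup G using (_∙_; ε; _⁻¹; ^-*; power-recurs; cancel-∙⁻¹; cancel-⁻¹∙) renaming (_^_ to infixr 9 _^ᴳ_)
      open Convolution G using (classFunctionRing; _⋆_)
      open Congruence classFunctionRing using () renaming (_^_ to infixr 8 _^ᶜ_)
      open ClassFunctionPowers G using (value; PowerInvariant)

      unit? : (i : ℕ) → Dec (gcd i e ≡ 1)
      unit? i = gcd i e ℕₚ.≟ 1

      -- Euler's totient of e.
      units : ℤ
      units = ℤΣ.sum {e} λ i → ℤΣ.indicator (unit? (toℕ i))

      units-positive : 1 ℕ.< e → + 0 ℤ.< units
      units-positive 1<e = sum-positive {e} (λ i → ℤΣ.indicator (unit? (toℕ i))) (λ i → nonNegative (unit? (toℕ i)))
        (fromℕ< 1<e) (≡.subst (+ 0 ℤ.<_) (≡.sym (ℤΣ.indicator-yes (unit? (toℕ (fromℕ< 1<e)))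
          (≡.trans (≡.cong (λ i → gcd i e) (Finₚ.toℕ-fromℕ< 1<e)) (coprime⇒gcd≡1 (Coprimality.1-coprimeTo e)))))
          (ℤ.+<+ (ℕ.s≤s ℕ.z≤n)))
        where
        nonNegative : ∀ {p} {P : Set p} (d : Dec P) → + 0 ℤ.≤ ℤΣ.indicator d
        nonNegative (yes _) = ℤ.+≤+ ℕ.z≤n
        nonNegative (no _)  = ℤ.+≤+ ℕ.z≤n

      module _ (χ : Fin n → Carrier) where

        pairing : (Fin n → ℤ) → Carrier
        pairing a = sum λ x → ι (a x) * χ x

        gcdSum : Fin n → ℕ → Carrier
        gcdSum x d = sum {e} λ i → indicator (gcd (toℕ i) e ℕₚ.≟ d) * χ (x ^ᴳ toℕ i)

        module _ (average : ∀ x m → x ^ᴳ m ≡ ε → IsInteger (sum {m} λ i → χ (x ^ᴳ toℕ i))) where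

          -- The exponents divisible by d run through the powers of x^d, whose (e/d)-th power is ε,
          -- so this is one of the averages over a cyclic group.
          multiplesSum-integer : ∀ x d → d ∣ e → IsInteger (sum {e} λ i → indicator (d ∣? toℕ i) * χ (x ^ᴳ toℕ i))
          multiplesSum-integer x d d∣e@(divides k e≡kd) = integer-cong
            (trans (reflexive (≡.cong (λ m → sum {m} λ i → indicator (d ∣? toℕ i) * χ (x ^ᴳ toℕ i)) e≡kd))
              (trans (sum-multiples d {{d≢0}} k (λ i → χ (x ^ᴳ i)))
                (sum-cong-≋ {k} λ i → reflexive (≡.cong χ (≡.sym (^-* x d (toℕ i)))))))
            (average (x ^ᴳ d) k (≡.trans (^-* x d k) (≡.trans (≡.cong (x ^ᴳ_) (≡.sym e≡kd)) (exp x))))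
            where
            d≢0 : ℕ.NonZero d
            d≢0 = ℕ.≢-nonZero λ { ≡.refl → ℕ.≢-nonZero⁻¹ e (0∣⇒≡0 d∣e) }

          -- Integral by descending induction on d: the sum over all multiples i of d
          -- is a sum over the subgroup generated by x ^ d, hence an integer, and it is
          -- the sum of the gcdSums of the multiples of d.

          gcdSum-integer : ∀ x d → Acc ℕ._<_ (e ℕ.∸ d) → d ∣ e → IsInteger (gcdSum x d)
          gcdSum-integer x d (acc rec) d∣e = integer-cong
              (sym (trans (*-cong (reflexive (indicator-yes (d ∣? toℕ d′) (≡.subst (d ∣_) (≡.sym d′≡d) ∣-refl)))
                                  (reflexive (≡.cong (gcdSum x) d′≡d))) (*-identityˡ (gcdSum x d))))
              (integer-summand d′ others (integer-cong total (multiplesSum-integer x d d∣e)))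
            where
            d′ : Fin (suc e)
            d′ = fromℕ< (ℕ.s≤s (∣⇒≤ d∣e))
            d′≡d : toℕ d′ ≡ d
            d′≡d = Finₚ.toℕ-fromℕ< (ℕ.s≤s (∣⇒≤ d∣e))
            total : sum {suc e} (λ v → indicator (d ∣? toℕ v) * gcdSum x (toℕ v)) ≈
                    sum {e} (λ i → indicator (d ∣? toℕ i) * χ (x ^ᴳ toℕ i))
            total = trans
              (sum-by-value {e} (λ i → χ (x ^ᴳ toℕ i)) (suc e) (λ i → gcd (toℕ i) e)
                (λ i → ℕ.s≤s (∣⇒≤ (gcd[m,n]∣n (toℕ i) e))) (λ v → indicator (d ∣? v)))
              (sum-cong-≋ {e} λ i → *-congʳ (reflexive (indicator-⇔ (d ∣? gcd (toℕ i) e) (d ∣? toℕ i)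
                (λ div → ∣-trans div (gcd[m,n]∣m (toℕ i) e)) (λ div → gcd-greatest div d∣e))))
            class-integer : ∀ v → v ≢ d → d ∣ v → Dec (v ∣ e) → IsInteger (gcdSum x v)
            class-integer v v≢d d∣v (no v∤e) = integer-cong
              (sum-zero {e} λ i → trans (*-congʳ (reflexive (indicator-no (gcd (toℕ i) e ℕₚ.≟ v)
                λ eq → v∤e (≡.subst (_∣ e) eq (gcd[m,n]∣n (toℕ i) e))))) (zeroˡ (χ (x ^ᴳ toℕ i))))
              integer-0
            class-integer v v≢d d∣v (yes v∣e) = gcdSum-integer x v (rec (ℕₚ.∸-monoʳ-< d<v (∣⇒≤ v∣e))) v∣e
              where
              d<v : d ℕ.< v
              d<v = ℕₚ.≤∧≢⇒< (∣⇒≤ {{ℕ.≢-nonZero λ { ≡.refl → ℕ.≢-nonZero⁻¹ e (0∣⇒≡0 v∣e) }}} d∣v) (v≢d ∘ ≡.sym)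
            others : ∀ v → v ≢ d′ → IsInteger (indicator (d ∣? toℕ v) * gcdSum x (toℕ v))
            others v v≢d′ with d ∣? toℕ v
            ... | no _    = integer-cong (zeroˡ (gcdSum x (toℕ v))) integer-0
            ... | yes d∣v = integer-cong (*-identityˡ (gcdSum x (toℕ v)))
                  (class-integer (toℕ v) (λ eq → v≢d′ (Finₚ.toℕ-injective (≡.trans eq (≡.sym d′≡d)))) d∣v (toℕ v ∣? e))

          -- For u prime to e the substitution x ↦ x^u replaces χ(x) by χ(x^u) and leaves a(x)
          -- alone. Adding this up over all such u < e collects the integer `gcdSum x 1` as the
          -- factor of a(x).
          units-pairing-integer : 1 ℕ.< e → ∀ a → PowerInvariant exp a → IsInteger (ι units * pairing (value a))
          units-pairing-integer 1<e a inv = integer-cong (begin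
              ι units * pairing (value a)
                ≈⟨ *-congʳ (trans (ι-sum {e} (λ i → ℤΣ.indicator (unit? (toℕ i)))) (sum-cong-≋ {e} λ i → ι-indicator (unit? (toℕ i)))) ⟩
              sum {e} (λ i → indicator (unit? (toℕ i))) * pairing (value a)
                ≈⟨ *-distribʳ-sum {e} (pairing (value a)) (λ i → indicator (unit? (toℕ i))) ⟩
              sum {e} (λ i → indicator (unit? (toℕ i)) * pairing (value a))
                ≈⟨ sum-cong-≋ {e} (λ i → twist (toℕ i) (unit? (toℕ i))) ⟩
              sum {e} (λ i → sum λ x → ι (value a x) * (indicator (unit? (toℕ i)) * χ (x ^ᴳ toℕ i)))
                ≈⟨ ∑-comm {e} (λ i x → ι (value a x) * (indicator (unit? (toℕ i)) * χ (x ^ᴳ toℕ i))) ⟩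
              sum (λ x → sum {e} λ i → ι (value a x) * (indicator (unit? (toℕ i)) * χ (x ^ᴳ toℕ i)))
                ≈⟨ sum-cong-≋ (λ x → *-distribˡ-sum {e} (ι (value a x)) (λ i → indicator (unit? (toℕ i)) * χ (x ^ᴳ toℕ i))) ⟨
              sum (λ x → ι (value a x) * gcdSum x 1) ∎)
            (integer-sum λ x → integer-* (integer-ι (value a x)) (gcdSum-integer x 1 (<-wellFounded _) (divides e (≡.sym (ℕₚ.*-identityʳ e)))))
            where
            twist : ∀ u (d : Dec (gcd u e ≡ 1)) →
                    indicator d * pairing (value a) ≈ sum λ x → ι (value a x) * (indicator d * χ (x ^ᴳ u))
            twist u (no _) = trans (zeroˡ _) (sym (sum-zero λ x → trans (*-congˡ (zeroˡ (χ (x ^ᴳ u)))) (zeroʳ (ι (value a x)))))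
            twist u (yes gcd≡1) = begin
                1# * pairing (value a)  ≈⟨ *-identityˡ _ ⟩
                sum (λ x → ι (value a x) * χ x)  ≈⟨ sum-bijection (λ x → ι (value a x) * χ x) (_^ᴳ u) (_^ᴳ (u ℕ.^ φ)) στ τσ ⟩
                sum (λ x → ι (value a (x ^ᴳ u)) * χ (x ^ᴳ u))  ≈⟨ sum-cong-≋ (λ x → *-cong (reflexive (≡.cong ι (inv u coprime x)))
                                                                         (sym (*-identityˡ (χ (x ^ᴳ u))))) ⟩
                sum (λ x → ι (value a x) * (1# * χ (x ^ᴳ u)))  ∎
              where
              coprime : Coprime u e
              coprime = gcd≡1⇒coprime gcd≡1
              instance
                u≢0 : ℕ.NonZero u
                -- The gcd of 0 and e is e, which exceeds 1.
                u≢0 = ℕ.≢-nonZero λ { ≡.refl → ℕₚ.<-irrefl (≡.sym (Coprimality.0-coprimeTo-m⇒m≡1 coprime)) 1<e }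
              φ : ℕ
              φ = proj₁ (power-recurs exp coprime)
              στ : ∀ x → (x ^ᴳ (u ℕ.^ φ)) ^ᴳ u ≡ x
              στ x = ≡.trans (^-* x (u ℕ.^ φ) u) (proj₂ (power-recurs exp coprime) x)
              τσ : ∀ x → (x ^ᴳ u) ^ᴳ (u ℕ.^ φ) ≡ x
              τσ x = ≡.trans (^-* x u (u ℕ.^ φ)) (≡.trans (≡.cong (x ^ᴳ_) (ℕₚ.*-comm (u ℕ.^ φ) u))
                (proj₂ (power-recurs exp coprime) x))

        -- With g = hk the double sum becomes the sum over k of b(k) times the sum over h of a(h)
        -- χ(hk), where the latter is μ χ(k).
        pairing-⋆ : ∀ {a μ} → (∀ x → sum (λ y → ι (a y) * χ (y ∙ x)) ≈ μ * χ x) → ∀ b → pairing (a ⋆ b) ≈ μ * pairing b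
        pairing-⋆ {a} {μ} eigen b = begin
          sum (λ g → ι ((a ⋆ b) g) * χ g)
            ≈⟨ sum-cong-≋ (λ g → trans (*-congʳ (ι-sum (λ h → a h ℤ.* b (h ⁻¹ ∙ g)))) (*-distribʳ-sum (χ g) (λ h → ι (a h ℤ.* b (h ⁻¹ ∙ g))))) ⟩
          sum (λ g → sum λ h → ι (a h ℤ.* b (h ⁻¹ ∙ g)) * χ g)
            ≈⟨ ∑-comm (λ g h → ι (a h ℤ.* b (h ⁻¹ ∙ g)) * χ g) ⟩
          sum (λ h → sum λ g → ι (a h ℤ.* b (h ⁻¹ ∙ g)) * χ g)
            ≈⟨ sum-cong-≋ (λ h → trans
                 (sum-bijection (λ g → ι (a h ℤ.* b (h ⁻¹ ∙ g)) * χ g) (h ∙_) (h ⁻¹ ∙_) (cancel-∙⁻¹ h) (cancel-⁻¹∙ h))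
                 (sum-cong-≋ λ k → rearrange h k)) ⟩
          sum (λ h → sum λ k → ι (b k) * (ι (a h) * χ (h ∙ k)))
            ≈⟨ ∑-comm (λ h k → ι (b k) * (ι (a h) * χ (h ∙ k))) ⟩
          sum (λ k → sum λ h → ι (b k) * (ι (a h) * χ (h ∙ k)))
            ≈⟨ sum-cong-≋ (λ k → trans (sym (*-distribˡ-sum (ι (b k)) (λ h → ι (a h) * χ (h ∙ k))))
                 (trans (*-congˡ (eigen k)) (x∙yz≈y∙xz (ι (b k)) μ (χ k)))) ⟩
          sum (λ k → μ * (ι (b k) * χ k))
            ≈⟨ *-distribˡ-sum μ (λ k → ι (b k) * χ k) ⟨
          μ * pairing b ∎
          where
          x∙yz≈y∙xz : ∀ x y z → x * (y * z) ≈ y * (x * z)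
          x∙yz≈y∙xz x y z = trans (sym (*-assoc x y z)) (trans (*-congʳ (*-comm x y)) (*-assoc y x z))
          rearrange : ∀ h k → ι (a h ℤ.* b (h ⁻¹ ∙ (h ∙ k))) * χ (h ∙ k) ≈ ι (b k) * (ι (a h) * χ (h ∙ k))
          rearrange h k = trans
            (*-congʳ (trans (ι-* (a h) (b (h ⁻¹ ∙ (h ∙ k)))) (*-congˡ (reflexive (≡.cong (ι ∘ b) (cancel-⁻¹∙ h k))))))
            (trans (*-assoc (ι (a h)) (ι (b k)) (χ (h ∙ k))) (x∙yz≈y∙xz (ι (a h)) (ι (b k)) (χ (h ∙ k))))

        pairing-^ : ∀ {L μ} → (∀ x → sum (λ y → ι (value L y) * χ (y ∙ x)) ≈ μ * χ x) →
                    ∀ k → pairing (value (L ^ᶜ k)) ≈ μ ^ k * χ ε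
        pairing-^ eigen zero = trans
          (sum-single ε (λ x → ι (ℤΣ.indicator (x Finₚ.≟ ε)) * χ x) λ x x≢ε → trans
            (*-congʳ (trans (reflexive (≡.cong ι (ℤΣ.indicator-no (x Finₚ.≟ ε) x≢ε))) ι-0)) (zeroˡ (χ x)))
          (*-congʳ (trans (reflexive (≡.cong ι (ℤΣ.indicator-yes (ε Finₚ.≟ ε) ≡.refl))) ι-1))
        pairing-^ {L} {μ} eigen (suc k) = trans (pairing-⋆ {value L} {μ} eigen (value (L ^ᶜ k)))
          (trans (*-congˡ (pairing-^ {L} eigen k)) (sym (*-assoc μ (μ ^ k) (χ ε))))

      eigenvalue-integer : 1 ℕ.< e → ∀ {L M μ M-left M-right} → (∀ k → PowerInvariant exp (L ^ᶜ k)) →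
                           (∀ x → M ε x ≈ ι (value L x)) →
                           EigenspaceCharacter.Character K G invertible M μ M-left M-right → IsInteger μ
      eigenvalue-integer 1<e {L} {M} {μ} invariant M≈L character =
          -- The factor `degree` is the value χ(ε) that `pairing-^` yields, and `units` is the
          -- factor making the pairing an integer.
          bounded-denominator⇒integer (units ℤ.* + degree) {{nonZero}} μ λ k → integer-cong
            (begin
              ι (units ℤ.* + degree) * μ ^ k  ≈⟨ *-congʳ (ι-* units (+ degree)) ⟩
              ι units * ι (+ degree) * μ ^ k  ≈⟨ *-assoc (ι units) (ι (+ degree)) (μ ^ k) ⟩
              ι units * (ι (+ degree) * μ ^ k)  ≈⟨ *-congˡ (*-comm (ι (+ degree)) (μ ^ k)) ⟩
              ι units * (μ ^ k * ι (+ degree))  ≈⟨ *-congˡ (*-congˡ (trans (ι-degree degree) (sym χ-ε))) ⟩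
              ι units * (μ ^ k * χ ε)  ≈⟨ *-congˡ (pairing-^ χ {L} eigen k) ⟨
              ι units * pairing χ (value (L ^ᶜ k)) ∎)
            (units-pairing-integer χ average 1<e (L ^ᶜ k) (invariant k))
        where
        open EigenspaceCharacter.Character character
        eigen : ∀ x → sum (λ y → ι (value L y) * χ (y ∙ x)) ≈ μ * χ x
        eigen x = trans (sum-cong-≋ λ y → *-congʳ (sym (M≈L y))) (χ-eigen x)
        average : ∀ x m → x ^ᴳ m ≡ ε → IsInteger (sum {m} λ i → χ (x ^ᴳ toℕ i))
        average x m xᵐ≡ε stop = χ-average x m xᵐ≡ε λ (k , eq) → integer-cong eq (integer-× (k ℕ.* m)) stop
        ι-degree : ∀ k → ι (+ k) ≈ k ×ᴷ 1#
        ι-degree zero    = ι-0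
        ι-degree (suc k) = trans (ι-+ (+ 1) (+ k)) (+-cong ι-1 (ι-degree k))
        nonZero : ℕ.NonZero ℤ.∣ units ℤ.* + degree ∣
        nonZero = ℕ.≢-nonZero λ eq → impossible (ℕₚ.m*n≡0⇒m≡0∨n≡0 ℤ.∣ units ∣ (≡.trans (≡.sym (ℤₚ.abs-* units (+ degree))) eq))
          where
          impossible : ℤ.∣ units ∣ ≡ 0 ⊎ degree ≡ 0 → ⊥
          impossible (inj₁ eq) = ℤₚ.<-irrefl (≡.sym (ℤₚ.∣i∣≡0⇒i≡0 eq)) (units-positive 1<e)
          impossible (inj₂ eq) = degree≢0 eq

open IntegralEigenvalues

-- Constructive real and complex numbers

module ComplexNumbers where
  open import Defs using (ℝ; seq; cauchy; _≃_; mk≃; close; ≗⇒≃; ≃-trans; fromℚ; _+ᴿ_; -ᴿ_; _*ᴿ_; 0ᴿ; 1ᴿ; ℂ;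
    re; im; _≈ᶜ_; _,ᶜ_; re≃; im≃; _#ᶜ_; _#ᴿ_; _*ᶜ_; 0ᶜ; 1ᶜ; fromℤ; ℂ-commutativeRing; module V₁; module V₂;
    curried)
  open import Data.Integer.Base as ℤ using (ℤ; +_)
  import Data.Integer.Properties as ℤₚ
  open import Data.Integer.DivMod using (_/ℕ_; [n/ℕd]*d≤n; n<s[n/ℕd]*d)
  open import Data.Nat.Base using (_⊔_)
  open import Data.Nat.Coprimality as Coprimality using ()
  open import Data.Rational.Base as ℚ using (ℚ; mkℚ; 0ℚ; 1ℚ; ½; ∣_∣; ↥_; ↧_; ↧ₙ_; *≤*; *<*)
  import Data.Rational.Properties as ℚₚ
  open import Data.Rational.Solver using (module +-*-Solver)
  open import Relation.Binary.PropositionalEquality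
  open +-*-Solver using (solve; con; _:=_; _:+_; _:*_; _:-_; :-_)

  p≤∣p∣ : ∀ p → p ℚ.≤ ∣ p ∣
  p≤∣p∣ p with 0ℚ ℚₚ.≤? p
  ... | yes 0≤p = ℚₚ.≤-reflexive (sym (ℚₚ.0≤p⇒∣p∣≡p 0≤p))
  ... | no  0≰p = ℚₚ.≤-trans (ℚₚ.<⇒≤ (ℚₚ.≰⇒> 0≰p)) (ℚₚ.0≤∣p∣ p)

  ∣p-q∣≡∣q-p∣ : ∀ p q → ∣ p ℚ.- q ∣ ≡ ∣ q ℚ.- p ∣
  ∣p-q∣≡∣q-p∣ p q = trans (cong ∣_∣ (solve 2 (λ p q → p :- q := :- (q :- p)) refl p q)) (ℚₚ.∣-p∣≡∣p∣ (q ℚ.- p))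

  ∣p-r∣≤∣p-q∣+∣q-r∣ : ∀ p q r → ∣ p ℚ.- r ∣ ℚ.≤ ∣ p ℚ.- q ∣ ℚ.+ ∣ q ℚ.- r ∣
  ∣p-r∣≤∣p-q∣+∣q-r∣ p q r = subst (λ z → ∣ z ∣ ℚ.≤ ∣ p ℚ.- q ∣ ℚ.+ ∣ q ℚ.- r ∣)
    (solve 3 (λ p q r → (p :- q) :+ (q :- r) := p :- r) refl p q r)
    (ℚₚ.∣p+q∣≤∣p∣+∣q∣ (p ℚ.- q) (q ℚ.- r))

  ∣p∣≤∣p-q∣+∣q∣ : ∀ p q → ∣ p ∣ ℚ.≤ ∣ p ℚ.- q ∣ ℚ.+ ∣ q ∣
  ∣p∣≤∣p-q∣+∣q∣ p q = subst (λ z → ∣ z ∣ ℚ.≤ ∣ p ℚ.- q ∣ ℚ.+ ∣ q ∣)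
    (solve 2 (λ p q → (p :- q) :+ q := p) refl p q) (ℚₚ.∣p+q∣≤∣p∣+∣q∣ (p ℚ.- q) q)

  ½*-positive : ∀ {ε} → 0ℚ ℚ.< ε → 0ℚ ℚ.< ½ ℚ.* ε
  ½*-positive {ε} ε>0 = subst (ℚ._< ½ ℚ.* ε) (ℚₚ.*-zeroʳ ½) (ℚₚ.*-monoʳ-<-pos ½ ε>0)

  ½*-< : ∀ {ε} → 0ℚ ℚ.< ε → ½ ℚ.* ε ℚ.< ε
  ½*-< {ε} ε>0 = subst₂ ℚ._<_ (ℚₚ.+-identityʳ (½ ℚ.* ε)) (solve 1 (λ ε → con ½ :* ε :+ con ½ :* ε := ε) refl ε)
    (ℚₚ.+-monoʳ-< (½ ℚ.* ε) (½*-positive ε>0))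

  Vanishing Bounded-away : ℝ → Set
  Vanishing z = ∀ ε → 0ℚ ℚ.< ε → ∃ λ N → ∀ n → N ℕ.≤ n → ∣ seq z n ∣ ℚ.≤ ε
  Bounded-away z = ∃ λ δ → 0ℚ ℚ.< δ × ∃ λ N → ∀ n → N ℕ.≤ n → δ ℚ.≤ ∣ seq z n ∣

  -- A single rational comparison decides: from N on the terms vary by at most ε/4, so comparing the
  -- N-th with ε/2 bounds them all by ε from above or by ε/4 from below.
  dichotomy : ∀ z ε → 0ℚ ℚ.< ε → (∃ λ N → ∀ n → N ℕ.≤ n → ∣ seq z n ∣ ℚ.≤ ε) ⊎ Bounded-away z
  dichotomy z ε ε>0 with cauchy z (½ ℚ.* (½ ℚ.* ε)) (½*-positive (½*-positive ε>0))
  ... | N , near with ∣ seq z N ∣ ℚₚ.≤? ½ ℚ.* ε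
  ...   | yes small = inj₁ (N , λ n N≤n → begin
          ∣ seq z n ∣  ≤⟨ ∣p∣≤∣p-q∣+∣q∣ (seq z n) (seq z N) ⟩
          ∣ seq z n ℚ.- seq z N ∣ ℚ.+ ∣ seq z N ∣ ≤⟨ ℚₚ.+-mono-≤ (near n N N≤n ℕₚ.≤-refl) small ⟩
          ½ ℚ.* (½ ℚ.* ε) ℚ.+ ½ ℚ.* ε  ≤⟨ ℚₚ.+-monoˡ-≤ (½ ℚ.* ε) (ℚₚ.<⇒≤ (½*-< (½*-positive ε>0))) ⟩
          ½ ℚ.* ε ℚ.+ ½ ℚ.* ε  ≡⟨ solve 1 (λ ε → con ½ :* ε :+ con ½ :* ε := ε) refl ε ⟩
          ε                                    ∎)
    where open ℚₚ.≤-Reasoning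
  ...   | no large = inj₂ (¼ε , ½*-positive (½*-positive ε>0) , N , λ n N≤n → begin
          ¼ε  ≡⟨ solve 1 (λ ε → con ½ :* (con ½ :* ε) := (con ½ :* ε) :- con ½ :* (con ½ :* ε)) refl ε ⟩
          ½ ℚ.* ε ℚ.- ¼ε  ≤⟨ ℚₚ.+-monoˡ-≤ (ℚ.- ¼ε) (ℚₚ.<⇒≤ (ℚₚ.≰⇒> large)) ⟩
          ∣ seq z N ∣ ℚ.- ¼ε  ≤⟨ ℚₚ.+-monoˡ-≤ (ℚ.- ¼ε) (∣p∣≤∣p-q∣+∣q∣ (seq z N) (seq z n)) ⟩
          ∣ seq z N ℚ.- seq z n ∣ ℚ.+ ∣ seq z n ∣ ℚ.- ¼ε ≤⟨ ℚₚ.+-monoˡ-≤ (ℚ.- ¼ε) (ℚₚ.+-monoˡ-≤ ∣ seq z n ∣ (near N n ℕₚ.≤-refl N≤n)) ⟩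
          ¼ε ℚ.+ ∣ seq z n ∣ ℚ.- ¼ε  ≡⟨ solve 2 (λ a b → a :+ b :- a := b) refl ¼ε ∣ seq z n ∣ ⟩
          ∣ seq z n ∣                          ∎)
    where
    open ℚₚ.≤-Reasoning
    ¼ε = ½ ℚ.* (½ ℚ.* ε)

  vanishing∧away : ∀ {z} → Vanishing z → ¬ Bounded-away z
  vanishing∧away {z} van (δ , δ>0 , N , away) with van (½ ℚ.* δ) (½*-positive δ>0)
  ... | M , small = ℚₚ.<-irrefl refl (ℚₚ.≤-<-trans
    (ℚₚ.≤-trans (away (N ⊔ M) (ℕₚ.m≤m⊔n N M)) (small (N ⊔ M) (ℕₚ.m≤n⊔m N M))) (½*-< δ>0))

  ¬away⇒vanishing : ∀ {z} → ¬ Bounded-away z → Vanishing z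
  ¬away⇒vanishing {z} ¬away ε ε>0 with dichotomy z ε ε>0
  ... | inj₁ small = small
  ... | inj₂ away  = contradiction away ¬away

  -- By `dichotomy`, vanishing is equivalent to the negation of being bounded away from zero, and
  -- negations are stable.
  vanishing-stable : ∀ {z} → ¬ ¬ Vanishing z → Vanishing z
  vanishing-stable {z} ¬¬van = ¬away⇒vanishing {z} λ away → ¬¬van λ van → vanishing∧away {z} van away

  vanishing-or-away : ∀ z → ¬ ¬ (Vanishing z ⊎ Bounded-away z)
  vanishing-or-away z k = k (inj₁ (¬away⇒vanishing {z} (k ∘ inj₂)))

  ≃⇒vanishing : ∀ {x y} → x ≃ y → Vanishing (x +ᴿ -ᴿ y)
  ≃⇒vanishing p = close p

  vanishing⇒≃ : ∀ {x y} → Vanishing (x +ᴿ -ᴿ y) → x ≃ y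
  vanishing⇒≃ van = mk≃ van

  ≃-stable : ∀ {x y} → ¬ ¬ x ≃ y → x ≃ y
  ≃-stable {x} {y} ¬¬p = vanishing⇒≃ (vanishing-stable {x +ᴿ -ᴿ y} λ k → ¬¬p λ p → k (≃⇒vanishing p))

  vanishing⇒≃0 : ∀ {z} → Vanishing z → z ≃ 0ᴿ
  vanishing⇒≃0 {z} van = mk≃ λ ε ε>0 → proj₁ (van ε ε>0) , λ n N≤n →
    subst (λ q → ∣ q ∣ ℚ.≤ ε) (sym (ℚₚ.+-identityʳ (seq z n))) (proj₂ (van ε ε>0) n N≤n)

  apart⇒≄0 : ∀ {z} → z #ᴿ 0ᴿ → ¬ z ≃ 0ᴿ
  apart⇒≄0 {z} z#0 z≃0 = vanishing∧away {z +ᴿ -ᴿ 0ᴿ} (≃⇒vanishing z≃0) (away z#0)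
    where
    away : z #ᴿ 0ᴿ → Bounded-away (z +ᴿ -ᴿ 0ᴿ)
    away (inj₁ (ε , ε>0 , N , z<0)) = ε , ε>0 , N , λ n N≤n → ℚₚ.≤-trans (z<0 n N≤n)
      (ℚₚ.≤-trans (p≤∣p∣ (0ℚ ℚ.- seq z n)) (ℚₚ.≤-reflexive (∣p-q∣≡∣q-p∣ 0ℚ (seq z n))))
    away (inj₂ (ε , ε>0 , N , 0<z)) = ε , ε>0 , N , λ n N≤n → ℚₚ.≤-trans (0<z n N≤n) (p≤∣p∣ (seq z n ℚ.- 0ℚ))

  #ᶜ⇒≉0 : ∀ {z} → z #ᶜ 0ᶜ → ¬ z ≈ᶜ 0ᶜ
  #ᶜ⇒≉0 {z} (inj₁ p) (q ,ᶜ _) = apart⇒≄0 {re z} p q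
  #ᶜ⇒≉0 {z} (inj₂ p) (_ ,ᶜ q) = apart⇒≄0 {im z} p q

  -- Dropping N terms leaves a sequence that is at least δ everywhere, so that each term can be
  -- inverted and the inverses are bounded by 1/δ. The identity 1/x - 1/y = (1/x)(1/y)(y - x) makes
  -- them a Cauchy sequence.
  module PositiveInverse (s : ℝ) (δ : ℚ) (δ>0 : 0ℚ ℚ.< δ) (N : ℕ) (δ≤s : ∀ n → N ℕ.≤ n → δ ℚ.≤ seq s n) where

    private
      a : ℕ → ℚ
      a n = seq s (N ℕ.+ n)

      δ≤a : ∀ n → δ ℚ.≤ a n
      δ≤a n = δ≤s (N ℕ.+ n) (ℕₚ.m≤m+n N n)

      instance
        δ-positive : ℚ.Positive δ
        δ-positive = ℚ.positive δ>0

        a-positive : ∀ {n} → ℚ.Positive (a n)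
        a-positive {n} = ℚ.positive (ℚₚ.<-≤-trans δ>0 (δ≤a n))

      a⁻¹ : ℕ → ℚ
      a⁻¹ n = (ℚ.1/ a n) {{ℚₚ.pos⇒nonZero (a n)}}

      aa⁻¹≡1 : ∀ n → a n ℚ.* a⁻¹ n ≡ 1ℚ
      aa⁻¹≡1 n = ℚₚ.*-inverseʳ (a n) {{ℚₚ.pos⇒nonZero (a n)}}

      a⁻¹-positive : ∀ n → ℚ.Positive (a⁻¹ n)
      a⁻¹-positive n = ℚₚ.1/pos⇒pos (a n)

      K : ℚ
      K = (ℚ.1/ δ) {{ℚₚ.pos⇒nonZero δ}}

      a⁻¹≤K : ∀ n → a⁻¹ n ℚ.≤ K
      a⁻¹≤K n = begin
        a⁻¹ n  ≡⟨ trans (cong (a⁻¹ n ℚ.*_) (ℚₚ.*-inverseʳ δ {{ℚₚ.pos⇒nonZero δ}})) (ℚₚ.*-identityʳ (a⁻¹ n)) ⟨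
        a⁻¹ n ℚ.* (δ ℚ.* K)  ≡⟨ solve 3 (λ x y z → x :* (y :* z) := x :* z :* y) refl (a⁻¹ n) δ K ⟩
        a⁻¹ n ℚ.* K ℚ.* δ  ≤⟨ ℚₚ.*-monoˡ-≤-nonNeg (a⁻¹ n ℚ.* K) {{product-nonNegative}} (δ≤a n) ⟩
        a⁻¹ n ℚ.* K ℚ.* a n  ≡⟨ solve 3 (λ x y z → x :* y :* z := y :* (z :* x)) refl (a⁻¹ n) K (a n) ⟩
        K ℚ.* (a n ℚ.* a⁻¹ n)  ≡⟨ trans (cong (K ℚ.*_) (aa⁻¹≡1 n)) (ℚₚ.*-identityʳ K) ⟩
        K                          ∎
        where
        open ℚₚ.≤-Reasoning
        product-nonNegative : ℚ.NonNegative (a⁻¹ n ℚ.* K)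
        product-nonNegative = ℚₚ.pos⇒nonNeg (a⁻¹ n ℚ.* K)
          {{ℚₚ.pos*pos⇒pos (a⁻¹ n) {{a⁻¹-positive n}} K {{ℚₚ.1/pos⇒pos δ}}}}

      a⁻¹-bounded : V₂.Bounded (λ p → a⁻¹ (proj₁ p) ℚ.* a⁻¹ (proj₂ p))
      a⁻¹-bounded = K ℚ.* K , ℚₚ.positive⁻¹ (K ℚ.* K) {{ℚₚ.pos*pos⇒pos K {{K-positive}} K {{K-positive}}}} , 0 , λ (m , n) _ → begin
        ∣ a⁻¹ m ℚ.* a⁻¹ n ∣  ≡⟨ ℚₚ.0≤p⇒∣p∣≡p (ℚₚ.<⇒≤ (ℚₚ.positive⁻¹ (a⁻¹ m ℚ.* a⁻¹ n)
                                        {{ℚₚ.pos*pos⇒pos (a⁻¹ m) {{a⁻¹-positive m}} (a⁻¹ n) {{a⁻¹-positive n}}}})) ⟩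
        a⁻¹ m ℚ.* a⁻¹ n  ≤⟨ ℚₚ.*-monoˡ-≤-nonNeg (a⁻¹ m) {{ℚₚ.pos⇒nonNeg (a⁻¹ m) {{a⁻¹-positive m}}}} (a⁻¹≤K n) ⟩
        a⁻¹ m ℚ.* K  ≤⟨ ℚₚ.*-monoʳ-≤-nonNeg K {{ℚₚ.pos⇒nonNeg K {{K-positive}}}} (a⁻¹≤K m) ⟩
        K ℚ.* K                    ∎
        where
        open ℚₚ.≤-Reasoning
        K-positive : ℚ.Positive K
        K-positive = ℚₚ.1/pos⇒pos δ

      shift-cauchy : V₂.Vanishes (λ p → a (proj₂ p) ℚ.- a (proj₁ p))
      shift-cauchy ε ε>0 with cauchy s ε ε>0
      ... | M , near = M , λ (m , n) M≤ → near (N ℕ.+ n) (N ℕ.+ m)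
        (ℕₚ.≤-trans (ℕₚ.≤-trans M≤ (ℕₚ.m⊓n≤n m n)) (ℕₚ.m≤n+m n N))
        (ℕₚ.≤-trans (ℕₚ.≤-trans M≤ (ℕₚ.m⊓n≤m m n)) (ℕₚ.m≤n+m m N))

      difference : ∀ p → a⁻¹ (proj₁ p) ℚ.* a⁻¹ (proj₂ p) ℚ.* (a (proj₂ p) ℚ.- a (proj₁ p)) ≡ a⁻¹ (proj₁ p) ℚ.- a⁻¹ (proj₂ p)
      difference (m , n) = begin
        a⁻¹ m ℚ.* a⁻¹ n ℚ.* (a n ℚ.- a m)
          ≡⟨ solve 4 (λ s t x y → s :* t :* (y :- x) := s :* (y :* t) :- t :* (x :* s)) refl (a⁻¹ m) (a⁻¹ n) (a m) (a n) ⟩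
        a⁻¹ m ℚ.* (a n ℚ.* a⁻¹ n) ℚ.- a⁻¹ n ℚ.* (a m ℚ.* a⁻¹ m)
          ≡⟨ cong₂ (λ x y → a⁻¹ m ℚ.* x ℚ.- a⁻¹ n ℚ.* y) (aa⁻¹≡1 n) (aa⁻¹≡1 m) ⟩
        a⁻¹ m ℚ.* 1ℚ ℚ.- a⁻¹ n ℚ.* 1ℚ
          ≡⟨ cong₂ ℚ._-_ (ℚₚ.*-identityʳ (a⁻¹ m)) (ℚₚ.*-identityʳ (a⁻¹ n)) ⟩
        a⁻¹ m ℚ.- a⁻¹ n ∎
        where open ≡-Reasoning

    inverse : ℝ
    seq inverse = a⁻¹
    cauchy inverse = curried a⁻¹ (V₂.vanishes-cong difference (V₂.vanishes-* a⁻¹-bounded shift-cauchy))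

    inverseʳ : s *ᴿ inverse ≃ 1ᴿ
    inverseʳ = mk≃ (V₁.vanishes-cong pointwise (V₁.vanishes-* bounded⁻¹ near))
      where
      bounded⁻¹ : V₁.Bounded a⁻¹
      bounded⁻¹ = K , ℚₚ.positive⁻¹ K {{ℚₚ.1/pos⇒pos δ}} , 0 , λ n _ → ℚₚ.≤-trans
        (ℚₚ.≤-reflexive (ℚₚ.0≤p⇒∣p∣≡p (ℚₚ.<⇒≤ (ℚₚ.positive⁻¹ (a⁻¹ n) {{a⁻¹-positive n}})))) (a⁻¹≤K n)
      near : V₁.Vanishes (λ n → seq s n ℚ.- a n)
      near ε ε>0 with cauchy s ε ε>0
      ... | M , close = M , λ n M≤n → close n (N ℕ.+ n) M≤n (ℕₚ.≤-trans M≤n (ℕₚ.m≤n+m n N))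
      -- The inverse belongs to the shifted sequence, so the product with s is off by the inverse
      -- times s(n) - s(N + n), which tends to zero.
      pointwise : ∀ n → a⁻¹ n ℚ.* (seq s n ℚ.- a n) ≡ seq s n ℚ.* a⁻¹ n ℚ.- 1ℚ
      pointwise n = trans (solve 3 (λ t x y → t :* (x :- y) := x :* t :- y :* t) refl (a⁻¹ n) (seq s n) (a n))
        (cong (λ y → seq s n ℚ.* a⁻¹ n ℚ.- y) (aa⁻¹≡1 n))

  private
    module ℂᴿ = CommutativeRing ℂ-commutativeRing

  away⇒square-≥ : ∀ x y (away : Bounded-away x) → ∃ λ δ → 0ℚ ℚ.< δ × ∃ λ N → ∀ n → N ℕ.≤ n →
                  δ ℚ.≤ seq (x *ᴿ x +ᴿ y *ᴿ y) n
  away⇒square-≥ x y (ε , ε>0 , N , ε≤) = ε ℚ.* ε , ℚₚ.positive⁻¹ (ε ℚ.* ε) {{ℚₚ.pos*pos⇒pos ε ε}} , N , λ n N≤n → begin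
      ε ℚ.* ε  ≤⟨ ℚₚ.*-monoˡ-≤-nonNeg ε {{ℚₚ.pos⇒nonNeg ε}} (ε≤ n N≤n) ⟩
      ε ℚ.* ∣ seq x n ∣  ≤⟨ ℚₚ.*-monoʳ-≤-nonNeg ∣ seq x n ∣ {{ℚₚ.∣-∣-nonNeg (seq x n)}} (ε≤ n N≤n) ⟩
      ∣ seq x n ∣ ℚ.* ∣ seq x n ∣  ≡⟨ ∣p∣*∣p∣≡p*p (seq x n) ⟩
      seq x n ℚ.* seq x n  ≡⟨ ℚₚ.+-identityʳ _ ⟨
      seq x n ℚ.* seq x n ℚ.+ 0ℚ  ≤⟨ ℚₚ.+-monoʳ-≤ (seq x n ℚ.* seq x n) (0≤p*p (seq y n)) ⟩
      seq x n ℚ.* seq x n ℚ.+ seq y n ℚ.* seq y n          ∎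
    where
    open ℚₚ.≤-Reasoning
    instance
      ε-positive : ℚ.Positive ε
      ε-positive = ℚ.positive ε>0
    ∣p∣*∣p∣≡p*p : ∀ p → ∣ p ∣ ℚ.* ∣ p ∣ ≡ p ℚ.* p
    ∣p∣*∣p∣≡p*p p with ℚₚ.∣p∣≡p∨∣p∣≡-p p
    ... | inj₁ eq = cong₂ ℚ._*_ eq eq
    ... | inj₂ eq = trans (cong₂ ℚ._*_ eq eq) (solve 1 (λ p → (:- p) :* (:- p) := p :* p) refl p)
    0≤p*p : ∀ p → 0ℚ ℚ.≤ p ℚ.* p
    0≤p*p p = subst₂ ℚ._≤_ (ℚₚ.*-zeroʳ ∣ p ∣) (∣p∣*∣p∣≡p*p p)
      (ℚₚ.*-monoˡ-≤-nonNeg ∣ p ∣ {{ℚₚ.∣-∣-nonNeg p}} (ℚₚ.0≤∣p∣ p))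

  -- The square of the modulus; z is inverted as its conjugate divided by this.
  norm : ℂ → ℝ
  norm z = re z *ᴿ re z +ᴿ im z *ᴿ im z

  norm-inverse : ∀ z t → norm z *ᴿ t ≃ 1ᴿ → ∃ λ w → w *ᶜ z ≈ᶜ 1ᶜ
  norm-inverse z t eq = w
    , (≃-trans (≗⇒≃ λ n → solve 3 (λ a b t → (a :* t) :* a :+ :- ((:- (b :* t)) :* b) := (a :* a :+ b :* b) :* t) refl
        (seq (re z) n) (seq (im z) n) (seq t n)) eq)
    ,ᶜ ≗⇒≃ λ n → solve 3 (λ a b t → (a :* t) :* b :+ (:- (b :* t)) :* a := con 0ℚ) refl
        (seq (re z) n) (seq (im z) n) (seq t n)
    where
    w : ℂ
    re w = re z *ᴿ t
    im w = -ᴿ (im z *ᴿ t)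

  zero-or-invertible : ∀ z → ¬ ¬ (z ≈ᶜ 0ᶜ ⊎ ∃ λ w → w *ᶜ z ≈ᶜ 1ᶜ)
  zero-or-invertible z k = vanishing-or-away (re z) λ where
      (inj₂ away) → k (inj₂ (fromBound (away⇒square-≥ (re z) (im z) away)))
      (inj₁ re≃0) → vanishing-or-away (im z) λ where
        (inj₂ away) → k (inj₂ (fromBound (swap (away⇒square-≥ (im z) (re z) away))))
        (inj₁ im≃0) → k (inj₁ (vanishing⇒≃0 re≃0 ,ᶜ vanishing⇒≃0 im≃0))
    where
    EventuallyPositive : ℝ → Set
    EventuallyPositive s = ∃ λ δ → 0ℚ ℚ.< δ × ∃ λ N → ∀ n → N ℕ.≤ n → δ ℚ.≤ seq s n
    fromBound : EventuallyPositive (norm z) → ∃ λ w → w *ᶜ z ≈ᶜ 1ᶜ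
    fromBound (δ , δ>0 , N , δ≤) = norm-inverse z (PositiveInverse.inverse (norm z) δ δ>0 N δ≤)
      (PositiveInverse.inverseʳ (norm z) δ δ>0 N δ≤)
    swap : EventuallyPositive (im z *ᴿ im z +ᴿ re z *ᴿ re z) → EventuallyPositive (norm z)
    swap (δ , δ>0 , N , δ≤) = δ , δ>0 , N , λ n N≤n → ℚₚ.≤-trans (δ≤ n N≤n)
      (ℚₚ.≤-reflexive (ℚₚ.+-comm (seq (im z) n ℚ.* seq (im z) n) (seq (re z) n ℚ.* seq (re z) n)))

  -- The integer in lowest terms from the outset: unlike `k ℚ./ 1`, it has a numerator and
  -- denominator that compute for a variable k.
  int : ℤ → ℚ
  int k = mkℚ k 0 (Coprimality.sym (Coprimality.1-coprimeTo ℤ.∣ k ∣))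

  /1≡int : ∀ k → k ℚ./ 1 ≡ int k
  /1≡int k = ℚₚ.↥p/↧p≡p (int k)

  int-+ : ∀ i j → int (i ℤ.+ j) ≡ int i ℚ.+ int j
  int-+ i j = trans (sym (/1≡int (i ℤ.+ j)))
    (cong (ℚ._/ 1) (sym (cong₂ ℤ._+_ (ℤₚ.*-identityʳ i) (ℤₚ.*-identityʳ j))))

  int-* : ∀ i j → int (i ℤ.* j) ≡ int i ℚ.* int j
  int-* i j = sym (/1≡int (i ℤ.* j))

  int-neg : ∀ i → int (ℤ.- i) ≡ ℚ.- int i
  int-neg (+ 0)         = refl
  int-neg (+ ℕ.suc _)   = refl
  int-neg ℤ.-[1+ _ ]    = refl

  int-cancel-< : ∀ {i j} → int i ℚ.< int j → i ℤ.< j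
  int-cancel-< {i} {j} (*<* lt) = subst₂ ℤ._<_ (ℤₚ.*-identityʳ i) (ℤₚ.*-identityʳ j) lt

  via-int : ∀ {i p} → int i ≡ p → ∀ {x : ℝ} → (∀ n → seq x n ≡ p) → fromℚ (i ℚ./ 1) ≃ x
  via-int {i} eq seq≡ = ≗⇒≃ λ n → trans (/1≡int i) (trans eq (sym (seq≡ n)))

  fromℤ-+ : ∀ i j → fromℤ (i ℤ.+ j) ≈ᶜ fromℤ i ℂᴿ.+ fromℤ j
  fromℤ-+ i j = via-int (int-+ i j) (λ _ → cong₂ ℚ._+_ (/1≡int i) (/1≡int j)) ,ᶜ ≗⇒≃ λ _ → refl

  fromℤ-* : ∀ i j → fromℤ (i ℤ.* j) ≈ᶜ fromℤ i ℂᴿ.* fromℤ j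
  fromℤ-* i j = via-int (int-* i j) (λ _ → trans
        (cong₂ (λ p q → p ℚ.* q ℚ.+ ℚ.- (0ℚ ℚ.* 0ℚ)) (/1≡int i) (/1≡int j)) (ℚₚ.+-identityʳ (int i ℚ.* int j)))
    ,ᶜ ≗⇒≃ λ _ → solve 2 (λ p q → con 0ℚ := p :* con 0ℚ :+ con 0ℚ :* q) refl (i ℚ./ 1) (j ℚ./ 1)

  fromℤ-neg : ∀ i → fromℤ (ℤ.- i) ≈ᶜ ℂᴿ.- fromℤ i
  fromℤ-neg i = via-int (int-neg i) (λ _ → cong ℚ.-_ (/1≡int i)) ,ᶜ ≗⇒≃ λ _ → refl

  fromℤ-0 : fromℤ (+ 0) ≈ᶜ 0ᶜ
  fromℤ-0 = ≗⇒≃ (λ _ → refl) ,ᶜ ≗⇒≃ (λ _ → refl)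

  fromℤ-1 : fromℤ (+ 1) ≈ᶜ 1ᶜ
  fromℤ-1 = ≗⇒≃ (λ _ → refl) ,ᶜ ≗⇒≃ (λ _ → refl)

  ⅓ ⅙ : ℚ
  ⅓ = + 1 ℚ./ 3
  ⅙ = + 1 ℚ./ 6

  -- The floor of q + ½, a nearest integer to q.
  rounded : ℚ → ℤ
  rounded q = ↥ (q ℚ.+ ½) /ℕ ↧ₙ (q ℚ.+ ½)

  floor-≤ : ∀ p → int (↥ p /ℕ ↧ₙ p) ℚ.≤ p
  floor-≤ p@record{} = *≤* (subst ((↥ p /ℕ ↧ₙ p) ℤ.* ↧ p ℤ.≤_) (sym (ℤₚ.*-identityʳ (↥ p))) ([n/ℕd]*d≤n (↥ p) (↧ₙ p)))

  <-suc-floor : ∀ p → p ℚ.< int (ℤ.suc (↥ p /ℕ ↧ₙ p))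
  <-suc-floor p@record{} = *<* (subst (ℤ._< ℤ.suc (↥ p /ℕ ↧ₙ p) ℤ.* ↧ p) (sym (ℤₚ.*-identityʳ (↥ p))) (n<s[n/ℕd]*d (↥ p) (↧ₙ p)))

  ≤-from-difference : ∀ p q {ε} → ∣ p ℚ.- q ∣ ℚ.≤ ε → p ℚ.≤ q ℚ.+ ε
  ≤-from-difference p q le = subst (ℚ._≤ q ℚ.+ _) (solve 2 (λ p q → q :+ (p :- q) := p) refl p q)
    (ℚₚ.+-monoʳ-≤ q (ℚₚ.≤-trans (p≤∣p∣ (p ℚ.- q)) le))

  -- From ⅓ + ½ < 1 and ⅓ < ½ it follows that k is the floor of q + ½.
  rounded-unique : ∀ q k → ∣ q ℚ.- int k ∣ ℚ.≤ ⅓ → rounded q ≡ k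
  rounded-unique q k near = ℤₚ.≤-antisym
      (suc-cancel-≤ (int-cancel-< (ℚₚ.≤-<-trans (floor-≤ (q ℚ.+ ½)) (begin-strict
        q ℚ.+ ½  ≤⟨ ℚₚ.+-monoˡ-≤ ½ (≤-from-difference q (int k) near) ⟩
        int k ℚ.+ ⅓ ℚ.+ ½        ≡⟨ ℚₚ.+-assoc (int k) ⅓ ½ ⟩
        int k ℚ.+ (⅓ ℚ.+ ½)  <⟨ ℚₚ.+-monoʳ-< (int k) {⅓ ℚ.+ ½} {1ℚ} (*<* (ℤ.+<+ (ℕ.s≤s (ℕ.s≤s (ℕ.s≤s (ℕ.s≤s (ℕ.s≤s (ℕ.s≤s ℕ.z≤n)))))))) ⟩
        int k ℚ.+ 1ℚ             ≡⟨ ℚₚ.+-comm (int k) 1ℚ ⟩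
        int (+ 1) ℚ.+ int k      ≡⟨ int-+ (+ 1) k ⟨
        int (ℤ.suc k)            ∎))))
      (suc-cancel-≤ (int-cancel-< (begin-strict
        int k  ≤⟨ ≤-from-difference (int k) q (subst (ℚ._≤ ⅓) (∣p-q∣≡∣q-p∣ q (int k)) near) ⟩
        q ℚ.+ ⅓  <⟨ ℚₚ.+-monoʳ-< q {⅓} {½} (*<* (ℤ.+<+ (ℕ.s≤s (ℕ.s≤s (ℕ.s≤s ℕ.z≤n))))) ⟩
        q ℚ.+ ½                      <⟨ <-suc-floor (q ℚ.+ ½) ⟩
        int (ℤ.suc (rounded q))      ∎)))
    where
    open ℚₚ.≤-Reasoning
    suc-cancel-≤ : ∀ {i j} → i ℤ.< ℤ.suc j → i ℤ.≤ j
    suc-cancel-≤ {i} {j} lt = subst (i ℤ.≤_) (ℤₚ.pred-suc j) (ℤₚ.i<j⇒i≤pred[j] lt)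

  -- The candidate is read off one term of the real part, within ⅙ of all later ones; another ⅙
  -- reaches any integer equal to z, and ⅓ determines it by rounding. The double negation is then
  -- needed only for the equation with this candidate, which is stable.
  integer-decided : ∀ z → ¬ ¬ (∃ λ k → z ≈ᶜ fromℤ k) → ∃ λ k → z ≈ᶜ fromℤ k
  integer-decided z ¬¬int = k₀ , (≃-stable (λ ¬p → ¬¬int λ where (k , eq) → ¬p (re≃ (≈k₀ k eq)))
                              ,ᶜ ≃-stable (λ ¬p → ¬¬int λ where (k , eq) → ¬p (im≃ (≈k₀ k eq))))
    where
    ⅙>0 : 0ℚ ℚ.< ⅙
    ⅙>0 = ℚₚ.positive⁻¹ ⅙
    N : ℕ
    N = proj₁ (cauchy (re z) ⅙ ⅙>0)
    q : ℚ
    q = seq (re z) N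
    k₀ : ℤ
    k₀ = rounded q
    k≡k₀ : ∀ k → z ≈ᶜ fromℤ k → k₀ ≡ k
    k≡k₀ k eq with close (re≃ eq) ⅙ ⅙>0
    ... | M , near = rounded-unique q k (subst (λ p → ∣ q ℚ.- p ∣ ℚ.≤ ⅓) (/1≡int k) (ℚₚ.≤-trans
          (∣p-r∣≤∣p-q∣+∣q-r∣ q (seq (re z) (N ⊔ M)) (k ℚ./ 1))
          (ℚₚ.+-mono-≤ (proj₂ (cauchy (re z) ⅙ ⅙>0) N (N ⊔ M) ℕₚ.≤-refl (ℕₚ.m≤m⊔n N M)) (near (N ⊔ M) (ℕₚ.m≤n⊔m N M)))))
    ≈k₀ : ∀ k → z ≈ᶜ fromℤ k → z ≈ᶜ fromℤ k₀
    ≈k₀ k eq = subst (λ i → z ≈ᶜ fromℤ i) (sym (k≡k₀ k eq)) eq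

  fromℤ-injective : ∀ {i j} → fromℤ i ≈ᶜ fromℤ j → i ≡ j
  fromℤ-injective {i} {j} eq with close (re≃ eq) ⅓ (ℚₚ.positive⁻¹ ⅓)
  ... | N , near = trans (sym (rounded-unique (int i) i (subst (λ z → ∣ z ∣ ℚ.≤ ⅓) (sym (ℚₚ.+-inverseʳ (int i))) (ℚₚ.<⇒≤ (ℚₚ.positive⁻¹ ⅓)))))
      (rounded-unique (int i) j (subst₂ (λ p q → ∣ p ℚ.- q ∣ ℚ.≤ ⅓) (/1≡int i) (/1≡int j) (near N ℕₚ.≤-refl)))

open ComplexNumbers

-- Cayley graphs of finite subgroups and reflections

module ReflectionGroups where
  open import Defs using (ℂ; ℂ-ring; ℂ-commutativeRing; 1ᶜ; fromℤ; DistanceIntegral; IsSubgroup; Finite;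
    CayleyGraph; HasDimension; Automorphism; GL; Eigenspace; ComplexReflectionGroup; linComb)
  import Algebra.Properties.Monoid.Mult as Mult
  open import Algebra.Module.Bundles using (LeftModule)
  open import Data.Integer.Base using (+_)
  open import Data.Nat.Coprimality using (Coprime)
  open import Relation.Binary.Construct.Closure.Symmetric using (fwd; bwd)
  open import Relation.Binary.PropositionalEquality as ≡ using (_≡_)
  open import Relation.Unary using (Pred; U; _⊆_)

  -- The group law is carried over to positions in the enumeration. These have decidable equality
  -- even where that of `𝒢` is not decidable, and they are the vertices of the Cayley graph.
  module IndexGroup {c ℓ h : Level} (𝒢 : Group c ℓ) {H : Pred (Group.Carrier 𝒢) h}
    (subgroup : IsSubgroup 𝒢 H) (finite : Finite 𝒢 H) where
    open Group 𝒢
    open Mult monoid using (×-congʳ) renaming (_×_ to _×ᴳ_)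
    open IsSubgroup subgroup
    open Finite finite

    private
      index : ∀ {x} → H x → Fin order
      index = proj₁ ∘ complete

      _∙ⁱ_ : Fin order → Fin order → Fin order
      i ∙ⁱ j = index (∙-closed (elem∈ i) (elem∈ j))

      εⁱ : Fin order
      εⁱ = index ε-closed

      _⁻¹ⁱ : Fin order → Fin order
      i ⁻¹ⁱ = index (⁻¹-closed (elem∈ i))

    elem-∙ : ∀ i j → elem (i ∙ⁱ j) ≈ elem i ∙ elem j
    elem-∙ i j = proj₂ (complete (∙-closed (elem∈ i) (elem∈ j)))

    elem-ε : elem εⁱ ≈ ε
    elem-ε = proj₂ (complete ε-closed)

    elem-⁻¹ : ∀ i → elem (i ⁻¹ⁱ) ≈ elem i ⁻¹
    elem-⁻¹ i = proj₂ (complete (⁻¹-closed (elem∈ i)))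

    indexGroup : FinGroup order
    indexGroup = record
      { _∙_ = _∙ⁱ_ ; ε = εⁱ ; _⁻¹ = _⁻¹ⁱ
      ; isGroup = record
        { isMonoid = record
          { isSemigroup = record
            { isMagma = record { isEquivalence = ≡.isEquivalence ; ∙-cong = ≡.cong₂ _∙ⁱ_ }
            ; assoc = λ i j k → distinct (trans (elem-∙ (i ∙ⁱ j) k) (trans (∙-congʳ (elem-∙ i j))
                (trans (assoc (elem i) (elem j) (elem k)) (sym (trans (elem-∙ i (j ∙ⁱ k)) (∙-congˡ (elem-∙ j k)))))))
            }
          ; identity = (λ i → distinct (trans (elem-∙ εⁱ i) (trans (∙-congʳ elem-ε) (identityˡ (elem i)))))
                     , (λ i → distinct (trans (elem-∙ i εⁱ) (trans (∙-congˡ elem-ε) (identityʳ (elem i)))))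
          }
        ; inverse = (λ i → distinct (trans (elem-∙ (i ⁻¹ⁱ) i) (trans (∙-congʳ (elem-⁻¹ i)) (trans (inverseˡ (elem i)) (sym elem-ε)))))
                  , (λ i → distinct (trans (elem-∙ i (i ⁻¹ⁱ)) (trans (∙-congˡ (elem-⁻¹ i)) (trans (inverseʳ (elem i)) (sym elem-ε)))))
        ; ⁻¹-cong = ≡.cong _⁻¹ⁱ
        }
      }

    open FinGroup indexGroup public using () renaming (_^_ to infixr 9 _^ⁱ_)
    private module I = FinGroup indexGroup

    elem-^ : ∀ i k → elem (i ^ⁱ k) ≈ k ×ᴳ elem i
    elem-^ i zero    = elem-ε
    elem-^ i (suc k) = trans (elem-∙ i (i ^ⁱ k)) (∙-congˡ (elem-^ i k))

    elem-conjugate : ∀ i j → elem (I.conjugate i j) ≈ elem i ∙ elem j ∙ elem i ⁻¹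
    elem-conjugate i j = trans (elem-∙ (i ∙ⁱ j) (i ⁻¹ⁱ)) (∙-cong (elem-∙ i j) (elem-⁻¹ i))

    elem-quotient : ∀ {t} i j → elem j ≈ t ∙ elem i → t ≈ elem (j ∙ⁱ (i ⁻¹ⁱ))
    elem-quotient {t} i j eq = begin
      t                        ≈⟨ identityʳ t ⟨
      t ∙ ε                    ≈⟨ ∙-congˡ (inverseʳ (elem i)) ⟨
      t ∙ (elem i ∙ elem i ⁻¹) ≈⟨ assoc t (elem i) (elem i ⁻¹) ⟨
      t ∙ elem i ∙ elem i ⁻¹   ≈⟨ ∙-cong eq (elem-⁻¹ i) ⟨
      elem j ∙ elem (i ⁻¹ⁱ)    ≈⟨ elem-∙ j (i ⁻¹ⁱ) ⟨
      elem (j ∙ⁱ (i ⁻¹ⁱ))      ∎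
      where open import Relation.Binary.Reasoning.Setoid setoid

    private
      e : ℕ
      e = 2 ℕ.* (order ℕ.!)
      instance
        e≢0 : ℕ.NonZero e
        e≢0 = ℕₚ.m*n≢0 2 (order ℕ.!) {{ℕ.nonZero}} {{order ℕₚ.!≢0}}

    -- Supplies the finite order demanded of a reflection, from the common exponent of the group.
    finite-order : ∀ {x} → H x → ∃ λ k → suc k ×ᴳ x ≈ ε
    finite-order {x} Hx = ℕ.pred e , (begin
        suc (ℕ.pred e) ×ᴳ x  ≡⟨ ≡.cong (_×ᴳ x) (ℕₚ.suc-pred e) ⟩
        e ×ᴳ x               ≈⟨ ×-congʳ e (proj₂ (complete Hx)) ⟨
        e ×ᴳ elem i          ≈⟨ elem-^ i e ⟨
        elem (i ^ⁱ e)  ≡⟨ ≡.cong elem (I.factorial-exponent i) ⟩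
        elem εⁱ              ≈⟨ elem-ε ⟩
        ε                    ∎)
      where
      open import Relation.Binary.Reasoning.Setoid setoid
      i : Fin order
      i = index Hx

    -- `T-power` asks for a v with x^(uv) = x in place of coprimality: x and x^u are then powers of
    -- each other, which is what comparing fixed spaces requires.
    module _ {t : Level} (T : Pred Carrier t)
      (T-resp : ∀ {x y} → x ≈ y → T x → T y)
      (T-⁻¹ : ∀ {x} → T x → T (x ⁻¹))
      (T-conjugate : ∀ {x y} → H x → T y → T (x ∙ y ∙ x ⁻¹))
      (T-power : ∀ u → .{{_ : ℕ.NonZero u}} → ∀ v {x} → H x → v ×ᴳ (u ×ᴳ x) ≈ x → T x → T (u ×ᴳ x)) where

      private
        1<e : 1 ℕ.< e
        1<e = ℕₚ.*-monoʳ-≤ 2 (ℕ.>-nonZero⁻¹ (order ℕ.!) {{order ℕₚ.!≢0}})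
        exponent : I.HasExponent e
        exponent = I.factorial-exponent

        Adj = CayleyGraph 𝒢 finite T

        -- Adjacency of i and j amounts to j i⁻¹ lying in T; closure under inversion absorbs the
        -- symmetric closure.
        adjacent⇒ : ∀ {i j} → Adj i j → T (elem (j ∙ⁱ (i ⁻¹ⁱ)))
        adjacent⇒ {i} {j} (fwd (t , Tt , eq)) = T-resp (elem-quotient i j eq) Tt
        adjacent⇒ {i} {j} (bwd (t , Tt , eq)) = T-resp (trans (⁻¹-cong (elem-quotient j i eq)) (trans (sym (elem-⁻¹ (i ∙ⁱ (j ⁻¹ⁱ))))
          (reflexive (≡.cong elem (≡.trans (I.⁻¹-anti-homo-∙ i (j ⁻¹ⁱ)) (≡.cong (_∙ⁱ (i ⁻¹ⁱ)) (I.⁻¹-involutive j))))))) (T-⁻¹ Tt)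

        ⇒adjacent : ∀ {i j} → T (elem (j ∙ⁱ (i ⁻¹ⁱ))) → Adj i j
        ⇒adjacent {i} {j} T-quotient = fwd (elem (j ∙ⁱ (i ⁻¹ⁱ)) , T-quotient ,
          trans (reflexive (≡.cong elem (≡.sym (I.cancelʳ-⁻¹∙ i j)))) (elem-∙ (j ∙ⁱ (i ⁻¹ⁱ)) i))

        -- Multiplying both ends by x on the left conjugates the quotient j i⁻¹ by x, whereas
        -- multiplying on the right leaves it unchanged.
        left-invariant : ∀ x {i j} → Adj i j → Adj (x ∙ⁱ i) (x ∙ⁱ j)
        left-invariant x {i} {j} adj = ⇒adjacent (T-resp
          (trans (sym (elem-conjugate x (j ∙ⁱ (i ⁻¹ⁱ)))) (reflexive (≡.cong elem quotient)))
          (T-conjugate (elem∈ x) (adjacent⇒ adj)))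
          where
          quotient : I.conjugate x (j ∙ⁱ (i ⁻¹ⁱ)) ≡ (x ∙ⁱ j) ∙ⁱ ((x ∙ⁱ i) ⁻¹ⁱ)
          quotient = ≡.trans (≡.cong (_∙ⁱ (x ⁻¹ⁱ)) (≡.sym (I.assoc x j (i ⁻¹ⁱ))))
            (≡.trans (I.assoc (x ∙ⁱ j) (i ⁻¹ⁱ) (x ⁻¹ⁱ)) (≡.cong ((x ∙ⁱ j) ∙ⁱ_) (≡.sym (I.⁻¹-anti-homo-∙ x i))))

        right-invariant : ∀ x {i j} → Adj i j → Adj (i ∙ⁱ x) (j ∙ⁱ x)
        right-invariant x {i} {j} adj = ⇒adjacent (T-resp (reflexive (≡.cong elem quotient)) (adjacent⇒ adj))
          where
          quotient : j ∙ⁱ (i ⁻¹ⁱ) ≡ (j ∙ⁱ x) ∙ⁱ ((i ∙ⁱ x) ⁻¹ⁱ)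
          quotient = ≡.trans (≡.cong (_∙ⁱ (i ⁻¹ⁱ)) (≡.sym (I.cancelʳ-∙⁻¹ x j)))
            (≡.trans (I.assoc (j ∙ⁱ x) (x ⁻¹ⁱ) (i ⁻¹ⁱ)) (≡.cong ((j ∙ⁱ x) ∙ⁱ_) (≡.sym (I.⁻¹-anti-homo-∙ i x))))

        power-closed : ∀ u .{{_ : ℕ.NonZero u}} → Coprime u e → ∀ {x} → Adj εⁱ x → Adj εⁱ (x ^ⁱ u)
        power-closed u c {x} adj = ⇒adjacent (T-resp
          (trans (sym (elem-^ x u)) (reflexive (≡.cong elem (≡.sym (∙ε⁻¹ (x ^ⁱ u))))))
          (T-power u (u ℕ.^ proj₁ recurs) (elem∈ x) (trans (×-congʳ (u ℕ.^ proj₁ recurs) (sym (elem-^ x u)))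
              (trans (sym (elem-^ (x ^ⁱ u) (u ℕ.^ proj₁ recurs))) (reflexive (≡.cong elem
                (≡.trans (I.^-* x u (u ℕ.^ proj₁ recurs)) (≡.trans (≡.cong (x ^ⁱ_) (ℕₚ.*-comm (u ℕ.^ proj₁ recurs) u)) (proj₂ recurs x)))))))
            (T-resp (reflexive (≡.cong elem (∙ε⁻¹ x))) (adjacent⇒ adj))))
          where
          recurs = I.power-recurs exponent c
          ∙ε⁻¹ : ∀ y → y ∙ⁱ (εⁱ ⁻¹ⁱ) ≡ y
          ∙ε⁻¹ y = ≡.trans (≡.cong (y ∙ⁱ_) I.ε⁻¹≈ε) (I.identityʳ y)

      distance-integral : DistanceIntegral Adj
      distance-integral D isD μ (v , (p , vₚ#0) , Mv≈μv) = integer-decided μ λ stop →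
          eigenvector⇒character zero-or-invertible M μ M-left M-right v Mv≈μv (p , #ᶜ⇒≉0 vₚ#0) λ character →
            Integrality.eigenvalue-integer ℂ-commutativeRing zero-or-invertible fromℤ fromℤ-+ fromℤ-* fromℤ-neg fromℤ-0 fromℤ-1
              fromℤ-injective indexGroup exponent 1<e {lengthFunction} {M} {μ} {M-left} {M-right}
              length-^-power-invariant (λ x → CommutativeRing.refl ℂ-commutativeRing) character stop
        where
        open WordLength indexGroup exponent isD left-invariant right-invariant power-closed
        open EigenspaceCharacter ℂ-commutativeRing indexGroup using (eigenvector⇒character)
        M : Fin order → Fin order → ℂ
        M i j = fromℤ (+ D i j)
        M-left : ∀ x i j → CommutativeRing._≈_ ℂ-commutativeRing (M (x ∙ⁱ i) (x ∙ⁱ j)) (M i j)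
        M-left x i j = CommutativeRing.reflexive ℂ-commutativeRing (≡.cong (λ k → fromℤ (+ k)) (D-left x i j))
        M-right : ∀ x i j → CommutativeRing._≈_ ℂ-commutativeRing (M (i ∙ⁱ x) (j ∙ⁱ x)) (M i j)
        M-right x i j = CommutativeRing.reflexive ℂ-commutativeRing (≡.cong (λ k → fromℤ (+ k)) (D-right x i j))

  module Reflections {a ℓ : Level} (V : LeftModule ℂ-ring a ℓ) where
    open LeftModule V
    private
      module 𝒢 = Group (GL V)
      open module At (g : Automorphism V) = Automorphism g
    open Mult 𝒢.monoid using () renaming (_×_ to _×ᴳ_)

    dimension-resp : ∀ {p q} {P : Pred Carrierᴹ p} {Q : Pred Carrierᴹ q} {k} → P ⊆ Q → Q ⊆ P →
                     HasDimension V P k → HasDimension V Q k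
    dimension-resp P⊆Q Q⊆P dim = record
      { basis = basis ; basis∈ = λ i → P⊆Q (basis∈ i) ; independent = independent
      ; coord = λ Qv → coord (Q⊆P Qv) ; expansion = λ Qv → expansion (Q⊆P Qv) }
      where open HasDimension dim

    linComb-image : ∀ g {k} c (b : Fin k → Carrierᴹ) → linComb V c (⟦ g ⟧ ∘ b) ≈ᴹ ⟦ g ⟧ (linComb V c b)
    linComb-image g {zero}  c b = ≈ᴹ-sym (0ᴹ-homo g)
    linComb-image g {suc k} c b = ≈ᴹ-sym (≈ᴹ-trans (+ᴹ-homo g (c zero *ₗ b zero) (linComb V (c ∘ suc) (b ∘ suc)))
      (+ᴹ-cong (*ₗ-homo g (c zero) (b zero)) (≈ᴹ-sym (linComb-image g (c ∘ suc) (b ∘ suc)))))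

    dimension-image : ∀ {p q} {P : Pred Carrierᴹ p} {Q : Pred Carrierᴹ q} {k} g →
                      (∀ {v} → P v → Q (⟦ g ⟧ v)) → (∀ {v} → Q v → P (⟦ g 𝒢.⁻¹ ⟧ v)) →
                      HasDimension V P k → HasDimension V Q k
    dimension-image g P⇒Q Q⇒P dim = record
      { basis       = ⟦ g ⟧ ∘ basis
      ; basis∈      = λ i → P⇒Q (basis∈ i)
      ; independent = λ c eq → independent c (injective g (≈ᴹ-trans (≈ᴹ-sym (linComb-image g c basis))
                        (≈ᴹ-trans eq (≈ᴹ-sym (0ᴹ-homo g)))))
      ; coord       = λ Qv → coord (Q⇒P Qv)
      ; expansion   = λ {v} Qv → ≈ᴹ-trans (≈ᴹ-sym (𝒢.inverseʳ g v)) (≈ᴹ-trans (⟦⟧-cong g (expansion (Q⇒P Qv)))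
                        (≈ᴹ-sym (linComb-image g (coord (Q⇒P Qv)) basis)))
      }
      where open HasDimension dim

    Fixes : Automorphism V → Pred Carrierᴹ ℓ
    Fixes g v = ⟦ g ⟧ v ≈ᴹ v

    eigen⇒fixes : ∀ {g v} → Eigenspace V g 1ᶜ v → Fixes g v
    eigen⇒fixes {v = v} eq = ≈ᴹ-trans eq (*ₗ-identityˡ v)

    fixes⇒eigen : ∀ {g v} → Fixes g v → Eigenspace V g 1ᶜ v
    fixes⇒eigen {v = v} eq = ≈ᴹ-trans eq (≈ᴹ-sym (*ₗ-identityˡ v))

    fixes-× : ∀ k {g v} → Fixes g v → Fixes (k ×ᴳ g) v
    fixes-× zero        eq = ≈ᴹ-refl
    fixes-× (suc k) {g} eq = ≈ᴹ-trans (⟦⟧-cong g (fixes-× k {g} eq)) eq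

    fixes-⁻¹ : ∀ {g v} → Fixes g v → Fixes (g 𝒢.⁻¹) v
    fixes-⁻¹ {g} {v} eq = injective g (≈ᴹ-trans (𝒢.inverseʳ g v) (≈ᴹ-sym eq))

    module _ {n : ℕ} {dimV : HasDimension V U n} {w : Level} (G : ComplexReflectionGroup V dimV w) where
      open ComplexReflectionGroup G
      open IsSubgroup isSubgroup
      open IndexGroup (GL V) isSubgroup finite using (finite-order; distance-integral)

      FixedDimension : Automorphism V → Set _
      FixedDimension g = ∃ λ m → n ≡ suc m × HasDimension V (Eigenspace V g 1ᶜ) m

      same-fixed-space : ∀ {g h} → (∀ {v} → Fixes g v → Fixes h v) → (∀ {v} → Fixes h v → Fixes g v) →
                         FixedDimension g → FixedDimension h
      same-fixed-space {g} {h} g⇒h h⇒g (m , eq , dim) = m , eq , dimension-resp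
        (λ {v} → fixes⇒eigen {h} ∘ g⇒h ∘ eigen⇒fixes {g}) (λ {v} → fixes⇒eigen {g} ∘ h⇒g ∘ eigen⇒fixes {h}) dim

      reflection-resp : ∀ {g h} → g 𝒢.≈ h → Reflection g → Reflection h
      reflection-resp {g} {h} g≈h (Wg , _ , dim) = resp g≈h Wg , finite-order (resp g≈h Wg)
        , same-fixed-space {g} {h} (λ {v} → ≈ᴹ-trans (≈ᴹ-sym (g≈h v))) (λ {v} → ≈ᴹ-trans (g≈h v)) dim

      reflection-⁻¹ : ∀ {g} → Reflection g → Reflection (g 𝒢.⁻¹)
      reflection-⁻¹ {g} (Wg , _ , dim) = ⁻¹-closed Wg , finite-order (⁻¹-closed Wg)
        , same-fixed-space {g} {g 𝒢.⁻¹} (fixes-⁻¹ {g}) (λ {v} eq → ≈ᴹ-trans (⟦⟧-cong g (≈ᴹ-sym eq)) (𝒢.inverseʳ g v)) dim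

      reflection-conjugate : ∀ {x g} → W x → Reflection g → Reflection (x 𝒢.∙ g 𝒢.∙ x 𝒢.⁻¹)
      reflection-conjugate {x} {g} Wx (Wg , _ , m , eq , dim) = W-conjugate , finite-order W-conjugate , m , eq
        , dimension-image x
            (λ {v} → fixes⇒eigen {x 𝒢.∙ g 𝒢.∙ x 𝒢.⁻¹} ∘ image ∘ eigen⇒fixes {g})
            (λ {v} → fixes⇒eigen {g} ∘ preimage ∘ eigen⇒fixes {x 𝒢.∙ g 𝒢.∙ x 𝒢.⁻¹}) dim
        where
        W-conjugate = ∙-closed (∙-closed Wx Wg) (⁻¹-closed Wx)
        image : ∀ {v} → Fixes g v → Fixes (x 𝒢.∙ g 𝒢.∙ x 𝒢.⁻¹) (⟦ x ⟧ v)
        image {v} fixed = ⟦⟧-cong x (≈ᴹ-trans (⟦⟧-cong g (𝒢.inverseˡ x v)) fixed)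
        preimage : ∀ {v} → Fixes (x 𝒢.∙ g 𝒢.∙ x 𝒢.⁻¹) v → Fixes g (⟦ x 𝒢.⁻¹ ⟧ v)
        preimage {v} fixed = injective x (≈ᴹ-trans fixed (≈ᴹ-sym (𝒢.inverseʳ x v)))

      -- Since g is in turn a power of g^u, the two fix the same vectors.
      reflection-power : ∀ u → .{{_ : ℕ.NonZero u}} → ∀ v {g} → W g → v ×ᴳ (u ×ᴳ g) 𝒢.≈ g → Reflection g → Reflection (u ×ᴳ g)
      reflection-power u v {g} Wg root (_ , _ , dim) = W-power u , finite-order (W-power u)
        , same-fixed-space {g} {u ×ᴳ g} (fixes-× u {g}) (λ {x} eq → ≈ᴹ-trans (≈ᴹ-sym (root x)) (fixes-× v {u ×ᴳ g} eq)) dim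
        where
        W-power : ∀ k → W (k ×ᴳ g)
        W-power zero    = ε-closed
        W-power (suc k) = ∙-closed Wg (W-power k)

      reflection-distance-integral : DistanceIntegral (CayleyGraph (GL V) finite Reflection)
      reflection-distance-integral =
        distance-integral Reflection reflection-resp reflection-⁻¹ reflection-conjugate reflection-power

open ReflectionGroups

open import Defs
open import Relation.Unary using (U)
open import Algebra.Module.Bundles using (LeftModule)

theorem5p4 : {a ℓ w : Level} {n : ℕ} (V : LeftModule ℂ-ring a ℓ)
    (dimV : HasDimension V U n) (G : ComplexReflectionGroup V dimV w) →
    ComplexReflectionGroup.Irreducible G →
    DistanceIntegral (CayleyGraph (GL V) (ComplexReflectionGroup.finite G) (ComplexReflectionGroup.Reflection G))
theorem5p4 V dimV G _ = Reflections.reflection-distance-integral V G
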